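{- Let $\Gamma=(X,\mathcal E)$ be the Coxeter graph (the distance-regular graph with $28$ vertices and intersection array $\{3,2,2,1;1,1,1,2\}$); the spectrum of its adjacency matrix $A$ is $3^12^8(-1+\sqrt2)^6(-1)^7(-1-\sqrt2)^6$. Let $x\in X$ and $T=T(x)$. Order the three vertices of $\Gamma_1(x)$ arbitrarily. Order $\Gamma_2(x)$ as $y_1,\dots,y_6$ so that each of the pairs $\{y_1,y_2\},\{y_3,y_4\},\{y_5,y_6\}$ has a common neighbor in $\Gamma_1(x)$, the vertices $y_1,y_4,y_6$ are pairwise at distance 3, and the vertices $y_2,y_3,y_5$ are pairwise at distance 3. Order $\Gamma_3(x)$ as $z_1,\dots,z_{12}$ so that $z_{2j-1},z_{2j}$ are the neighbors of $y_j$ in $\Gamma_3(x)$ for $1\le j\le6$, and so that with $S=\{z_2,z_3,z_5,z_8,z_{10},z_{11}\}$ every edge inside $\Gamma_3(x)$ joins a vertex in $S$ to a vertex not in $S$, while for each vertex of $\Gamma_4(x)$ its two neighbors in $\Gamma_3(x)$ are both in $S$ or both not in $S$. Then the standard module $V=\mathbb C^X$ is an orthogonal direct sum of irreducible $T$-modules $V=W_0\oplus W_{1,a}\oplus W_{1,b}\oplus W_{2,a}\oplus W_{2,b}\oplus W_{2,c}\oplus W_{3,a}\oplus W_{3,b}$, where two summands are isomorphic if and only if they have the same type in the following list, and the data are as listed. Each listed basis is a pure basis of the module. For each summand other than $W_0$, the seed vector $\nu$ spans $E_r^*W$ (so $\dim E_r^*W=1$), where $r$ is the endpoint of the summand $W$,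 and is given by its essential part. Type I ($W_0$): endpoint 0, multiplicity 1, dimension 5, diameter 4, shape $(1,1,1,1,1)$; basis $e_0^*,\dots,e_4^*$; matrix representing $A$: $\begin{pmatrix}0&3&0&0&0\\1&0&2&0&0\\0&1&0&2&0\\0&0&1&1&1\\0&0&0&2&1\end{pmatrix}$, with eigenvalues $3,2,-1+\sqrt2,-1,-1-\sqrt2$. Type II ($W_{1,a},W_{1,b}$): endpoint 1, multiplicity 2, dimension 5, diameter 3, shape $(1,1,2,1)$; basis $\nu,A\nu,E_3^*A^2\nu,E_3^*A^3\nu,E_4^*A^3\nu$ (with $A\nu=E_2^*A\nu$), where $\nu=[1,-1,0]$ for $W_{1,a}$ and $\nu=[1,1,-2]$ for $W_{1,b}$; matrix representing $A$: $\begin{pmatrix}0&2&0&0&0\\1&0&2&-1&0\\0&1&0&1&0\\0&0&1&0&-1\\0&0&1&-2&1\end{pmatrix}$, with eigenvalues $2,2,-1+\sqrt2,-1,-1-\sqrt2$. Type III ($W_{2,a}$): endpoint 2, multiplicity 1, dimension 2, diameter 1, shape $(1,1)$; basis $\nu,A\nu$ (with $A\nu=E_3^*A\nu$), where $\nu=[1,-1,-1,1,-1,1]$; matrix representing $A$: $\begin{pmatrix}0&2\\1&1\end{pmatrix}$, with eigenvalues $2,-1$. Type IV ($W_{2,b},W_{2,c}$): endpoint 2, multiplicity 2, dimension 4, diameter 2, shape $(1,2,1)$; basis $\nu,A\nu,E_3^*A^2\nu,E_4^*A^2\nu$ (with $A\nu=E_3^*A\nu$), where $\nu=[1,-1,0,0,1,-1]$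 for $W_{2,b}$ and $\nu=[1,-1,2,-2,-1,1]$ for $W_{2,c}$; matrix representing $A$: $\begin{pmatrix}0&2&-1&0\\1&0&1&2\\0&1&0&1\\0&1&0&-1\end{pmatrix}$, with eigenvalues $2,-1+\sqrt2,-1,-1-\sqrt2$. Type V ($W_{3,a}$): endpoint 3, multiplicity 1, dimension 1, diameter 0, shape $(1)$; basis $\nu$, where $\nu=[-1,1,-1,1,-1,1,-1,1,1,-1,1,-1]$; matrix representing $A$: $\begin{pmatrix}-1\end{pmatrix}$, with eigenvalue $-1$. Type VI ($W_{3,b}$): endpoint 3, multiplicity 1, dimension 2, diameter 1, shape $(1,1)$; basis $\nu,E_4^*A\nu$, where $\nu=[-1,1,1,-1,1,-1,-1,1,-1,1,1,-1]$; matrix representing $A$: $\begin{pmatrix}-1&2\\1&-1\end{pmatrix}$, with eigenvalues $-1+\sqrt2,-1-\sqrt2$. Moreover $\dim T=5^2+5^2+2^2+4^2+1^2+2^2=75$.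
   Context: Let $\Gamma=(X,\mathcal E)$ be a finite undirected connected graph without loops or multiple edges, with path-length distance $d$ and diameter $D\ge1$; put $\Gamma_i(x)=\{y\in X:d(x,y)=i\}$. $\Gamma$ is distance-regular if for all $0\le h,i,j\le D$ the number $p^h_{i,j}=|\Gamma_i(y)\cap\Gamma_j(z)|$ is the same for all $y,z\in X$ with $d(y,z)=h$. Its intersection array is $\{b_0,\dots,b_{D-1};c_1,\dots,c_D\}$ with $b_i=p^i_{1,i+1}$, $c_i=p^i_{1,i-1}$. $A\in\mathrm{Mat}_X(\mathbb C)$ is the adjacency matrix; in its spectrum, exponents denote multiplicities. The standard module $V=\mathbb C^X$ (column vectors) carries the Hermitian inner product $\langle u,v\rangle=u^t\bar v$. Fix a base vertex $x\in X$. For $0\le i\le D$, $E_i^*=E_i^*(x)$ is the diagonal matrix with $(y,y)$-entry $1$ if $d(x,y)=i$ and $0$ otherwise, and $e_i^*\in V$ is the vector with $y$-entry $1$ if $d(x,y)=i$ and $0$ otherwise. The Terwilliger algebra $T=T(x)$ is the subalgebra of $\mathrm{Mat}_X(\mathbb C)$ generated by $A$ and $E_0^*,\dots,E_D^*$. A $T$-module is a subspace $W\subseteq V$ with $BW\subseteq W$ for all $B\in T$; it is irreducible if $W\ne0$ and it properly contains no nonzero $T$-module. Isomorphisms of $T$-modules are vector space isomorphisms commuting with every $B\in T$. The endpoint of $W$ is $r=\min\{i:E_i^*W\ne0\}$; the diameter of an irreducible $W$ is $\delta=|\{i:E_i^*W\ne0\}|-1$, and its shape is $(\dim E_r^*W,\dots,\dim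 E_{r+\delta}^*W)$. The multiplicity of an irreducible module is the number of summands isomorphic to it in an orthogonal decomposition of $V$ into irreducible $T$-modules. A nonzero vector is pure with support $i$ if it lies in $E_i^*V$; its essential part is the row vector of its coordinates at the vertices of $\Gamma_i(x)$, in the chosen order (all its other coordinates are $0$). A pure basis of an irreducible $T$-module is an ordered basis of pure vectors with weakly increasing supports. The matrix $B$ representing $A$ with respect to a basis $v_1,\dots,v_\ell$ is given by $Av_j=\sum_iB_{ij}v_i$. -}

module Defs where

open import Agda.Builtin.FromNat using (Number)
open import Agda.Builtin.FromNeg using (Negative)
open import Algebra.Apartness.Bundles using (HeytingCommutativeRing; HeytingField)
open import Algebra.Bundles using (CommutativeRing)
open import Algebra.Bundles.Raw using (RawRing)
open import Algebra.Definitions.RawMonoid as RawMonoidDefinitions using ()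
open import Data.Bool.Base using (if_then_else_; _∧_)
open import Data.Fin.Base using (Fin; zero; suc; toℕ; combine)
open import Data.Fin.Patterns using (0F; 1F; 2F; 3F; 4F; 5F)
open import Data.Fin.Properties using (any?) renaming (_≟_ to _≟ᶠ_)
open import Data.Fin.Subset using (Subset; inside; outside; ∣_∣; _∩_) renaming (_∈_ to _∈ˢ_; _∉_ to _∉ˢ_)
open import Data.Integer.Base using (ℤ; +_; -[1+_])
open import Data.Integer.Literals as ℤ-Literals using ()
open import Data.List.Base using (List)
open import Data.List.Relation.Unary.All using (All)
open import Data.List.Relation.Unary.AllPairs using (AllPairs)
open import Data.List.Relation.Unary.Any using (Any)
open import Data.Nat.Base using (ℕ; zero; suc; _≤_; _<_; s<s)
import Data.Nat.Base as ℕ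
open import Data.Nat.Literals as ℕ-Literals using ()
open import Data.Nat.Properties using (_≟_)
open import Data.Product.Base using (Σ; Σ-syntax; ∃; ∃-syntax; _×_; _,_; proj₁; proj₂)
open import Data.Sum.Base using (_⊎_)
open import Data.Vec.Base using (Vec; []; _∷_; lookup; tabulate)
open import Function.Base using (_∘_; _on_)
open import Function.Bundles using (_⇔_)
open import Function.Definitions using (Congruent; Bijective; Injective)
open import Level using (0ℓ)
open import Relation.Binary.Core using (Rel)
open import Relation.Binary.Definitions using (Irreflexive; Symmetric) renaming (Decidable to Decidable₂)
open import Relation.Binary.PropositionalEquality.Core using (_≡_; _≢_)
open import Relation.Binary.Structures using (IsStrictPartialOrder)
open import Relation.Nullary.Decidable.Core using (yes; no; does; _×-dec_)
open import Relation.Nullary.Negation.Core using (¬_)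
open import Relation.Unary using (Pred; Decidable; _∈_; _⊆_)

instance
  ℕ-number : Number ℕ
  ℕ-number = ℕ-Literals.number

  ℤ-number : Number ℤ
  ℤ-number = ℤ-Literals.number

  ℤ-negative : Negative ℤ
  ℤ-negative = ℤ-Literals.negative

Walk : ∀ {n} → Rel (Fin n) 0ℓ → ℕ → Rel (Fin n) 0ℓ
Walk Adj zero    y z = y ≡ z
Walk Adj (suc k) y z = ∃[ w ] (Adj y w × Walk Adj k w z)

walk? : ∀ {n} {Adj : Rel (Fin n) 0ℓ} → Decidable₂ Adj → ∀ k → Decidable₂ (Walk Adj k)
walk? adj? zero    y z = y ≟ᶠ z
walk? adj? (suc k) y z = any? λ w → adj? y w ×-dec walk? adj? k w z

record Graph (n : ℕ) : Set₁ where
  field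
    Adj       : Rel (Fin n) 0ℓ
    adj?      : Decidable₂ Adj
    irrefl    : Irreflexive _≡_ Adj
    sym       : Symmetric Adj
    connected : ∀ y z → ∃[ k ] Walk Adj k y z

-- `least P? k` is the least number satisfying P, provided that k does.
least : {P : Pred ℕ 0ℓ} → Decidable P → ℕ → ℕ
least P? zero    = zero
least P? (suc k) = if does (P? zero) then zero else suc (least (P? ∘ suc) k)

least-satisfies : {P : Pred ℕ 0ℓ} (P? : Decidable P) (k : ℕ) → P k → P (least P? k)
least-satisfies P? zero    p = p
least-satisfies P? (suc k) p with P? zero
... | yes p₀ = p₀
... | no  _  = least-satisfies (P? ∘ suc) k p

least-minimal : {P : Pred ℕ 0ℓ} (P? : Decidable P) (k : ℕ) →
                ∀ {j} → j < least P? k → ¬ P j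
least-minimal P? (suc k) j<l with P? zero
least-minimal P? (suc k) {zero}  _         | no ¬p₀ = ¬p₀
least-minimal P? (suc k) {suc j} (s<s j<l) | no _   = least-minimal (P? ∘ suc) k j<l

module _ {n : ℕ} (Γ : Graph n) where
  open Graph Γ

  dist : Fin n → Fin n → ℕ
  dist y z = least (λ k → walk? adj? k y z) (proj₁ (connected y z))

  dist-walk : ∀ y z → Walk Adj (dist y z) y z
  dist-walk y z = least-satisfies (λ k → walk? adj? k y z) _ (proj₂ (connected y z))

  dist-minimal : ∀ y z {k} → k < dist y z → ¬ Walk Adj k y z
  dist-minimal y z = least-minimal (λ k → walk? adj? k y z) (proj₁ (connected y z))

  sphere : ℕ → Fin n → Subset n
  sphere i y = tabulate λ z → does (dist y z ≟ i)

  HasDiameter : ℕ → Set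
  HasDiameter D = (∀ y z → dist y z ≤ D) × ∃[ y ] ∃[ z ] dist y z ≡ D

  record IsDistanceRegular (D : ℕ) : Set where
    field
      hasDiameter : HasDiameter D
      p           : ℕ → ℕ → ℕ → ℕ
      p-spec      : ∀ {h i j} → h ≤ D → i ≤ D → j ≤ D →
                    ∀ y z → dist y z ≡ h → ∣ sphere i y ∩ sphere j z ∣ ≡ p h i j

    -- The array {b₀,…,b_{D-1}; c₁,…,c_D}: the entry of cs at position i is c_{i+1}.
    HasIntersectionArray : Vec ℕ D → Vec ℕ D → Set
    HasIntersectionArray bs cs =
      (∀ i → p (toℕ i) 1 (suc (toℕ i)) ≡ lookup bs i) ×
      (∀ i → p (suc (toℕ i)) 1 (toℕ i) ≡ lookup cs i)

record IsCoxeterGraph (Γ : Graph 28) : Set where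
  field
    isDistanceRegular : IsDistanceRegular Γ 4

  open IsDistanceRegular isDistanceRegular public

  field
    intersectionArray : HasIntersectionArray (3 ∷ 2 ∷ 2 ∷ 1 ∷ []) (1 ∷ 1 ∷ 1 ∷ 2 ∷ [])

-- S = {z₂,z₃,z₅,z₈,z₁₀,z₁₁}, as a set of positions (position k holds z_{k+1}).
S : Subset 12
S = outside ∷ inside  ∷ inside ∷ outside ∷ inside ∷ outside ∷
    outside ∷ inside ∷ outside ∷ inside ∷ inside ∷ outside ∷ []

module _ {n : ℕ} (Γ : Graph n) (x : Fin n) where
  open Graph Γ

  Enumerates : ∀ {m} → (Fin m → Fin n) → ℕ → Set
  Enumerates o i =
    Injective _≡_ _≡_ o × (∀ w → dist Γ x w ≡ i ⇔ (∃[ j ] o j ≡ w))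

  -- Indices start at 0 here: y 0F is y₁.  The index `combine j e` is 2j + e, so
  -- y (combine j 0F), y (combine j 1F) are y_{2j+1}, y_{2j+2}, and likewise for z.
  record VertexOrdering : Set where
    field
      u : Fin 3 → Fin n
      y : Fin 6 → Fin n
      z : Fin 12 → Fin n

      u-enumerates : Enumerates u 1
      y-enumerates : Enumerates y 2
      z-enumerates : Enumerates z 3

      y-pairs : ∀ (j : Fin 3) →
                ∃[ w ] (dist Γ x w ≡ 1 × Adj w (y (combine {3} {2} j 0F)) × Adj w (y (combine {3} {2} j 1F)))

      y₁y₄ : dist Γ (y 0F) (y 3F) ≡ 3
      y₁y₆ : dist Γ (y 0F) (y 5F) ≡ 3
      y₄y₆ : dist Γ (y 3F) (y 5F) ≡ 3
      y₂y₃ : dist Γ (y 1F) (y 2F) ≡ 3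
      y₂y₅ : dist Γ (y 1F) (y 4F) ≡ 3
      y₃y₅ : dist Γ (y 2F) (y 4F) ≡ 3

      z-children : ∀ (j : Fin 6) w →
                   (Adj (y j) w × dist Γ x w ≡ 3) ⇔
                   (w ≡ z (combine {6} {2} j 0F) ⊎ w ≡ z (combine {6} {2} j 1F))

      Γ₃-edges : ∀ i j → Adj (z i) (z j) →
                 (i ∈ˢ S × j ∉ˢ S) ⊎ (i ∉ˢ S × j ∈ˢ S)

      Γ₄-neighbours : ∀ w → dist Γ x w ≡ 4 → ∀ i j → Adj w (z i) → Adj w (z j) →
                      (i ∈ˢ S × j ∈ˢ S) ⊎ (i ∉ˢ S × j ∉ˢ S)

-- An Archimedean, Cauchy complete ordered Heyting field.  Classically this
-- determines ℝ up to isomorphism; constructively the Cauchy reals are a model.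
record RealNumbers : Set₁ where
  infix 4 _<ᵣ_
  field
    heytingField : HeytingField 0ℓ 0ℓ 0ℓ

  open HeytingField heytingField public
  open CommutativeRing (HeytingCommutativeRing.commutativeRing heytingCommutativeRing)
    public using (+-rawMonoid)
  open RawMonoidDefinitions +-rawMonoid using () renaming (_×_ to _⨉_)

  fromℕ : ℕ → Carrier
  fromℕ k = k ⨉ 1#

  field
    _<ᵣ_                 : Rel Carrier 0ℓ
    isStrictPartialOrder : IsStrictPartialOrder _≈_ _<ᵣ_
    #⇔<⊎>                : ∀ a b → a # b ⇔ (a <ᵣ b ⊎ b <ᵣ a)
    +-monoˡ-<            : ∀ a {b c} → b <ᵣ c → b + a <ᵣ c + a
    *-positive           : ∀ {a b} → 0# <ᵣ a → 0# <ᵣ b → 0# <ᵣ a * b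
    archimedean          : ∀ a → ∃[ k ] a <ᵣ fromℕ k

  Within : Carrier → Rel Carrier 0ℓ
  Within ε a b = ((a - b) <ᵣ ε) × ((b - a) <ᵣ ε)

  IsCauchy : (ℕ → Carrier) → Set
  IsCauchy s = ∀ ε → 0# <ᵣ ε → ∃[ N ] (∀ i j → N ≤ i → N ≤ j → Within ε (s i) (s j))

  ConvergesTo : (ℕ → Carrier) → Carrier → Set
  ConvergesTo s l = ∀ ε → 0# <ᵣ ε → ∃[ N ] (∀ i → N ≤ i → Within ε (s i) l)

  field
    complete : ∀ s → IsCauchy s → ∃[ l ] ConvergesTo s l

  IsSquareRoot : Carrier → Carrier → Set
  IsSquareRoot a s = ¬ (s <ᵣ 0#) × s * s ≈ a

module Complex (R : RealNumbers) where
  private module ℝ = RealNumbers R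

  infix 5 _+i_
  record ℂ : Set where
    constructor _+i_
    field
      re im : ℝ.Carrier
  open ℂ public

  ℂ-rawRing : RawRing 0ℓ 0ℓ
  ℂ-rawRing = record
    { Carrier = ℂ
    ; _≈_     = λ a b → (re a ℝ.≈ re b) × (im a ℝ.≈ im b)
    ; _+_     = λ a b → (re a ℝ.+ re b) +i (im a ℝ.+ im b)
    ; _*_     = λ a b → ((re a ℝ.* re b) ℝ.- (im a ℝ.* im b)) +i ((re a ℝ.* im b) ℝ.+ (im a ℝ.* re b))
    ; -_      = λ a → (ℝ.- re a) +i (ℝ.- im a)
    ; 0#      = ℝ.0# +i ℝ.0#
    ; 1#      = ℝ.1# +i ℝ.0#
    }

  open RawRing ℂ-rawRing public using (_≈_; _+_; _*_; -_; 0#; 1#; +-rawMonoid)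
  open RawMonoidDefinitions +-rawMonoid public using (sum)

  infix 4 _#_
  _#_ : Rel ℂ 0ℓ
  a # b = (re a ℝ.# re b) ⊎ (im a ℝ.# im b)

  infixl 6 _-_
  _-_ : ℂ → ℂ → ℂ
  a - b = a + (- b)

  conj : ℂ → ℂ
  conj a = re a +i (ℝ.- im a)

  fromℝ : ℝ.Carrier → ℂ
  fromℝ a = a +i ℝ.0#

  fromℤ : ℤ → ℂ
  fromℤ (+ k)    = fromℝ (ℝ.fromℕ k)
  fromℤ -[1+ k ] = - fromℝ (ℝ.fromℕ (suc k))

  -- Vectors are indexed by an arbitrary type, so that the notions below apply
  -- both to subspaces of ℂ^X and to subspaces of Mat_X(ℂ) = ℂ^(X × X).
  ℂ^ : Set → Set
  ℂ^ I = I → ℂ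

  Matrix : ℕ → Set
  Matrix n = ℂ^ (Fin n × Fin n)

  module _ {I : Set} where
    infix  4 _≈ᵥ_ _#ᵥ_
    infixl 6 _+ᵥ_
    infixr 7 _*ₗ_

    _≈ᵥ_ _#ᵥ_ : Rel (ℂ^ I) 0ℓ
    v ≈ᵥ w = ∀ i → v i ≈ w i
    v #ᵥ w = ∃[ i ] v i # w i

    0ᵥ : ℂ^ I
    0ᵥ _ = 0#

    _+ᵥ_ : ℂ^ I → ℂ^ I → ℂ^ I
    (v +ᵥ w) i = v i + w i

    _*ₗ_ : ℂ → ℂ^ I → ℂ^ I
    (a *ₗ v) i = a * v i

    sumᵥ : ∀ {k} → (Fin k → ℂ^ I) → ℂ^ I
    sumᵥ v i = sum λ j → v j i

    record IsSubspace (W : Pred (ℂ^ I) 0ℓ) : Set where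
      field
        resp     : ∀ {v w} → v ≈ᵥ w → v ∈ W → w ∈ W
        0-closed : 0ᵥ ∈ W
        +-closed : ∀ {v w} → v ∈ W → w ∈ W → (v +ᵥ w) ∈ W
        *-closed : ∀ a {v} → v ∈ W → (a *ₗ v) ∈ W

    NonZero : Pred (ℂ^ I) 0ℓ → Set
    NonZero W = ∃[ v ] (v ∈ W × v #ᵥ 0ᵥ)

    record IsBasis (W : Pred (ℂ^ I) 0ℓ) {k : ℕ} (v : Fin k → ℂ^ I) : Set where
      field
        members     : ∀ j → v j ∈ W
        independent : ∀ (a : Fin k → ℂ) → sumᵥ (λ j → a j *ₗ v j) ≈ᵥ 0ᵥ → ∀ j → a j ≈ 0#
        spanning    : ∀ w → w ∈ W → Σ[ a ∈ (Fin k → ℂ) ] w ≈ᵥ sumᵥ (λ j → a j *ₗ v j)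

    HasDim : Pred (ℂ^ I) 0ℓ → ℕ → Set
    HasDim W k = Σ (Fin k → ℂ^ I) (IsBasis W)

  infixr 7 _·_
  _·_ : ∀ {n} → Matrix n → ℂ^ (Fin n) → ℂ^ (Fin n)
  (M · v) y = sum λ z → M (y , z) * v z

  infixl 7 _*ₘ_
  _*ₘ_ : ∀ {n} → Matrix n → Matrix n → Matrix n
  (M *ₘ N) (y , z) = sum λ w → M (y , w) * N (w , z)

  Iₘ : ∀ {n} → Matrix n
  Iₘ (y , z) = if does (y ≟ᶠ z) then 1# else 0#

  ⟨_,_⟩ : ∀ {n} → ℂ^ (Fin n) → ℂ^ (Fin n) → ℂ
  ⟨ u , v ⟩ = sum λ y → u y * conj (v y)

  image : ∀ {n} → Matrix n → Pred (ℂ^ (Fin n)) 0ℓ → Pred (ℂ^ (Fin n)) 0ℓ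
  image M W v = ∃[ w ] (w ∈ W × v ≈ᵥ M · w)

  fromRows : ∀ {k} → Vec (Vec ℤ k) k → Matrix k
  fromRows rows (i , j) = fromℤ (lookup (lookup rows i) j)

  Eigenspace : ∀ {n} → Matrix n → ℂ → Pred (ℂ^ (Fin n)) 0ℓ
  Eigenspace M θ v = M · v ≈ᵥ θ *ₗ v

  -- The pairs are the distinct eigenvalues with their multiplicities (dimensions
  -- of eigenspaces).  When these sum to the size of M, as in all uses here, M is
  -- diagonalizable and they are also the algebraic multiplicities.
  record HasSpectrum {n : ℕ} (M : Matrix n) (θs : List (ℂ × ℕ)) : Set where
    field
      distinct       : AllPairs (λ (θ , _) (θ′ , _) → θ # θ′) θs
      eigenvalues    : All (λ (θ , _) → NonZero (Eigenspace M θ)) θs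
      multiplicities : All (λ (θ , m) → HasDim (Eigenspace M θ) m) θs
      exhaustive     : ∀ θ → NonZero (Eigenspace M θ) → Any (λ (θ′ , _) → θ ≈ θ′) θs

  adjacencyMatrix : ∀ {n} → Graph n → Matrix n
  adjacencyMatrix Γ (y , z) = if does (Graph.adj? Γ y z) then 1# else 0#

  -- The vector with entry a_j at the vertex o j, and 0 at vertices outside o.
  fromEssential : ∀ {n m} → (Fin m → Fin n) → Vec ℤ m → ℂ^ (Fin n)
  fromEssential o a y = sum λ j → if does (o j ≟ᶠ y) then fromℤ (lookup a j) else 0#

-- D is the diameter of Γ and x the base vertex.
module Terwilliger (R : RealNumbers) {n : ℕ} (Γ : Graph n) (D : ℕ) (x : Fin n) where
  open Complex R

  V : Set
  V = ℂ^ (Fin n)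

  A : Matrix n
  A = adjacencyMatrix Γ

  E* : ℕ → Matrix n
  E* i (y , z) = if does (y ≟ᶠ z) ∧ does (dist Γ x y ≟ i) then 1# else 0#

  e* : ℕ → V
  e* i y = if does (dist Γ x y ≟ i) then 1# else 0#

  data T : Pred (Matrix n) 0ℓ where
    A∈T      : A ∈ T
    E*∈T     : ∀ {i} → i ≤ D → E* i ∈ T
    I∈T      : Iₘ ∈ T
    +-closed : ∀ {B C} → B ∈ T → C ∈ T → (B +ᵥ C) ∈ T
    *-closed : ∀ a {B} → B ∈ T → (a *ₗ B) ∈ T
    ∘-closed : ∀ {B C} → B ∈ T → C ∈ T → (B *ₘ C) ∈ T
    resp     : ∀ {B C} → B ≈ᵥ C → B ∈ T → C ∈ T

  record IsTModule (W : Pred V 0ℓ) : Set where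
    field
      isSubspace : IsSubspace W
      T-closed   : ∀ {B} → B ∈ T → ∀ {v} → v ∈ W → (B · v) ∈ W

  record IsIrreducible (W : Pred V 0ℓ) : Set₁ where
    field
      isTModule : IsTModule W
      nonZero   : NonZero W
      simple    : ∀ (U : Pred V 0ℓ) → IsTModule U → NonZero U → U ⊆ W → W ⊆ U

  infix 4 _≅_
  record _≅_ (W W′ : Pred V 0ℓ) : Set where
    field
      to            : ∃ W → ∃ W′
      cong          : Congruent (_≈ᵥ_ on proj₁) (_≈ᵥ_ on proj₁) to
      +-homo        : ∀ u v w → proj₁ w ≈ᵥ proj₁ u +ᵥ proj₁ v →
                      proj₁ (to w) ≈ᵥ proj₁ (to u) +ᵥ proj₁ (to v)
      *-homo        : ∀ a v w → proj₁ w ≈ᵥ a *ₗ proj₁ v → proj₁ (to w) ≈ᵥ a *ₗ proj₁ (to v)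
      T-equivariant : ∀ {B} → B ∈ T → ∀ v w → proj₁ w ≈ᵥ B · proj₁ v →
                      proj₁ (to w) ≈ᵥ B · proj₁ (to v)
      bijective     : Bijective (_≈ᵥ_ on proj₁) (_≈ᵥ_ on proj₁) to

  record IsOrthogonalDecomposition {m : ℕ} (W : Fin m → Pred V 0ℓ) : Set₁ where
    field
      irreducible : ∀ i → IsIrreducible (W i)
      orthogonal  : ∀ i j → i ≢ j → ∀ {v w} → v ∈ W i → w ∈ W j → ⟨ v , w ⟩ ≈ 0#
      spanning    : ∀ v → Σ[ w ∈ (Fin m → V) ] ((∀ i → w i ∈ W i) × v ≈ᵥ sumᵥ w)
      direct      : ∀ w → (∀ i → w i ∈ W i) → sumᵥ w ≈ᵥ 0ᵥ → ∀ i → w i ≈ᵥ 0ᵥ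

  -- By semisimplicity of V the count does not depend on the decomposition.
  HasMultiplicity : Pred V 0ℓ → ℕ → Set₁
  HasMultiplicity U m =
    ∃[ k ] Σ[ W ∈ (Fin k → Pred V 0ℓ) ] IsOrthogonalDecomposition W ×
      ∃[ s ] ((∀ i → i ∈ˢ s ⇔ (W i ≅ U)) × ∣ s ∣ ≡ m)

  HasEndpoint : Pred V 0ℓ → ℕ → Set
  HasEndpoint W r = NonZero (image (E* r) W) × (∀ i → i < r → ¬ NonZero (image (E* i) W))

  HasModuleDiameter : Pred V 0ℓ → ℕ → Set
  HasModuleDiameter W δ =
    ∃[ s ] ((∀ (i : Fin (suc D)) → i ∈ˢ s ⇔ NonZero (image (E* (toℕ i)) W)) × ∣ s ∣ ≡ suc δ)

  HasPureSupport : V → ℕ → Set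
  HasPureSupport v i = v #ᵥ 0ᵥ × ∃[ w ] v ≈ᵥ E* i · w

  record IsPureBasis (W : Pred V 0ℓ) {k : ℕ} (v : Fin k → V) : Set where
    field
      isBasis    : IsBasis W v
      support    : Fin k → ℕ
      pure       : ∀ j → support j ≤ D × HasPureSupport (v j) (support j)
      increasing : ∀ i j → toℕ i ≤ toℕ j → support i ≤ support j

  Represents : ∀ {k} → Matrix k → (Fin k → V) → Set
  Represents B v = ∀ j → A · v j ≈ᵥ sumᵥ (λ i → B (i , j) *ₗ v i)

  record ModuleData (W : Pred V 0ℓ) (endpoint multiplicity dimension diameter : ℕ)
                    (shape : Vec ℕ (suc diameter)) (basis : Vec V dimension)
                    (rows : Vec (Vec ℤ dimension) dimension)
                    (spectrum : List (ℂ × ℕ)) : Set₁ where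
    field
      hasEndpoint     : HasEndpoint W endpoint
      hasMultiplicity : HasMultiplicity W multiplicity
      hasDimension    : HasDim W dimension
      hasDiameter     : HasModuleDiameter W diameter
      hasShape        : ∀ j → HasDim (image (E* (endpoint ℕ.+ toℕ j)) W) (lookup shape j)
      isPureBasis     : IsPureBasis W (lookup basis)
      represents      : Represents (fromRows rows) (lookup basis)
      hasSpectrum     : HasSpectrum (fromRows rows) spectrum

  SeedOf : V → Pred V 0ℓ → ℕ → Set
  SeedOf ν W r = IsBasis (image (E* r) W) {1} (λ _ → ν)

data ModuleType : Set where
  typeI typeII typeIII typeIV typeV typeVI : ModuleType

{-# OPTIONS --safe #-}
module Submission where

-- The intersection array determines the distances from any vertex v of the three
-- neighbours of any vertex w.  Hence the girth is 7, and every path of length 3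
-- lies in exactly one 7-cycle.  With these facts, the order that the theorem
-- demands on Γ₂(x) exists (the other conceivable pattern, a hexagon, contradicts
-- them) and forces the edges inside Γ₃(x), then those to Γ₄(x), and finally those
-- inside Γ₄(x).  The condition on S then determines the order of
-- Γ₃(x) up to exchanging z_{2j-1} and z_{2j} for all j at once.  So, up to this
-- exchange and the order of Γ₁(x), everything happens in one explicit graph on 28
-- vertices, where the listed bases and the dual basis are integral up to a common
-- denominator.
--
-- A and the E*_i act on the eight blocks through one matrix per type, so T embeds
-- in the direct sum of six full matrix algebras.  T is all of it: once the modules
-- of smaller endpoint are dealt with, E*_r yields the matrix units at the seeds
-- (a closed walk from level r separates III from IV, and V from VI), and products
-- with E*_i A E*_j give the other ones.  Irreducibility, the
-- isomorphism classes and dim T follow, and the spectra are read off eigenbases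
-- with coordinates in ℤ[√2].

open import Algebra.Bundles using (CommutativeRing)
import Algebra.Properties.Ring as RingProperties
import Algebra.Properties.Semiring.Mult as SemiringMult
open import Data.Bool.Base using (_∧_; false; if_then_else_; true)
open import Data.Empty using (⊥-elim)
open import Data.Fin using (#_)
open import Data.Fin.Base using (Fin; remQuot; toℕ)
open import Data.Fin.Patterns
open import Data.Fin.Properties using (all?) renaming (_≟_ to _≟ᶠ_)
open import Data.Fin.Subset using () renaming (_∈_ to _∈ˢ_)
open import Data.Integer.Base as ℤ using (+_; -1ℤ; 0ℤ; 1ℤ; ℤ)
open import Data.Integer.Properties as ℤₚ using () renaming (_≟_ to _≟ᶻ_)
open import Data.List.Base using (List)
open import Data.List.Relation.Unary.All as All using (All)
import Data.List.Relation.Unary.All.Properties as Allₚ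
import Data.List.Relation.Unary.Any as Any
open import Data.Nat.Base as ℕ using (_≤_; s≤s; z≤n; ℕ)
open import Data.Nat.Properties as ℕₚ using (_≟_)
open import Data.Product.Base as Product using (_,_; _×_; proj₁; proj₂; Σ-syntax; ∃-syntax)
open import Data.Sum.Base as Sum using ([_,_]; [_,_]′; _⊎_; inj₁; inj₂)
open import Data.Unit.Base using (tt)
open import Data.Vec.Base using (Vec; lookup; tabulate)
open import Data.Vec.Properties using (lookup∘tabulate)
open import Function.Base using (_∘_; id)
open import Function.Bundles using (Equivalence; _⇔_; mk⇔)
open import Function.Definitions using (Injective)
open import Level using (0ℓ)
open import Relation.Binary.Definitions using (DecidableEquality)
import Relation.Binary.PropositionalEquality as ≡
import Relation.Binary.Reasoning.Setoid as SetoidReasoning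
open import Relation.Nullary.Decidable using (True; _→-dec_; dec-false; dec-true; from-yes; map′; toWitness)
open import Relation.Unary using (Pred)

module LocalStructure where

  open import Defs hiding (S)
  open import Data.Fin.Base using (zero; suc)
  open import Data.Fin.Properties using (pigeonhole; any?; <⇒≢; suc-injective)
  open import Data.Fin.Subset using (Subset; inside; outside; ∣_∣; _∩_)
  open import Data.Fin.Subset.Properties using (x∈p∩q⁺; x∈p∩q⁻)
  open import Data.Nat.Base using (zero; suc)
  open import Data.Vec.Base using ([]; _∷_; here; there)
  open import Data.Vec.Properties using ([]=⇒lookup; lookup⇒[]=)
  open import Function.Base using (case_of_)
  open import Relation.Binary.PropositionalEquality hiding ([_])
  open import Relation.Nullary

  does-true : ∀ {P : Set} (P? : Dec P) → does P? ≡ true → P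
  does-true (yes p) _ = p

  record Enumeration {n : ℕ} (P : Pred (Fin n) 0ℓ) (k : ℕ) : Set where
    field
      at        : Fin k → Fin n
      injective : Injective _≡_ _≡_ at
      sound     : ∀ i → P (at i)
      complete  : ∀ {t} → P t → ∃[ i ] at i ≡ t

  enumerate : ∀ {n} (s : Subset n) → Enumeration (_∈ˢ s) ∣ s ∣
  enumerate [] = record { at = λ () ; injective = λ { {()} } ; sound = λ () ; complete = λ () }
  enumerate (outside ∷ s) = record
    { at        = suc ∘ at
    ; injective = injective ∘ suc-injective
    ; sound     = there ∘ sound
    ; complete  = λ { (there t∈s) → let i , eq = complete t∈s in i , cong suc eq }
    } where open Enumeration (enumerate s)
  enumerate {suc n} (inside ∷ s) = record
    { at        = at′
    ; injective = λ {i} {j} → injective′ i j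
    ; sound     = λ { zero → here ; (suc i) → there (sound i) }
    ; complete  = λ { here → zero , refl ; (there t∈s) → let i , eq = complete t∈s in suc i , cong suc eq }
    }
    where
    open Enumeration (enumerate s)
    at′ : Fin (suc ∣ s ∣) → Fin (suc n)
    at′ zero    = zero
    at′ (suc i) = suc (at i)
    injective′ : ∀ i j → at′ i ≡ at′ j → i ≡ j
    injective′ zero    zero    _  = refl
    injective′ (suc i) (suc j) eq = cong suc (injective (suc-injective eq))

  module _ {n : ℕ} {P : Pred (Fin n) 0ℓ} {k : ℕ} (E : Enumeration P k) where
    open Enumeration E

    map-enumeration : ∀ {Q : Pred (Fin n) 0ℓ} → (∀ {t} → P t → Q t) → (∀ {t} → Q t → P t) → Enumeration Q k
    map-enumeration f g = record { at = at ; injective = injective ; sound = f ∘ sound ; complete = complete ∘ g }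

    injection-covers : (f : Fin k → Fin n) → Injective _≡_ _≡_ f → (∀ i → P (f i)) →
                       ∀ {t} → P t → ∃[ i ] f i ≡ t
    injection-covers f f-inj f-sound {t} p = decidable-stable (any? λ i → f i ≟ᶠ t) λ missed →
      let i , j , i<j , eq = pigeonhole ℕₚ.≤-refl (λ i → proj₁ (complete (sound′ i)))
      in <⇒≢ i<j (injective′ missed i j
           (trans (sym (proj₂ (complete (sound′ i)))) (trans (cong at eq) (proj₂ (complete (sound′ j))))))
      where
      open import Relation.Nullary.Decidable using (decidable-stable)
      f′ : Fin (suc k) → Fin n
      f′ zero    = t
      f′ (suc i) = f i
      sound′ : ∀ i → P (f′ i)
      sound′ zero    = p
      sound′ (suc i) = f-sound i
      injective′ : ¬ (∃[ i ] f i ≡ t) → ∀ i j → f′ i ≡ f′ j → i ≡ j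
      injective′ missed zero    zero    _  = refl
      injective′ missed zero    (suc j) eq = contradiction (j , sym eq) missed
      injective′ missed (suc i) zero    eq = contradiction (i , eq) missed
      injective′ missed (suc i) (suc j) eq = cong suc (f-inj eq)

  -- The distances from v of the neighbours of a vertex at distance h from v.
  neighbourLevels : Fin 5 → Vec ℕ 3
  neighbourLevels 0F = 1 ∷ 1 ∷ 1 ∷ []
  neighbourLevels 1F = 0 ∷ 2 ∷ 2 ∷ []
  neighbourLevels 2F = 1 ∷ 3 ∷ 3 ∷ []
  neighbourLevels 3F = 2 ∷ 4 ∷ 3 ∷ []
  neighbourLevels 4F = 3 ∷ 3 ∷ 4 ∷ []

  module Distance {n : ℕ} (Γ : Graph n) where
    open Graph Γ using (Adj; irrefl) renaming (sym to Adj-sym) public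

    d : Fin n → Fin n → ℕ
    d = dist Γ

    snoc : ∀ {v w t} k → Walk Adj k v w → Adj w t → Walk Adj (suc k) v t
    snoc zero    refl          a = _ , a , refl
    snoc (suc k) (s , b , ws)  a = s , b , snoc k ws a

    reverse : ∀ {v w} k → Walk Adj k v w → Walk Adj k w v
    reverse zero    refl         = refl
    reverse (suc k) (s , b , ws) = snoc k (reverse k ws) (Adj-sym b)

    d-≤ : ∀ {v w} k → Walk Adj k v w → d v w ≤ k
    d-≤ {v} {w} k ws = ℕₚ.≮⇒≥ λ k<d → dist-minimal Γ v w k<d ws

    d-sym : ∀ v w → d v w ≡ d w v
    d-sym v w = ℕₚ.≤-antisym (d-≤ _ (reverse _ (dist-walk Γ w v))) (d-≤ _ (reverse _ (dist-walk Γ v w)))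

    d-step : ∀ {v w t} → Adj w t → d v t ≤ suc (d v w)
    d-step {v} {w} a = d-≤ _ (snoc _ (dist-walk Γ v w) a)

    d-refl : ∀ v → d v v ≡ 0
    d-refl v = ℕₚ.n≤0⇒n≡0 (d-≤ 0 refl)

    d≡0⇒≡ : ∀ {v w} → d v w ≡ 0 → v ≡ w
    d≡0⇒≡ {v} {w} eq = subst (λ k → Walk Adj k v w) eq (dist-walk Γ v w)

    Adj⇒d≡1 : ∀ {v w} → Adj v w → d v w ≡ 1
    Adj⇒d≡1 {v} {w} a with d v w in eq | d-≤ 1 (w , a , refl)
    ... | 0 | _ = contradiction a (irrefl (d≡0⇒≡ eq))
    ... | 1 | _ = refl
    ... | suc (suc _) | s≤s ()

    d≡1⇒Adj : ∀ {v w} → d v w ≡ 1 → Adj v w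
    d≡1⇒Adj {v} {w} eq with subst (λ k → Walk Adj k v w) eq (dist-walk Γ v w)
    ... | s , a , refl = a

    ∈sphere⁺ : ∀ {i v w} → d v w ≡ i → w ∈ˢ sphere Γ i v
    ∈sphere⁺ {i} {v} {w} eq =
      lookup⇒[]= w _ (trans (lookup∘tabulate _ w) (dec-true (d v w ≟ i) eq))

    ∈sphere⁻ : ∀ {i v w} → w ∈ˢ sphere Γ i v → d v w ≡ i
    ∈sphere⁻ {i} {v} {w} w∈ = does-true (d v w ≟ i) (trans (sym (lookup∘tabulate _ w)) ([]=⇒lookup w∈))

    enumerate-neighbours-at : ∀ v w k → Enumeration (λ t → Adj w t × d v t ≡ k) ∣ sphere Γ 1 w ∩ sphere Γ k v ∣
    enumerate-neighbours-at v w k = map-enumeration (enumerate (sphere Γ 1 w ∩ sphere Γ k v))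
      (λ t∈ → let t∈₁ , t∈₂ = x∈p∩q⁻ (sphere Γ 1 w) (sphere Γ k v) t∈ in d≡1⇒Adj (∈sphere⁻ t∈₁) , ∈sphere⁻ t∈₂)
      (λ { (a , eq) → x∈p∩q⁺ (∈sphere⁺ (Adj⇒d≡1 a) , ∈sphere⁺ eq) })

    record Star (v w : Fin n) (levels : Vec ℕ 3) : Set where
      field
        at        : Fin 3 → Fin n
        injective : Injective _≡_ _≡_ at
        adjacent  : ∀ i → Adj w (at i)
        complete  : ∀ {t} → Adj w t → ∃[ i ] at i ≡ t
        level     : ∀ i → d v (at i) ≡ lookup levels i

    record HasNeighbourLevels : Set where
      field
        neighbours : ∀ w → Enumeration (Adj w) 3
        star     : ∀ h {v w} → d v w ≡ toℕ h → Star v w (neighbourLevels h)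
        diameter : ∀ v w → d v w ≤ 4

  module Regular (Γ : Graph 28) (coxeter : IsCoxeterGraph Γ) where
    open Distance Γ public
    open IsCoxeterGraph coxeter

    neighbours-at : ∀ {v w h k} c → h ≤ 4 → k ≤ 4 → d v w ≡ h → p h 1 k ≡ c →
                    Enumeration (λ t → Adj w t × d v t ≡ k) c
    neighbours-at {v} {w} c h≤4 k≤4 eq refl =
      subst (Enumeration _) (p-spec h≤4 (s≤s z≤n) k≤4 w v (trans (d-sym w v) eq)) (enumerate-neighbours-at v w _)

    neighbours : ∀ w → Enumeration (Adj w) 3
    neighbours w = map-enumeration
      (neighbours-at 3 z≤n (s≤s z≤n) (d-refl w) (proj₁ intersectionArray 0F))
      proj₁ (λ a → a , Adj⇒d≡1 a)

    module _ {v w : Fin 28} where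

      star-from : (at : Fin 3 → Fin 28) → Injective _≡_ _≡_ at → (∀ i → Adj w (at i)) →
             ∀ {levels} → (∀ i → d v (at i) ≡ lookup levels i) → Star v w levels
      star-from at inj adj lev = record
        { at = at ; injective = inj ; adjacent = adj ; level = lev
        ; complete = injection-covers (neighbours w) at inj adj }

      separate : ∀ {s t k l} → d v s ≡ k → d v t ≡ l → k ≢ l → s ≢ t
      separate eq eq′ k≢l refl = k≢l (trans (sym eq) eq′)

      injective₃ : (at : Fin 3 → Fin 28) → at 0F ≢ at 1F → at 0F ≢ at 2F → at 1F ≢ at 2F → Injective _≡_ _≡_ at
      injective₃ at n₀₁ n₀₂ n₁₂ {i} {j} = go i j
        where
        go : ∀ i j → at i ≡ at j → i ≡ j
        go 0F 0F _  = refl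
        go 0F 1F eq = contradiction eq n₀₁
        go 0F 2F eq = contradiction eq n₀₂
        go 1F 0F eq = contradiction (sym eq) n₀₁
        go 1F 1F _  = refl
        go 1F 2F eq = contradiction eq n₁₂
        go 2F 0F eq = contradiction (sym eq) n₀₂
        go 2F 1F eq = contradiction (sym eq) n₁₂
        go 2F 2F _  = refl

      star-1+2 : ∀ {h k l} → h ≤ 4 → k ≤ 4 → l ≤ 4 → d v w ≡ h →
                 p h 1 k ≡ 1 → p h 1 l ≡ 2 → k ≢ l → Star v w (k ∷ l ∷ l ∷ [])
      star-1+2 h≤4 k≤4 l≤4 eq pk pl k≢l =
        star-from at (injective₃ at (separate (proj₂ (sound K 0F)) (proj₂ (sound L 0F)) k≢l)
                               (separate (proj₂ (sound K 0F)) (proj₂ (sound L 1F)) k≢l)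
                               (λ eq → case injective L eq of λ ()))
             (λ { 0F → proj₁ (sound K 0F) ; 1F → proj₁ (sound L 0F) ; 2F → proj₁ (sound L 1F) })
             (λ { 0F → proj₂ (sound K 0F) ; 1F → proj₂ (sound L 0F) ; 2F → proj₂ (sound L 1F) })
        where
        open Enumeration renaming (at to _‼_)
        K = neighbours-at 1 h≤4 k≤4 eq pk
        L = neighbours-at 2 h≤4 l≤4 eq pl
        at : Fin 3 → Fin 28
        at 0F = K ‼ 0F
        at 1F = L ‼ 0F
        at 2F = L ‼ 1F

      another : (s t : Fin 28) → ∃[ r ] (Adj w r × s ≢ r × t ≢ r)
      another s t = case any? (λ i → ¬? (s ≟ᶠ at i) ×-dec ¬? (t ≟ᶠ at i)) of λ where
          (yes (i , s≢ , t≢)) → at i , sound i , s≢ , t≢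
          (no none) →
            let i , j , i<j , eq = pigeonhole {2} {3} ℕₚ.≤-refl (proj₁ ∘ which none)
            in contradiction (injective (trans (sym (proj₂ (which none i))) (trans (cong pick eq) (proj₂ (which none j)))))
                             (<⇒≢ i<j)
        where
        open Enumeration (neighbours w)
        pick : Fin 2 → Fin 28
        pick 0F = s
        pick 1F = t
        which : ¬ (∃[ i ] (s ≢ at i × t ≢ at i)) → ∀ i → ∃[ j ] pick j ≡ at i
        which none i with s ≟ᶠ at i | t ≟ᶠ at i
        ... | yes eq | _      = 0F , eq
        ... | no _   | yes eq = 1F , eq
        ... | no s≢  | no t≢  = contradiction (i , s≢ , t≢) none

      star₀ : d v w ≡ 0 → Star v w (neighbourLevels 0F)
      star₀ eq with d≡0⇒≡ eq
      ... | refl = star-from at injective sound (λ { 0F → Adj⇒d≡1 (sound 0F) ; 1F → Adj⇒d≡1 (sound 1F) ; 2F → Adj⇒d≡1 (sound 2F) })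
        where open Enumeration (neighbours w)

      star₁ : d v w ≡ 1 → Star v w (neighbourLevels 1F)
      star₁ eq = star-1+2 (s≤s z≤n) z≤n (s≤s (s≤s z≤n)) eq (proj₂ intersectionArray 0F) (proj₁ intersectionArray 1F) λ ()

      star₂ : d v w ≡ 2 → Star v w (neighbourLevels 2F)
      star₂ eq = star-1+2 (s≤s (s≤s z≤n)) (s≤s z≤n) (s≤s (s≤s (s≤s z≤n))) eq (proj₂ intersectionArray 1F) (proj₁ intersectionArray 2F) λ ()

      private
        between : ∀ {k h t} → d v w ≡ suc h → Adj w t → d v t ≡ k → h ≤ k × k ≤ suc (suc h)
        between eq a refl = ℕₚ.≤-pred (subst (ℕ._≤ suc (d v _)) eq (d-step (Adj-sym a))) , subst (λ k → d v _ ≤ suc k) eq (d-step a)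

      star₃ : d v w ≡ 3 → Star v w (neighbourLevels 3F)
      star₃ eq = star-from at (injective₃ at (separate (proj₂ (sound C 0F)) (proj₂ (sound B 0F)) λ ()) c≢ b≢)
                      (λ { 0F → proj₁ (sound C 0F) ; 1F → proj₁ (sound B 0F) ; 2F → adj })
                      (λ { 0F → proj₂ (sound C 0F) ; 1F → proj₂ (sound B 0F) ; 2F → level })
        where
        open Enumeration renaming (at to _‼_)
        3≤4 = s≤s (s≤s (s≤s z≤n))
        C = neighbours-at 1 3≤4 (s≤s (s≤s z≤n)) eq (proj₂ intersectionArray 2F)
        B = neighbours-at 1 3≤4 ℕₚ.≤-refl eq (proj₁ intersectionArray 3F)
        third = another (C ‼ 0F) (B ‼ 0F)
        r   = proj₁ third
        adj = proj₁ (proj₂ third)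
        c≢  = proj₁ (proj₂ (proj₂ third))
        b≢  = proj₂ (proj₂ (proj₂ third))
        level-is : ∀ k → d v r ≡ k → k ≡ 3
        level-is 2 eq′ = case complete C (adj , eq′) of λ { (0F , same) → contradiction same c≢ }
        level-is 3 _   = refl
        level-is 4 eq′ = case complete B (adj , eq′) of λ { (0F , same) → contradiction same b≢ }
        level-is 0 eq′ = contradiction (proj₁ (between eq adj eq′)) λ ()
        level-is 1 eq′ = contradiction (proj₁ (between eq adj eq′)) λ { (s≤s ()) }
        level-is (suc (suc (suc (suc (suc k))))) eq′ =
          contradiction (proj₂ (between eq adj eq′)) λ { (s≤s (s≤s (s≤s (s≤s ())))) }
        level = level-is _ refl
        at : Fin 3 → Fin 28
        at 0F = C ‼ 0F
        at 1F = B ‼ 0F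
        at 2F = r

      star₄ : d v w ≡ 4 → Star v w (neighbourLevels 4F)
      star₄ eq = star-from at (injective₃ at (λ same → case injective C same of λ ()) n₀ n₁)
                      (λ { 0F → proj₁ (sound C 0F) ; 1F → proj₁ (sound C 1F) ; 2F → adj })
                      (λ { 0F → proj₂ (sound C 0F) ; 1F → proj₂ (sound C 1F) ; 2F → level })
        where
        open Enumeration renaming (at to _‼_)
        C = neighbours-at 2 ℕₚ.≤-refl (s≤s (s≤s (s≤s z≤n))) eq (proj₂ intersectionArray 3F)
        third = another (C ‼ 0F) (C ‼ 1F)
        r   = proj₁ third
        adj = proj₁ (proj₂ third)
        n₀  = proj₁ (proj₂ (proj₂ third))
        n₁  = proj₂ (proj₂ (proj₂ third))
        level-is : ∀ k → d v r ≡ k → k ≡ 4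
        level-is 3 eq′ = case complete C (adj , eq′) of λ where
                           (0F , same) → contradiction same n₀
                           (1F , same) → contradiction same n₁
        level-is 4 _   = refl
        level-is 0 eq′ = contradiction (proj₁ (between eq adj eq′)) λ ()
        level-is 1 eq′ = contradiction (proj₁ (between eq adj eq′)) λ { (s≤s ()) }
        level-is 2 eq′ = contradiction (proj₁ (between eq adj eq′)) λ { (s≤s (s≤s ())) }
        level-is (suc (suc (suc (suc (suc k))))) eq′ =
          contradiction (subst (ℕ._≤ 4) eq′ (proj₁ hasDiameter v r)) λ { (s≤s (s≤s (s≤s (s≤s ())))) }
        level = level-is _ refl
        at : Fin 3 → Fin 28
        at 0F = C ‼ 0F
        at 1F = C ‼ 1F
        at 2F = r

    hasNeighbourLevels : HasNeighbourLevels
    hasNeighbourLevels = record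
      { neighbours = neighbours
      ; star     = λ { 0F → star₀ ; 1F → star₁ ; 2F → star₂ ; 3F → star₃ ; 4F → star₄ }
      ; diameter = proj₁ hasDiameter
      }

module ShortCycles where

  open import Defs hiding (S)
  open LocalStructure
  open import Data.List.Base using ([]; _∷_; concatMap; map; filter)
  open import Data.List.Relation.Unary.All using ([]; _∷_)
  open import Data.List.Relation.Unary.Any using (Any; here; there)
  open import Data.Vec.Base using ([]; _∷_)
  open import Relation.Binary.PropositionalEquality hiding ([_])
  open import Relation.Nullary

  Single : Vec ℕ 3 → ℕ → Set
  Single ls k = ∀ i j → lookup ls i ≡ k → lookup ls j ≡ k → i ≡ j

  single? : ∀ ls k → Dec (Single ls k)
  single? ls k = all? λ i → all? λ j → (lookup ls i ≟ k) →-dec ((lookup ls j ≟ k) →-dec (i ≟ᶠ j))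

  module Geodesics {n : ℕ} (Γ : Graph n) (levels : Distance.HasNeighbourLevels Γ) where
    open Distance Γ public
    open Distance.HasNeighbourLevels levels public

    neighbour-level : ∀ {v w t ls} → Star v w ls → Adj w t → ∃[ i ] d v t ≡ lookup ls i
    neighbour-level star a with Star.complete star a
    ... | i , refl = i , Star.level star i

    single-neighbour : ∀ {v w s t ls} k {_ : True (single? ls k)} → Star v w ls →
                       Adj w s → Adj w t → d v s ≡ k → d v t ≡ k → s ≡ t
    single-neighbour k {single} star as at ds dt with Star.complete star as | Star.complete star at
    ... | i , refl | j , refl = cong (Star.at star)
      (toWitness single i j (trans (sym (Star.level star i)) ds) (trans (sym (Star.level star j)) dt))

    two-path : ∀ {v a b} → Adj v a → Adj a b → v ≢ b → d v b ≡ 2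
    two-path va ab v≢b with Star.complete s ab | Star.level s
      where s = star 1F (Adj⇒d≡1 va)
    ... | 0F , refl | lev = contradiction (d≡0⇒≡ (lev 0F)) v≢b
    ... | 1F , refl | lev = lev 1F
    ... | 2F , refl | lev = lev 2F

    three-path : ∀ {v a b w} → Adj v a → Adj a b → Adj b w → v ≢ b → a ≢ w → d v w ≡ 3
    three-path {v} {a} {b} {w} va ab bw v≢b a≢w with neighbour-level s bw
      where s = star 2F (two-path va ab v≢b)
    ... | 0F , eq = contradiction
      (single-neighbour 1 (star 2F (two-path va ab v≢b)) (Adj-sym ab) bw (Adj⇒d≡1 va) eq) a≢w
    ... | 1F , eq = eq
    ... | 2F , eq = eq

  -- A configuration of labelled vertices is refuted by two distinct geodesics of
  -- length 3 between the same vertices, by a path of length 3 between vertices at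
  -- distance 2, or by two 7-cycles with a common path of length 3.
  module Configuration {L : Set} (_≟ᴸ_ : DecidableEquality L) (edges : List (L × L)) where

    neighboursIn : List (L × L) → L → List L
    neighboursIn []            v = []
    neighboursIn ((s , t) ∷ E) v with s ≟ᴸ v | t ≟ᴸ v
    ... | yes _ | _     = t ∷ neighboursIn E v
    ... | no _  | yes _ = s ∷ neighboursIn E v
    ... | no _  | no _  = neighboursIn E v

    extend : L → L → List L
    extend prev v = filter (λ w → ¬? (prev ≟ᴸ w)) (neighboursIn edges v)

    paths₂ : L → List (L × L)
    paths₂ v = concatMap (λ a → map (a ,_) (extend v a)) (neighboursIn edges v)

    paths₃ : L → List (L × L × L)
    paths₃ v = concatMap (λ (a , b) → map (λ w → a , b , w) (extend a b)) (paths₂ v)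

    Bigon Theta : List (L × L × L) → Set
    Bigon ps = Any (λ (_ , b , w) → Any (λ (_ , b′ , w′) → w ≡ w′ × b ≢ b′) ps) ps
    Theta ps = Any (λ (_ , _ , w) → Any (λ s → Any (λ (_ , _ , s′) → s ≡ s′) ps ×
                 Any (λ t → s ≢ t × Any (λ (_ , _ , t′) → t ≡ t′) ps) (neighboursIn edges w)) (neighboursIn edges w)) ps

    Pentagon : List (L × L × L) → List (L × L) → Set
    Pentagon ps qs = Any (λ (_ , b , w) → Any (λ (_ , w′) → w ≡ w′) qs) ps

    Violation : L → Set
    Violation v = Bigon (paths₃ v) ⊎ Pentagon (paths₃ v) (paths₂ v) ⊎ Theta (paths₃ v)

    bigon? : ∀ ps → Dec (Bigon ps)
    bigon? ps = Any.any? (λ (_ , b , w) → Any.any? (λ (_ , b′ , w′) → (w ≟ᴸ w′) ×-dec ¬? (b ≟ᴸ b′)) ps) ps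

    pentagon? : ∀ ps qs → Dec (Pentagon ps qs)
    pentagon? ps qs = Any.any? (λ (_ , b , w) → Any.any? (λ (_ , w′) → w ≟ᴸ w′) qs) ps

    theta? : ∀ ps → Dec (Theta ps)
    theta? ps = Any.any? (λ (_ , _ , w) → theta-at (neighboursIn edges w)) ps
      where
      reached? : ∀ s → Dec (Any (λ (_ , _ , s′) → s ≡ s′) ps)
      reached? s = Any.any? (λ (_ , _ , s′) → s ≟ᴸ s′) ps
      theta-at : ∀ ns → Dec (Any (λ s → Any (λ (_ , _ , s′) → s ≡ s′) ps ×
                   Any (λ t → s ≢ t × Any (λ (_ , _ , t′) → t ≡ t′) ps) ns) ns)
      theta-at ns = Any.any? (λ s → reached? s ×-dec Any.any? (λ t → ¬? (s ≟ᴸ t) ×-dec reached? t) ns) ns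

    violation? : ∀ v → Dec (Violation v)
    violation? v = go (paths₃ v) (paths₂ v)
      where
      go : ∀ ps qs → Dec (Bigon ps ⊎ Pentagon ps qs ⊎ Theta ps)
      go ps qs = bigon? ps ⊎-dec (pentagon? ps qs ⊎-dec theta? ps)

  module Refutation {n : ℕ} (Γ : Graph n) (levels : Distance.HasNeighbourLevels Γ) {L : Set} (_≟ᴸ_ : DecidableEquality L)
    (vertex : L → Fin n) (vertex-injective : Injective _≡_ _≡_ vertex) (edges : List (L × L))
    (valid : All (λ (s , t) → Graph.Adj Γ (vertex s) (vertex t)) edges) where
    open Geodesics Γ levels
    open Configuration _≟ᴸ_ edges

    neighboursIn-sound : ∀ {E} → All (λ (s , t) → Adj (vertex s) (vertex t)) E →
                         ∀ v → All (Adj (vertex v) ∘ vertex) (neighboursIn E v)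
    neighboursIn-sound []                      v = []
    neighboursIn-sound {(s , t) ∷ E} (a ∷ as) v with s ≟ᴸ v | t ≟ᴸ v
    ... | yes refl | _        = a ∷ neighboursIn-sound as v
    ... | no _     | yes refl = Adj-sym a ∷ neighboursIn-sound as v
    ... | no _     | no _     = neighboursIn-sound as v

    private
      extend-sound : ∀ u v → All (λ w → Adj (vertex v) (vertex w) × vertex u ≢ vertex w) (extend u v)
      extend-sound u v = All.zip ( Allₚ.filter⁺ _ (neighboursIn-sound valid v)
                                 , All.map (λ u≢w eq → u≢w (vertex-injective eq)) (Allₚ.all-filter _ (neighboursIn edges v)))

      paths₂-sound : ∀ v → All (λ (a , b) → Adj (vertex v) (vertex a) × Adj (vertex a) (vertex b) × vertex v ≢ vertex b) (paths₂ v)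
      paths₂-sound v = Allₚ.concat⁺ (Allₚ.map⁺ (All.map
        (λ {a} va → Allₚ.map⁺ (All.map (λ (ab , v≢b) → va , ab , v≢b) (extend-sound v a))) (neighboursIn-sound valid v)))

      paths₃-sound : ∀ v → All (λ (a , b , w) → d (vertex v) (vertex b) ≡ 2 × Adj (vertex b) (vertex w) × d (vertex v) (vertex w) ≡ 3) (paths₃ v)
      paths₃-sound v = Allₚ.concat⁺ (Allₚ.map⁺ (All.map
        (λ {(a , b)} (va , ab , v≢b) → Allₚ.map⁺ (All.map
          (λ (bw , a≢w) → two-path va ab v≢b , bw , three-path va ab bw v≢b a≢w) (extend-sound a b))) (paths₂-sound v)))

      pick : ∀ {A : Set} {P Q : A → Set} {xs} → All P xs → Any Q xs → ∃[ x ] (P x × Q x)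
      pick (p ∷ _)  (here q)  = _ , p , q
      pick (_ ∷ ps) (there i) = pick ps i

    no-violation : ∀ v → ¬ Violation v
    no-violation v (inj₁ bigon)
      with (_ , b , w) , (vb , bw , vw) , bigon′ ← pick (paths₃-sound v) bigon
      with (_ , b′ , .w) , (vb′ , bw′ , _) , refl , b≢b′ ← pick (paths₃-sound v) bigon′
      = b≢b′ (vertex-injective (single-neighbour 2 (star 3F vw) (Adj-sym bw) (Adj-sym bw′) vb vb′))
    no-violation v (inj₂ (inj₁ pentagon))
      with (_ , _ , w) , (_ , _ , vw) , pentagon′ ← pick (paths₃-sound v) pentagon
      with (_ , .w) , (va , aw , v≢w) , refl ← pick (paths₂-sound v) pentagon′
      = contradiction (trans (sym (two-path va aw v≢w)) vw) λ ()
    no-violation v (inj₂ (inj₂ theta))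
      with _ , (_ , _ , vw) , theta′ ← pick (paths₃-sound v) theta
      with s , ws , s-reached , theta″ ← pick (neighboursIn-sound valid _) theta′
      with t , wt , s≢t , t-reached ← pick (neighboursIn-sound valid _) theta″
      with _ , (_ , _ , vs) , refl ← pick (paths₃-sound v) s-reached
      with _ , (_ , _ , vt) , refl ← pick (paths₃-sound v) t-reached
      = s≢t (vertex-injective (single-neighbour 3 (star 3F vw) ws wt vs vt))

module Labels where

  open import Defs hiding (S)
  open LocalStructure
  open ShortCycles
  open import Data.Fin.Base using (suc; combine; join)
  open import Data.List.Base using ([]; _∷_)
  open import Data.List.Relation.Unary.All using ([]; _∷_)
  open import Data.Nat.Base using (suc)
  open import Data.Sum.Properties using (≡-dec)
  open import Data.Vec.Base using ([]; _∷_)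
  open import Relation.Binary.PropositionalEquality hiding ([_])
  open import Relation.Nullary

  -- The vertices y_j below u_a and z_s below y_j.
  branch : Fin 6 → Fin 3
  branch = lookup (0F ∷ 0F ∷ 1F ∷ 1F ∷ 2F ∷ 2F ∷ [])

  parent : Fin 12 → Fin 6
  parent = lookup (0F ∷ 0F ∷ 1F ∷ 1F ∷ 2F ∷ 2F ∷ 3F ∷ 3F ∷ 4F ∷ 4F ∷ 5F ∷ 5F ∷ [])

  pattern 10F = suc 9F
  pattern 11F = suc 10F

  yBelow : Fin 3 → Fin 2 → Fin 6
  yBelow = combine

  zBelow : Fin 6 → Fin 2 → Fin 12
  zBelow = combine

  branch-yBelow : ∀ a e → branch (yBelow a e) ≡ a
  branch-yBelow = from-yes (all? λ a → all? λ e → branch (yBelow a e) ≟ᶠ a)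

  parent-zBelow : ∀ j e → parent (zBelow j e) ≡ j
  parent-zBelow = from-yes (all? λ j → all? λ e → parent (zBelow j e) ≟ᶠ j)

  Label : ℕ → Set
  Label m = Fin 1 ⊎ Fin 3 ⊎ Fin 6 ⊎ Fin 12 ⊎ Fin m

  _≟ᴸ_ : ∀ {m} → DecidableEquality (Label m)
  _≟ᴸ_ = ≡-dec _≟ᶠ_ (≡-dec _≟ᶠ_ (≡-dec _≟ᶠ_ (≡-dec _≟ᶠ_ _≟ᶠ_)))

  pattern root = inj₁ 0F
  pattern U a  = inj₂ (inj₁ a)
  pattern Y j  = inj₂ (inj₂ (inj₁ j))
  pattern Z s  = inj₂ (inj₂ (inj₂ (inj₁ s)))
  pattern W i  = inj₂ (inj₂ (inj₂ (inj₂ i)))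

  treeEdges : ∀ {m} → List (Label m × Label m)
  treeEdges =
    (root , U 0F) ∷ (root , U 1F) ∷ (root , U 2F) ∷
    (U 0F , Y 0F) ∷ (U 0F , Y 1F) ∷ (U 1F , Y 2F) ∷ (U 1F , Y 3F) ∷ (U 2F , Y 4F) ∷ (U 2F , Y 5F) ∷
    (Y 0F , Z 0F) ∷ (Y 0F , Z 1F) ∷ (Y 1F , Z 2F) ∷ (Y 1F , Z 3F) ∷ (Y 2F , Z 4F) ∷ (Y 2F , Z 5F) ∷
    (Y 3F , Z 6F) ∷ (Y 3F , Z 7F) ∷ (Y 4F , Z 8F) ∷ (Y 4F , Z 9F) ∷ (Y 5F , Z 10F) ∷ (Y 5F , Z 11F) ∷ []

  -- How the edges inside Γ₃(x) join the vertices z_s.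
  record Matching : Set where
    field
      partner    : Fin 12 → Fin 12
      involutive : ∀ s → partner (partner s) ≡ s
      separated  : ∀ s t → parent s ≡ parent t → parent (partner s) ≡ parent (partner t) → s ≡ t
      pairs      : List (Fin 12)

    matchingEdges : ∀ {m} → List (Label m × Label m)
    matchingEdges = Data.List.Base.map (λ s → Z s , Z (partner s)) pairs

  record Tree {n : ℕ} (Γ : Graph n) (x : Fin n) : Set where
    open Graph Γ using (Adj)
    field
      u           : Fin 3 → Fin n
      y           : Fin 6 → Fin n
      u-level     : ∀ a → dist Γ x (u a) ≡ 1
      y-level     : ∀ j → dist Γ x (y j) ≡ 2
      u-y         : ∀ j → Adj (u (branch j)) (y j)
      y-injective : Injective _≡_ _≡_ y
      y-covers    : ∀ {t} → dist Γ x t ≡ 2 → ∃[ j ] y j ≡ t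

  Double : Vec ℕ 3 → ℕ → Set
  Double ls k = ∀ i j l → lookup ls i ≡ k → lookup ls j ≡ k → lookup ls l ≡ k → i ≡ j ⊎ i ≡ l ⊎ j ≡ l

  double? : ∀ ls k → Dec (Double ls k)
  double? ls k = all? λ i → all? λ j → all? λ l →
    (lookup ls i ≟ k) →-dec ((lookup ls j ≟ k) →-dec ((lookup ls l ≟ k) →-dec
      ((i ≟ᶠ j) ⊎-dec ((i ≟ᶠ l) ⊎-dec (j ≟ᶠ l)))))

  module Levels {n : ℕ} (Γ : Graph n) (levels : Distance.HasNeighbourLevels Γ) where
    open Geodesics Γ levels public

    two-neighbours : ∀ {v w r s t ls} k {_ : True (double? ls k)} → Star v w ls →
                     Adj w r → Adj w s → Adj w t → d v r ≡ k → d v s ≡ k → d v t ≡ k →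
                     r ≡ s ⊎ r ≡ t ⊎ s ≡ t
    two-neighbours k {double} st ar as at dr ds dt
      with Star.complete st ar | Star.complete st as | Star.complete st at
    ... | i , refl | j , refl | l , refl
      = Sum.map (cong (Star.at st)) (Sum.map (cong (Star.at st)) (cong (Star.at st)))
          (toWitness double i j l (trans (sym (Star.level st i)) dr) (trans (sym (Star.level st j)) ds) (trans (sym (Star.level st l)) dt))

    level-2-independent : ∀ {x s t} → d x s ≡ 2 → Adj s t → d x t ≢ 2
    level-2-independent xs st xt with neighbour-level (star 2F xs) st
    ... | 0F , e = contradiction (trans (sym e) xt) λ ()
    ... | 1F , e = contradiction (trans (sym e) xt) λ ()
    ... | 2F , e = contradiction (trans (sym e) xt) λ ()

    above-level-2 : ∀ {x y p q y′} → d x y ≡ 2 → d x y′ ≡ 2 → Adj y p → Adj p q → Adj q y′ → d y y′ ≡ 3 → d x p ≡ 3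
    above-level-2 {x} {y} {p} {q} {y′} xy xy′ yp pq qy′ yy′ with neighbour-level (star 2F xy) yp
    ... | 1F , eq = eq
    ... | 2F , eq = eq
    ... | 0F , eq with neighbour-level (star 1F eq) pq
    ...   | 0F , eq′ = contradiction (trans (sym (Adj⇒d≡1 (subst (λ t → Adj t y′) (sym (d≡0⇒≡ eq′)) qy′))) xy′) λ ()
    ...   | 1F , eq′ = contradiction xy′ (level-2-independent eq′ qy′)
    ...   | 2F , eq′ = contradiction xy′ (level-2-independent eq′ qy′)

    record Crossing (x y y′ : Fin n) : Set where
      field
        p q   : Fin n
        y-p   : Adj y p
        p-q   : Adj p q
        q-y′  : Adj q y′
        p-level : d x p ≡ 3
        q-level : d x q ≡ 3

    crossing : ∀ {x y y′} → d x y ≡ 2 → d x y′ ≡ 2 → d y y′ ≡ 3 → Crossing x y y′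
    crossing {y = y} {y′} xy xy′ yy′ with subst (λ k → Walk Adj k y y′) yy′ (dist-walk Γ y y′)
    ... | p , yp , q , pq , _ , qy′ , refl = record
      { p = p ; q = q ; y-p = yp ; p-q = pq ; q-y′ = qy′
      ; p-level = above-level-2 xy xy′ yp pq qy′ yy′
      ; q-level = above-level-2 xy′ xy (Adj-sym qy′) (Adj-sym pq) (Adj-sym yp) (trans (d-sym y′ y) yy′)
      }

    crossing-unique : ∀ {x y y′ y″} → d x y ≡ 2 → d x y′ ≡ 2 → d y y′ ≡ 3 → y″ ≡ y →
                      (C : Crossing x y y′) (C′ : Crossing x y′ y″) → Crossing.q C ≡ Crossing.p C′
    crossing-unique {x} {y} {y′} xy xy′ yy′ refl C C′ =
      single-neighbour 2 (star 3F yy′) (Adj-sym C.q-y′) C′.y-p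
        (two-path C.y-p C.p-q (differ xy C.q-level)) (two-path (Adj-sym C′.q-y′) (Adj-sym C′.p-q) (differ xy C′.p-level))
      where
      module C  = Crossing C
      module C′ = Crossing C′
      differ : ∀ {s t} → d x s ≡ 2 → d x t ≡ 3 → s ≢ t
      differ xs xt refl = contradiction (trans (sym xs) xt) λ ()

  module Frame {n : ℕ} (Γ : Graph n) (levels : Distance.HasNeighbourLevels Γ) (x : Fin n) (tree : Tree Γ x) (matching : Matching)
    (far : ∀ s → dist Γ (Tree.y tree (parent s)) (Tree.y tree (parent (Matching.partner matching s))) ≡ 3) where
    open Levels Γ levels public
    open Tree tree public
    open Matching matching public

    u-y-below : ∀ a e → Adj (u a) (y (yBelow a e))
    u-y-below a e = subst (λ b → Adj (u b) (y (yBelow a e))) (branch-yBelow a e) (u-y (yBelow a e))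

    u-injective : Injective _≡_ _≡_ u
    u-injective {a} {b} eq
      with two-neighbours 2 (star 1F (u-level a)) (u-y-below a 0F) (u-y-below a 1F)
             (subst (λ t → Adj t (y (yBelow b 0F))) (sym eq) (u-y-below b 0F)) (y-level _) (y-level _) (y-level _)
    ... | inj₁ e        = contradiction (y-injective e) (differ a)
      where differ : ∀ a → yBelow a 0F ≢ yBelow a 1F
            differ = from-yes (all? λ a → ¬? (yBelow a 0F ≟ᶠ yBelow a 1F))
    ... | inj₂ (inj₁ e) = trans (sym (branch-yBelow a 0F)) (trans (cong branch (y-injective e)) (branch-yBelow b 0F))
    ... | inj₂ (inj₂ e) = trans (sym (branch-yBelow a 1F)) (trans (cong branch (y-injective e)) (branch-yBelow b 0F))

    private
      cross : ∀ s → Crossing x (y (parent s)) (y (parent (partner s)))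
      cross s = crossing (y-level _) (y-level _) (far s)
      module C s = Crossing (cross s)

    z : Fin 12 → Fin n
    z = C.p

    z-level : ∀ s → d x (z s) ≡ 3
    z-level = C.p-level

    y-z : ∀ s → Adj (y (parent s)) (z s)
    y-z = C.y-p

    z-z : ∀ s → Adj (z s) (z (partner s))
    z-z s = subst (Adj (z s)) (crossing-unique (y-level _) (y-level _) (far s) (cong (y ∘ parent) (involutive s)) (cross s) (cross (partner s))) (C.p-q s)

    same-parent : ∀ {s t} → z s ≡ z t → parent s ≡ parent t
    same-parent {s} {t} eq = y-injective (single-neighbour 2 (star 3F (z-level s)) (Adj-sym (y-z s))
      (Adj-sym (subst (Adj (y (parent t))) (sym eq) (y-z t))) (y-level _) (y-level _))

    z-injective : Injective _≡_ _≡_ z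
    z-injective {s} {t} eq = separated s t (same-parent eq) (same-parent (single-neighbour 3 (star 3F (z-level s))
      (z-z s) (subst (λ r → Adj r (z (partner t))) (sym eq) (z-z t)) (z-level _) (z-level _)))

    z-covers : ∀ {t} → d x t ≡ 3 → ∃[ s ] z s ≡ t
    z-covers {t} xt with y-covers (Star.level (star 3F xt) 0F)
    ... | j , eq with two-neighbours 3 (star 2F (y-level j)) (child 0F) (child 1F)
                        (subst (λ r → Adj r t) (sym eq) (Adj-sym (Star.adjacent (star 3F xt) 0F))) (z-level _) (z-level _) xt
      where child : ∀ e → Adj (y j) (z (zBelow j e))
            child e = subst (λ i → Adj (y i) (z (zBelow j e))) (parent-zBelow j e) (y-z (zBelow j e))
    ...   | inj₁ e        = contradiction (z-injective e) (differ j)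
      where differ : ∀ j → zBelow j 0F ≢ zBelow j 1F
            differ = from-yes (all? λ j → ¬? (zBelow j 0F ≟ᶠ zBelow j 1F))
    ...   | inj₂ (inj₁ e) = _ , e
    ...   | inj₂ (inj₂ e) = _ , e

    module Vertices {m : ℕ} (w : Fin m → Fin n) (w-level : ∀ i → d x (w i) ≡ 4) (w-injective : Injective _≡_ _≡_ w) where

      vertex : Label m → Fin n
      vertex root  = x
      vertex (U a) = u a
      vertex (Y j) = y j
      vertex (Z s) = z s
      vertex (W i) = w i

      level : Label m → ℕ
      level root  = 0
      level (U _) = 1
      level (Y _) = 2
      level (Z _) = 3
      level (W _) = 4

      vertex-level : ∀ l → d x (vertex l) ≡ level l
      vertex-level root  = d-refl x
      vertex-level (U a) = u-level a
      vertex-level (Y j) = y-level j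
      vertex-level (Z s) = z-level s
      vertex-level (W i) = w-level i

      same-level : ∀ l l′ → vertex l ≡ vertex l′ → level l ≡ level l′
      same-level l l′ eq = trans (sym (vertex-level l)) (trans (cong (d x) eq) (vertex-level l′))

      vertex-injective : Injective _≡_ _≡_ vertex
      vertex-injective {l} {l′} eq = go l l′ (same-level l l′ eq) eq
        where
        go : ∀ l l′ → level l ≡ level l′ → vertex l ≡ vertex l′ → l ≡ l′
        go root  root   _  _ = refl
        go (U a) (U b)  _  e = cong (λ a → U a) (u-injective e)
        go (Y i) (Y j)  _  e = cong (λ a → Y a) (y-injective e)
        go (Z s) (Z t)  _  e = cong (λ a → Z a) (z-injective e)
        go (W i) (W j)  _  e = cong (λ a → W a) (w-injective e)
        go root  (U _)  () _
        go root  (Y _)  () _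
        go root  (Z _)  () _
        go root  (W _)  () _
        go (U _) root   () _
        go (U _) (Y _)  () _
        go (U _) (Z _)  () _
        go (U _) (W _)  () _
        go (Y _) root   () _
        go (Y _) (U _)  () _
        go (Y _) (Z _)  () _
        go (Y _) (W _)  () _
        go (Z _) root   () _
        go (Z _) (U _)  () _
        go (Z _) (Y _)  () _
        go (Z _) (W _)  () _
        go (W _) root   () _
        go (W _) (U _)  () _
        go (W _) (Y _)  () _
        go (W _) (Z _)  () _

      Valid : List (Label m × Label m) → Set
      Valid = All (λ (s , t) → Adj (vertex s) (vertex t))

      treeEdges-valid : Valid treeEdges
      treeEdges-valid =
        x-u 0F ∷ x-u 1F ∷ x-u 2F ∷ u-y 0F ∷ u-y 1F ∷ u-y 2F ∷ u-y 3F ∷ u-y 4F ∷ u-y 5F ∷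
        y-z 0F ∷ y-z 1F ∷ y-z 2F ∷ y-z 3F ∷ y-z 4F ∷ y-z 5F ∷ y-z 6F ∷ y-z 7F ∷ y-z 8F ∷ y-z 9F ∷ y-z 10F ∷ y-z 11F ∷ []
        where x-u : ∀ a → Adj x (u a)
              x-u a = d≡1⇒Adj (u-level a)

      matchingEdges-valid : Valid matchingEdges
      matchingEdges-valid = Allₚ.map⁺ (All.universal z-z pairs)

module Matchings where

  open import Defs hiding (S)
  open LocalStructure
  open ShortCycles
  open Labels
  open import Data.List.Base using ([]; _∷_; _++_)
  open import Data.List.Relation.Unary.All using ([]; _∷_)
  open import Data.List.Relation.Unary.Any using (any?)
  open import Data.Vec.Base using ([]; _∷_)
  open import Function.Base using (case_of_)
  open import Relation.Binary.PropositionalEquality hiding ([_])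
  open import Relation.Nullary

  -- The violations that occur below are all visible from one of these vertices.
  bases : ∀ {m} → List (Label m)
  bases = U 0F ∷ U 1F ∷ U 2F ∷ Y 0F ∷ Y 1F ∷ Y 2F ∷ Y 3F ∷ Y 4F ∷ Y 5F ∷ []

  Refuted : ∀ {m} → List (Label m × Label m) → Set
  Refuted edges = Any.Any (Configuration.Violation _≟ᴸ_ edges) bases

  refuted? : ∀ {m} (edges : List (Label m × Label m)) → Dec (Refuted edges)
  refuted? edges = any? (Configuration.violation? _≟ᴸ_ edges) bases

  mkMatching : (partner : Vec (Fin 12) 12) (pairs : List (Fin 12)) →
    {_ : True (all? λ s → lookup partner (lookup partner s) ≟ᶠ s)} →
    {_ : True (all? λ s → all? λ t → (parent s ≟ᶠ parent t) →-dec
                ((parent (lookup partner s) ≟ᶠ parent (lookup partner t)) →-dec (s ≟ᶠ t)))} → Matching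
  mkMatching partner pairs {inv} {sep} = record
    { partner = lookup partner ; involutive = toWitness inv ; separated = toWitness sep ; pairs = pairs }

  triangles hexagon : Matching
  triangles = mkMatching (10F ∷ 6F ∷ 8F ∷ 4F ∷ 3F ∷ 9F ∷ 1F ∷ 11F ∷ 2F ∷ 5F ∷ 0F ∷ 7F ∷ []) (0F ∷ 1F ∷ 2F ∷ 3F ∷ 5F ∷ 7F ∷ [])
  hexagon   = mkMatching (10F ∷ 6F ∷ 4F ∷ 8F ∷ 2F ∷ 11F ∷ 1F ∷ 9F ∷ 3F ∷ 7F ∷ 0F ∷ 5F ∷ []) (0F ∷ 1F ∷ 2F ∷ 3F ∷ 5F ∷ 7F ∷ [])

  linkEdges : Matching → Fin 12 → Fin 12 → List (Label 1 × Label 1)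
  linkEdges matching s t = (W 0F , Z s) ∷ (W 0F , Z t) ∷ treeEdges ++ Matching.matchingEdges matching

  module Link {n : ℕ} (Γ : Graph n) (levels : Distance.HasNeighbourLevels Γ) (x : Fin n) (tree : Tree Γ x) (matching : Matching)
    (far : ∀ s → dist Γ (Tree.y tree (parent s)) (Tree.y tree (parent (Matching.partner matching s))) ≡ 3) where
    open Frame Γ levels x tree matching far public

    refuted-link : ∀ {w s t} → d x w ≡ 4 → Adj w (z s) → Adj w (z t) → ¬ Refuted (linkEdges matching s t)
    refuted-link {w} {s} {t} xw ws wt refuted = violated (Any.satisfied refuted)
      where
      single-injective : Injective _≡_ _≡_ (λ (_ : Fin 1) → w)
      single-injective {0F} {0F} _ = refl
      open Vertices {1} (λ _ → w) (λ _ → xw) single-injective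
      open Refutation Γ levels _≟ᴸ_ vertex vertex-injective (linkEdges matching s t)
             (ws ∷ wt ∷ Allₚ.++⁺ treeEdges-valid matchingEdges-valid)
      violated : ¬ (∃[ v ] Configuration.Violation _≟ᴸ_ (linkEdges matching s t) v)
      violated (v , violation) = no-violation v violation

    -- The other two neighbours of z_s lie at distances 2 and 3 from x.
    above : Fin 12 → Fin n
    above s = Star.at (star 3F (z-level s)) 1F

    above-level : ∀ s → d x (above s) ≡ 4
    above-level s = Star.level (star 3F (z-level s)) 1F

    above-z : ∀ s → Adj (above s) (z s)
    above-z s = Adj-sym (Star.adjacent (star 3F (z-level s)) 1F)

    linked : ∀ s → ∃[ t ] (s ≢ t × Adj (above s) (z t))
    linked s = choose (z-covers (Star.level st 0F)) (z-covers (Star.level st 1F))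
      where
      st = star 4F (above-level s)
      choose : ∃[ t ] z t ≡ Star.at st 0F → ∃[ t ] z t ≡ Star.at st 1F → ∃[ t ] (s ≢ t × Adj (above s) (z t))
      choose (t , eq) (t′ , eq′) = case s ≟ᶠ t of λ where
        (no s≢t)  → t , s≢t , subst (Adj (above s)) (sym eq) (Star.adjacent st 0F)
        (yes s≡t) → t′
          , (λ s≡t′ → contradiction (Star.injective st (trans (sym eq) (trans (cong z (trans (sym s≡t) s≡t′)) eq′))) λ ())
          , subst (Adj (above s)) (sym eq′) (Star.adjacent st 1F)

  abstract
    hexagon-refuted : ∀ t → 0F ≡ t ⊎ Refuted (linkEdges hexagon 0F t)
    hexagon-refuted = from-yes (all? λ t → (0F ≟ᶠ t) ⊎-dec refuted? (linkEdges hexagon 0F t))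

  source target : Fin 6 → Fin 12
  source = lookup (0F ∷ 1F ∷ 6F ∷ 7F ∷ 10F ∷ 11F ∷ [])
  target = lookup (5F ∷ 9F ∷ 8F ∷ 2F ∷ 4F ∷ 3F ∷ [])

  abstract
    triangles-linked : ∀ i t → source i ≡ t ⊎ target i ≡ t ⊎ Refuted (linkEdges triangles (source i) t)
    triangles-linked = from-yes (all? λ i → all? λ t →
      (source i ≟ᶠ t) ⊎-dec ((target i ≟ᶠ t) ⊎-dec refuted? (linkEdges triangles (source i) t)))

  no-hexagon : ∀ {n} (Γ : Graph n) → Distance.HasNeighbourLevels Γ → ∀ x (tree : Tree Γ x) →
    ¬ (∀ s → dist Γ (Tree.y tree (parent s)) (Tree.y tree (parent (Matching.partner hexagon s))) ≡ 3)
  no-hexagon Γ levels x tree far = absurd (linked 0F)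
    where
    open Link Γ levels x tree hexagon far
    absurd : ¬ (∃[ t ] (0F ≢ t × Adj (above 0F) (z t)))
    absurd (t , 0≢t , adj) = [ 0≢t , refuted-link (above-level 0F) (above-z 0F) adj ] (hexagon-refuted t)

module Model where

  open import Defs hiding (S)
  open LocalStructure
  open ShortCycles
  open Labels
  open Matchings
  open import Data.Fin.Base using (splitAt; join)
  open import Data.List.Base using ([]; _∷_; _++_)
  open import Data.List.Relation.Unary.All using ([]; _∷_)
  open import Data.Vec.Base using ([]; _∷_)
  open import Data.Unit.Base using (⊤)
  open import Data.List.Membership.DecPropositional using () renaming (_∈?_ to member?)
  open import Data.List.Membership.Propositional using () renaming (_∈_ to _∈ᴸ_)
  open import Relation.Binary.PropositionalEquality hiding ([_])
  open import Relation.Nullary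

  encode : Label 6 → Fin 28
  encode = join 1 27 ∘ Sum.map₂ (join 3 24 ∘ Sum.map₂ (join 6 18 ∘ Sum.map₂ (join 12 6)))

  decode : Fin 28 → Label 6
  decode = Sum.map₂ (Sum.map₂ (Sum.map₂ (splitAt 12) ∘ splitAt 6) ∘ splitAt 3) ∘ splitAt 1

  mate : Fin 6 → Fin 6
  mate = lookup (3F ∷ 5F ∷ 4F ∷ 0F ∷ 2F ∷ 1F ∷ [])

  linkedEdges modelEdges : List (Label 6 × Label 6)
  linkedEdges =
    (W 0F , Z 0F) ∷ (W 1F , Z 1F) ∷ (W 2F , Z 6F) ∷ (W 3F , Z 7F) ∷ (W 4F , Z 10F) ∷ (W 5F , Z 11F) ∷
    (W 0F , Z 5F) ∷ (W 1F , Z 9F) ∷ (W 2F , Z 8F) ∷ (W 3F , Z 2F) ∷ (W 4F , Z 4F)  ∷ (W 5F , Z 3F) ∷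
    treeEdges ++ Matching.matchingEdges triangles
  modelEdges = (W 0F , W 3F) ∷ (W 1F , W 5F) ∷ (W 2F , W 4F) ∷ linkedEdges

  -- The neighbours of x = 0, u₀,…,u₂ = 1,…,3, y₀,…,y₅ = 4,…,9, z₀,…,z₁₁ = 10,…,21, w₀,…,w₅ = 22,…,27.
  modelNeighbours : Fin 28 → Vec (Fin 28) 3
  modelNeighbours = lookup
    ( (# 1 ∷ # 2 ∷ # 3 ∷ []) ∷ (# 0 ∷ # 4 ∷ # 5 ∷ []) ∷ (# 0 ∷ # 6 ∷ # 7 ∷ []) ∷ (# 0 ∷ # 8 ∷ # 9 ∷ [])
    ∷ (# 1 ∷ # 10 ∷ # 11 ∷ []) ∷ (# 1 ∷ # 12 ∷ # 13 ∷ []) ∷ (# 2 ∷ # 14 ∷ # 15 ∷ []) ∷ (# 2 ∷ # 16 ∷ # 17 ∷ [])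
    ∷ (# 3 ∷ # 18 ∷ # 19 ∷ []) ∷ (# 3 ∷ # 20 ∷ # 21 ∷ []) ∷ (# 4 ∷ # 20 ∷ # 22 ∷ []) ∷ (# 4 ∷ # 16 ∷ # 23 ∷ [])
    ∷ (# 5 ∷ # 18 ∷ # 25 ∷ []) ∷ (# 5 ∷ # 14 ∷ # 27 ∷ []) ∷ (# 6 ∷ # 13 ∷ # 26 ∷ []) ∷ (# 6 ∷ # 19 ∷ # 22 ∷ [])
    ∷ (# 7 ∷ # 11 ∷ # 24 ∷ []) ∷ (# 7 ∷ # 21 ∷ # 25 ∷ []) ∷ (# 8 ∷ # 12 ∷ # 24 ∷ []) ∷ (# 8 ∷ # 15 ∷ # 23 ∷ [])
    ∷ (# 9 ∷ # 10 ∷ # 26 ∷ []) ∷ (# 9 ∷ # 17 ∷ # 27 ∷ []) ∷ (# 10 ∷ # 15 ∷ # 25 ∷ []) ∷ (# 11 ∷ # 19 ∷ # 27 ∷ [])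
    ∷ (# 16 ∷ # 18 ∷ # 26 ∷ []) ∷ (# 12 ∷ # 17 ∷ # 22 ∷ []) ∷ (# 14 ∷ # 20 ∷ # 24 ∷ []) ∷ (# 13 ∷ # 21 ∷ # 23 ∷ []) ∷ [] )

  modelLevel : Fin 28 → ℕ
  modelLevel = [ (λ _ → 0) , [ (λ _ → 1) , [ (λ _ → 2) , [ (λ _ → 3) , (λ _ → 4) ] ] ] ] ∘ decode

  abstract
    encode-decode : ∀ k → encode (decode k) ≡ k
    encode-decode = from-yes (all? λ k → encode (decode k) ≟ᶠ k)

    modelNeighbours-distinct : ∀ i k l → lookup (modelNeighbours i) k ≡ lookup (modelNeighbours i) l → k ≡ l
    modelNeighbours-distinct = from-yes (all? λ i → all? λ k → all? λ l →
      (lookup (modelNeighbours i) k ≟ᶠ lookup (modelNeighbours i) l) →-dec (k ≟ᶠ l))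

    modelNeighbours-sound : ∀ i k → decode (lookup (modelNeighbours i) k) ∈ᴸ
      Configuration.neighboursIn _≟ᴸ_ modelEdges modelEdges (decode i)
    modelNeighbours-sound = from-yes (all? λ i → all? λ k → member? _≟ᴸ_ (decode (lookup (modelNeighbours i) k))
      (Configuration.neighboursIn _≟ᴸ_ modelEdges modelEdges (decode i)))

    mates-linked : ∀ i j → i ≡ j ⊎ mate i ≡ j ⊎ Refuted ((W i , W j) ∷ linkedEdges)
    mates-linked = from-yes (all? λ i → all? λ j →
      (i ≟ᶠ j) ⊎-dec ((mate i ≟ᶠ j) ⊎-dec refuted? ((W i , W j) ∷ linkedEdges)))

    links-separated : ∀ i j → source i ≡ source j ⊎ target i ≡ source j → i ≡ j
    links-separated = from-yes (all? λ i → all? λ j →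
      ((source i ≟ᶠ source j) ⊎-dec (target i ≟ᶠ source j)) →-dec (i ≟ᶠ j))

  record Coordinates {n : ℕ} (Γ : Graph n) (x : Fin n) (y : Fin 6 → Fin n) : Set where
    field
      φ           : Fin 28 → Fin n
      φ⁻¹         : Fin n → Fin 28
      φ-φ⁻¹       : ∀ v → φ (φ⁻¹ v) ≡ v
      φ-injective : Injective _≡_ _≡_ φ
      φ-adjacent  : ∀ i j → Graph.Adj Γ (φ i) (φ j) ⇔ (∃[ k ] lookup (modelNeighbours i) k ≡ j)
      φ-level     : ∀ i → dist Γ x (φ i) ≡ modelLevel i
      φ-root      : φ 0F ≡ x
      φ-y         : ∀ j → φ (encode (Y j)) ≡ y j

  module Labelling {n : ℕ} (Γ : Graph n) (levels : Distance.HasNeighbourLevels Γ) (everything : Enumeration {n} (λ _ → ⊤) 28) (x : Fin n)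
    (tree : Tree Γ x)
    (far : ∀ s → dist Γ (Tree.y tree (parent s)) (Tree.y tree (parent (Matching.partner triangles s))) ≡ 3) where
    open Link Γ levels x tree triangles far

    w : Fin 6 → Fin n
    w = above ∘ source

    w-level : ∀ i → d x (w i) ≡ 4
    w-level = above-level ∘ source

    w-source : ∀ i → Adj (w i) (z (source i))
    w-source = above-z ∘ source

    w-links : ∀ i {t} → Adj (w i) (z t) → source i ≡ t ⊎ target i ≡ t
    w-links i {t} adj = Sum.map₂ [ id , ⊥-elim ∘ refuted-link {w i} {source i} {t} (w-level i) (w-source i) adj ]′ (triangles-linked i t)

    w-target : ∀ i → Adj (w i) (z (target i))
    w-target i = resolve (linked (source i))
      where
      resolve : ∃[ t ] (source i ≢ t × Adj (w i) (z t)) → Adj (w i) (z (target i))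
      resolve (t , s≢t , adj) = [ ⊥-elim ∘ s≢t , (λ { refl → adj }) ]′ (w-links i adj)

    w-injective : Injective _≡_ _≡_ w
    w-injective {i} {j} eq = links-separated i j (w-links i {source j} (subst (λ v → Adj v (z (source j))) (sym eq) (w-source j)))

    open Vertices w w-level w-injective

    φ : Fin 28 → Fin n
    φ = vertex ∘ decode

    decode-injective : Injective _≡_ _≡_ decode
    decode-injective {i} {j} eq = trans (sym (encode-decode i)) (trans (cong encode eq) (encode-decode j))

    φ-injective : Injective _≡_ _≡_ φ
    φ-injective = decode-injective ∘ vertex-injective

    φ-surjective : ∀ v → ∃[ k ] φ k ≡ v
    φ-surjective v = injection-covers everything φ φ-injective _ {v} _

    linkedEdges-valid : Valid linkedEdges
    linkedEdges-valid =
      w-source 0F ∷ w-source 1F ∷ w-source 2F ∷ w-source 3F ∷ w-source 4F ∷ w-source 5F ∷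
      w-target 0F ∷ w-target 1F ∷ w-target 2F ∷ w-target 3F ∷ w-target 4F ∷ w-target 5F ∷
      Allₚ.++⁺ treeEdges-valid matchingEdges-valid

    at-level-4 : ∀ l → d x (vertex l) ≡ 4 → ∃[ i ] w i ≡ vertex l
    at-level-4 root  eq = contradiction (trans (sym (vertex-level root)) eq) λ ()
    at-level-4 (U a) eq = contradiction (trans (sym (vertex-level (U a))) eq) λ ()
    at-level-4 (Y j) eq = contradiction (trans (sym (vertex-level (Y j))) eq) λ ()
    at-level-4 (Z s) eq = contradiction (trans (sym (vertex-level (Z s))) eq) λ ()
    at-level-4 (W i) _  = i , refl

    w-covers : ∀ {t} → d x t ≡ 4 → ∃[ i ] w i ≡ t
    w-covers {t} xt =
      let k , eq  = φ-surjective t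
          i , eq′ = at-level-4 (decode k) (trans (cong (d x) eq) xt)
      in i , trans eq′ eq

    mates : ∀ i {j} → Adj (w i) (w j) → mate i ≡ j
    mates i {j} adj =
      [ (λ eq → contradiction adj (irrefl (cong w eq))) , [ id , (λ refuted → ⊥-elim (violated (Any.satisfied refuted))) ]′ ]′ (mates-linked i j)
      where
      open Refutation Γ levels _≟ᴸ_ vertex vertex-injective ((W i , W j) ∷ linkedEdges) (adj ∷ linkedEdges-valid)
      violated : ¬ (∃[ v ] Configuration.Violation _≟ᴸ_ ((W i , W j) ∷ linkedEdges) v)
      violated (v , violation) = no-violation v violation

    w-mate : ∀ i → Adj (w i) (w (mate i))
    w-mate i = resolve (w-covers (Star.level st 2F)) (Star.adjacent st 2F)
      where
      st = star 4F (w-level i)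
      resolve : ∀ {t} → ∃[ j ] w j ≡ t → Adj (w i) t → Adj (w i) (w (mate i))
      resolve (j , refl) adj = subst (Adj (w i) ∘ w) (sym (mates i {j} adj)) adj

    modelEdges-valid : Valid modelEdges
    modelEdges-valid = w-mate 0F ∷ w-mate 1F ∷ w-mate 2F ∷ linkedEdges-valid

    φ-neighbour : ∀ i k → Adj (φ i) (φ (lookup (modelNeighbours i) k))
    φ-neighbour i k = All.lookup (Refutation.neighboursIn-sound Γ levels _≟ᴸ_ vertex vertex-injective modelEdges modelEdges-valid
                                    modelEdges-valid (decode i)) (modelNeighbours-sound i k)

    φ-complete : ∀ i j → Adj (φ i) (φ j) → ∃[ k ] lookup (modelNeighbours i) k ≡ j
    φ-complete i j adj = resolve (injection-covers (neighbours (φ i)) (φ ∘ lookup (modelNeighbours i))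
                           (λ {k} {l} → modelNeighbours-distinct i k l ∘ φ-injective) (φ-neighbour i) adj)
      where
      resolve : ∃[ k ] φ (lookup (modelNeighbours i) k) ≡ φ j → ∃[ k ] lookup (modelNeighbours i) k ≡ j
      resolve (k , eq) = k , φ-injective eq

    φ-levels : ∀ l → d x (vertex l) ≡ [ (λ _ → 0) , [ (λ _ → 1) , [ (λ _ → 2) , [ (λ _ → 3) , (λ _ → 4) ] ] ] ] l
    φ-levels root  = vertex-level root
    φ-levels (U a) = vertex-level (U a)
    φ-levels (Y j) = vertex-level (Y j)
    φ-levels (Z s) = vertex-level (Z s)
    φ-levels (W i) = vertex-level (W i)

    coordinates : Coordinates Γ x y
    coordinates = record
      { φ           = φ
      ; φ⁻¹         = proj₁ ∘ φ-surjective
      ; φ-φ⁻¹       = proj₂ ∘ φ-surjective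
      ; φ-injective = φ-injective
      ; φ-adjacent  = λ i j → mk⇔ (φ-complete i j) (λ { (k , refl) → φ-neighbour i k })
      ; φ-level     = φ-levels ∘ decode
      ; φ-root      = refl
      ; φ-y         = λ { 0F → refl ; 1F → refl ; 2F → refl ; 3F → refl ; 4F → refl ; 5F → refl }
      }

module Triangles where

  open import Defs
  open LocalStructure
  open ShortCycles
  open Labels
  open Matchings
  open import Data.Fin.Properties using (combine-remQuot)
  open import Relation.Binary.PropositionalEquality hiding ([_])
  open import Relation.Nullary

  module Existence {n : ℕ} (Γ : Graph n) (levels : Distance.HasNeighbourLevels Γ) (x : Fin n) where
    open Levels Γ levels

    record Children (u c c′ : Fin n) : Set where
      field
        adj      : Adj u c
        adj′     : Adj u c′
        level    : d x c ≡ 2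
        level′   : d x c′ ≡ 2
        distinct : c ≢ c′
        only     : ∀ {t} → Adj u t → d x t ≡ 2 → t ≡ c ⊎ t ≡ c′

    swap : ∀ {u c c′} → Children u c c′ → Children u c′ c
    swap C = record { adj = adj′ ; adj′ = adj ; level = level′ ; level′ = level
                    ; distinct = distinct ∘ sym ; only = λ a e → Sum.swap (only a e) }
      where open Children C

    children : ∀ {u} → d x u ≡ 1 → ∃[ c ] ∃[ c′ ] Children u c c′
    children {u} xu = at 1F , at 2F , record
      { adj = adjacent 1F ; adj′ = adjacent 2F ; level = level 1F ; level′ = level 2F
      ; distinct = λ e → contradiction (injective e) λ ()
      ; only = only }
      where
      open Star (star 1F xu)
      only : ∀ {t} → Adj u t → d x t ≡ 2 → t ≡ at 1F ⊎ t ≡ at 2F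
      only a e with complete a
      ... | 0F , refl = contradiction (trans (sym (level 0F)) e) λ ()
      ... | 1F , refl = inj₁ refl
      ... | 2F , refl = inj₂ refl

    module _ {u u′ : Fin n} (xu : d x u ≡ 1) (xu′ : d x u′ ≡ 1) (u≢u′ : u ≢ u′) where

      across : ∀ {a} → Adj u a → d x a ≡ 2 → d a u′ ≡ 3
      across ua xa = three-path (Adj-sym ua) (Adj-sym (d≡1⇒Adj xu)) (d≡1⇒Adj xu′)
        (λ { refl → contradiction (trans (sym (d-refl x)) xa) λ () }) u≢u′

      opposite-child : ∀ {a b b′} → Adj u a → d x a ≡ 2 → Children u′ b b′ → d a b ≡ 3 ⊎ d a b′ ≡ 3
      opposite-child {a} {b} {b′} ua xa C = resolve (neighbour-level (star 1F xu′) (adjacent 2F)) (level 2F)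
        where
        open Star (star 3F (across ua xa))
        resolve : ∃[ i ] d x (at 2F) ≡ lookup (neighbourLevels 1F) i → d a (at 2F) ≡ 3 → d a b ≡ 3 ⊎ d a b′ ≡ 3
        resolve (0F , e) e′ = contradiction (trans (sym e′) (trans (cong (d a) (sym (d≡0⇒≡ e))) (trans (d-sym a x) xa))) λ ()
        resolve (1F , e) e′ = Sum.map (λ { refl → e′ }) (λ { refl → e′ }) (Children.only C (adjacent 2F) e)
        resolve (2F , e) e′ = Sum.map (λ { refl → e′ }) (λ { refl → e′ }) (Children.only C (adjacent 2F) e)

      opposite-unique : ∀ {a b b′} → Adj u a → d x a ≡ 2 → Adj u′ b → Adj u′ b′ → d a b ≡ 3 → d a b′ ≡ 3 → b ≡ b′
      opposite-unique ua xa = single-neighbour 3 (star 3F (across ua xa))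

    complementary : ∀ {u u′ a a′ b b′} → d x u ≡ 1 → d x u′ ≡ 1 → u ≢ u′ → Children u a a′ → Children u′ b b′ →
                    d a b ≡ 3 → d a′ b′ ≡ 3
    complementary {a = a} {a′} {b} {b′} xu xu′ u≢u′ C C′ ab with opposite-child xu xu′ u≢u′ (Children.adj′ C) (Children.level′ C) C′
    ... | inj₂ a′b′ = a′b′
    ... | inj₁ a′b  = contradiction
      (opposite-unique xu′ xu (u≢u′ ∘ sym) (Children.adj C′) (Children.level C′) (Children.adj C) (Children.adj′ C)
        (trans (d-sym b a) ab) (trans (d-sym b a′) a′b)) (Children.distinct C)

    align : ∀ {u u′ a} → d x u ≡ 1 → d x u′ ≡ 1 → u ≢ u′ → Adj u a → d x a ≡ 2 →
            ∃[ b ] ∃[ b′ ] (Children u′ b b′ × d a b ≡ 3)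
    align {a = a} xu xu′ u≢u′ ua xa = choose (children xu′)
      where
      choose : ∃[ b ] ∃[ b′ ] Children _ b b′ → ∃[ b ] ∃[ b′ ] (Children _ b b′ × d a b ≡ 3)
      choose (b , b′ , C) with opposite-child xu xu′ u≢u′ ua xa C
      ... | inj₁ e = b , b′ , C , e
      ... | inj₂ e = b′ , b , swap C , e

    module _ (u : Fin 3 → Fin n) (u-injective : Injective _≡_ _≡_ u) (u-adjacent : ∀ i → Adj x (u i))
             (u-complete : ∀ {t} → Adj x t → ∃[ i ] u i ≡ t)
             (c : Fin 3 → Fin 2 → Fin n) (C : ∀ a → Children (u a) (c a 0F) (c a 1F)) where

      private
        u-c : ∀ a e → Adj (u a) (c a e)
        u-c a 0F = Children.adj (C a)
        u-c a 1F = Children.adj′ (C a)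

        c-level : ∀ a e → d x (c a e) ≡ 2
        c-level a 0F = Children.level (C a)
        c-level a 1F = Children.level′ (C a)

        y : Fin 6 → Fin n
        y j = c (proj₁ (remQuot {3} 2 j)) (proj₂ (remQuot {3} 2 j))

        slot-injective : ∀ a e e′ → c a e ≡ c a e′ → e ≡ e′
        slot-injective a 0F 0F _  = refl
        slot-injective a 0F 1F eq = contradiction eq (Children.distinct (C a))
        slot-injective a 1F 0F eq = contradiction (sym eq) (Children.distinct (C a))
        slot-injective a 1F 1F _  = refl

        c-injective : ∀ a e a′ e′ → c a e ≡ c a′ e′ → (a , e) ≡ (a′ , e′)
        c-injective a e a′ e′ eq = same (u-injective (single-neighbour 1 (star 2F (c-level a e)) (Adj-sym (u-c a e))
            (Adj-sym (subst (Adj (u a′)) (sym eq) (u-c a′ e′))) (Adj⇒d≡1 (u-adjacent a)) (Adj⇒d≡1 (u-adjacent a′)))) eq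
          where
          same : ∀ {a′} → a ≡ a′ → c a e ≡ c a′ e′ → (a , e) ≡ (a′ , e′)
          same refl eq = cong (a ,_) (slot-injective a e e′ eq)

        y-combine : ∀ a e → y (yBelow a e) ≡ c a e
        y-combine a e = cong (λ (a , e) → c a e) (remQuot-combine {3} {2} a e)
          where open import Data.Fin.Properties using (remQuot-combine)

        covers : ∀ {t} → d x t ≡ 2 → ∃[ j ] y j ≡ t
        covers {t} xt = resolve (u-complete (d≡1⇒Adj (Star.level st 0F))) (Adj-sym (Star.adjacent st 0F))
          where
          st = star 2F xt
          resolve : ∀ {r} → ∃[ i ] u i ≡ r → Adj r t → ∃[ j ] y j ≡ t
          resolve (i , refl) ut with Children.only (C i) ut xt
          ... | inj₁ refl = yBelow i 0F , y-combine i 0F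
          ... | inj₂ refl = yBelow i 1F , y-combine i 1F

      tree-of-children : Tree Γ x
      tree-of-children = record
        { u = u ; y = y
        ; u-level = λ a → Adj⇒d≡1 (u-adjacent a)
        ; y-level = λ j → c-level _ _
        ; u-y = λ { 0F → u-c 0F 0F ; 1F → u-c 0F 1F ; 2F → u-c 1F 0F ; 3F → u-c 1F 1F ; 4F → u-c 2F 0F ; 5F → u-c 2F 1F }
        ; y-injective = λ {i} {j} eq → trans (sym (combine-remQuot {3} 2 i))
            (trans (cong (λ (a , e) → yBelow a e) (c-injective _ _ _ _ eq)) (combine-remQuot {3} 2 j))
        ; y-covers = covers
        }

    Far : Matching → (Fin 6 → Fin n) → Set
    Far m y = ∀ s → d (y (parent s)) (y (parent (Matching.partner m s))) ≡ 3

    private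
      flip : ∀ {s t} → d s t ≡ 3 → d t s ≡ 3
      flip {s} {t} = trans (d-sym t s)

    far-triangles : ∀ y → d (y 0F) (y 3F) ≡ 3 → d (y 0F) (y 5F) ≡ 3 → d (y 3F) (y 5F) ≡ 3 →
                    d (y 1F) (y 2F) ≡ 3 → d (y 1F) (y 4F) ≡ 3 → d (y 2F) (y 4F) ≡ 3 → Far triangles y
    far-triangles y e₀₃ e₀₅ e₃₅ e₁₂ e₁₄ e₂₄ = λ where
      0F  → e₀₅
      1F  → e₀₃
      2F  → e₁₄
      3F  → e₁₂
      4F  → flip e₁₂
      5F  → e₂₄
      6F  → flip e₀₃
      7F  → e₃₅
      8F  → flip e₁₄
      9F  → flip e₂₄
      10F → flip e₀₅
      11F → flip e₃₅

    far-hexagon : ∀ y → d (y 0F) (y 3F) ≡ 3 → d (y 0F) (y 5F) ≡ 3 → d (y 3F) (y 4F) ≡ 3 →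
                  d (y 1F) (y 2F) ≡ 3 → d (y 1F) (y 4F) ≡ 3 → d (y 2F) (y 5F) ≡ 3 → Far hexagon y
    far-hexagon y e₀₃ e₀₅ e₃₄ e₁₂ e₁₄ e₂₅ = λ where
      0F  → e₀₅
      1F  → e₀₃
      2F  → e₁₂
      3F  → e₁₄
      4F  → flip e₁₂
      5F  → e₂₅
      6F  → flip e₀₃
      7F  → e₃₄
      8F  → flip e₁₄
      9F  → flip e₃₄
      10F → flip e₀₅
      11F → flip e₂₅

    module _ (u : Fin 3 → Fin n) (u-injective : Injective _≡_ _≡_ u) (u-adjacent : ∀ i → Adj x (u i))
             (u-complete : ∀ {t} → Adj x t → ∃[ i ] u i ≡ t)
             {a a′ b b′ c c′ : Fin n} (A : Children (u 0F) a a′) (B : Children (u 1F) b b′) (C : Children (u 2F) c c′)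
             (ab : d a b ≡ 3) (ac : d a c ≡ 3) where

      private
        kids : Fin 3 → Fin 2 → Fin n
        kids 0F 0F = a
        kids 0F 1F = a′
        kids 1F 0F = b′
        kids 1F 1F = b
        kids 2F 0F = c′
        kids 2F 1F = c

        tree : Tree Γ x
        tree = tree-of-children u u-injective u-adjacent u-complete kids λ { 0F → A ; 1F → swap B ; 2F → swap C }

        xu : ∀ i → d x (u i) ≡ 1
        xu i = Adj⇒d≡1 (u-adjacent i)

        a′b′ : d a′ b′ ≡ 3
        a′b′ = complementary (xu 0F) (xu 1F) (λ e → contradiction (u-injective e) λ ()) A B ab

        a′c′ : d a′ c′ ≡ 3
        a′c′ = complementary (xu 0F) (xu 2F) (λ e → contradiction (u-injective e) λ ()) A C ac

        1≢2 : u 1F ≢ u 2F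
        1≢2 e = contradiction (u-injective e) λ ()

      aligned-tree : ∃[ tree ] Far triangles (Tree.y tree)
      aligned-tree = [ (λ bc  → tree , far-triangles (Tree.y tree) ab ac bc a′b′ a′c′
                                         (complementary (xu 1F) (xu 2F) 1≢2 B C bc))
                     , (λ bc′ → ⊥-elim (no-hexagon Γ levels x tree (far-hexagon (Tree.y tree) ab ac bc′ a′b′ a′c′
                                         (complementary (xu 1F) (xu 2F) 1≢2 B (swap C) bc′))))
                     ]′ (opposite-child (xu 1F) (xu 2F) 1≢2 (Children.adj B) (Children.level B) C)

    triangular-tree : ∃[ tree ] Far triangles (Tree.y tree)
    triangular-tree = start (children (xu 0F))
      where
      open Star (star 0F (d-refl x)) renaming (at to u; injective to u-injective; adjacent to u-adjacent; complete to u-complete; level to xu)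
      start : ∃[ a ] ∃[ a′ ] Children (u 0F) a a′ → ∃[ tree ] Far triangles (Tree.y tree)
      start (a , a′ , A) = next (align (xu 0F) (xu 1F) (λ e → contradiction (u-injective e) λ ()) (Children.adj A) (Children.level A))
                                (align (xu 0F) (xu 2F) (λ e → contradiction (u-injective e) λ ()) (Children.adj A) (Children.level A))
        where
        next : ∃[ b ] ∃[ b′ ] (Children (u 1F) b b′ × d a b ≡ 3) → ∃[ b ] ∃[ b′ ] (Children (u 2F) b b′ × d a b ≡ 3) →
               ∃[ tree ] Far triangles (Tree.y tree)
        next (_ , _ , B , ab) (_ , _ , C , ac) = aligned-tree u u-injective u-adjacent u-complete A B C ab ac

module VertexOrderings where

  open import Defs
  open LocalStructure
  open Labels
  open Matchings
  open Model
  open Triangles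
  open import Data.Fin.Properties using (any?)
  open import Data.List.Base using ([]; _∷_)
  open import Data.List.Relation.Unary.All using ([]; _∷_)
  open import Data.Vec.Base using ([]; _∷_)
  open import Data.Fin.Subset using () renaming (_∉_ to _∉ˢ_)
  open import Data.Fin.Subset.Properties using () renaming (_∈?_ to _∈ˢ?_)
  open import Relation.Binary.PropositionalEquality hiding ([_])
  open import Relation.Nullary

  _xor_ : Fin 2 → Fin 2 → Fin 2
  0F xor e  = e
  1F xor 0F = 1F
  1F xor 1F = 0F

  ≢⇒xor : ∀ {e e′} → e ≢ e′ → e′ ≡ e xor 1F
  ≢⇒xor {0F} {0F} e≢e′ = contradiction refl e≢e′
  ≢⇒xor {0F} {1F} e≢e′ = refl
  ≢⇒xor {1F} {0F} e≢e′ = refl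
  ≢⇒xor {1F} {1F} e≢e′ = contradiction refl e≢e′

  xor-0 : ∀ e → e xor 0F ≡ e
  xor-0 0F = refl
  xor-0 1F = refl

  slot : Fin 12 → Fin 2
  slot s = proj₂ (remQuot {6} 2 s)

  -- Exchanges the two children of y_j, for every j, when e is 1.
  twist : Fin 2 → Fin 12 → Fin 12
  twist e s = zBelow (parent s) (e xor slot s)

  twistBy : Vec (Fin 2) 6 → Fin 12 → Fin 12
  twistBy ε s = twist (lookup ε (parent s)) s

  Opposite Together : Fin 12 → Fin 12 → Set
  Opposite i j = (i ∈ˢ S × j ∉ˢ S) ⊎ (i ∉ˢ S × j ∈ˢ S)
  Together i j = (i ∈ˢ S × j ∈ˢ S) ⊎ (i ∉ˢ S × j ∉ˢ S)

  opposite? : ∀ i j → Dec (Opposite i j)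
  opposite? i j = ((i ∈ˢ? S) ×-dec ¬? (j ∈ˢ? S)) ⊎-dec (¬? (i ∈ˢ? S) ×-dec (j ∈ˢ? S))

  together? : ∀ i j → Dec (Together i j)
  together? i j = ((i ∈ˢ? S) ×-dec (j ∈ˢ? S)) ⊎-dec (¬? (i ∈ˢ? S) ×-dec ¬? (j ∈ˢ? S))

  ModelAdj : Fin 28 → Fin 28 → Set
  ModelAdj i j = ∃[ k ] lookup (modelNeighbours i) k ≡ j

  modelAdj? : ∀ i j → Dec (ModelAdj i j)
  modelAdj? i j = any? λ k → lookup (modelNeighbours i) k ≟ᶠ j

  uᴹ : Fin 3 → Fin 28
  uᴹ a = encode (U a)

  yᴹ : Fin 6 → Fin 28
  yᴹ j = encode (Y j)

  zᴹ : Fin 12 → Fin 28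
  zᴹ s = encode (Z s)

  wᴹ : Fin 6 → Fin 28
  wᴹ i = encode (W i)

  triangle-partner : Fin 12 → Fin 12
  triangle-partner = Matching.partner triangles

  abstract
    uᴹ-injective : ∀ a b → uᴹ a ≡ uᴹ b → a ≡ b
    uᴹ-injective = from-yes (all? λ a → all? λ b → (uᴹ a ≟ᶠ uᴹ b) →-dec (a ≟ᶠ b))

    zᴹ-injective : ∀ a b → zᴹ a ≡ zᴹ b → a ≡ b
    zᴹ-injective = from-yes (all? λ a → all? λ b → (zᴹ a ≟ᶠ zᴹ b) →-dec (a ≟ᶠ b))

    uᴹ-level : ∀ a → modelLevel (uᴹ a) ≡ 1
    uᴹ-level = from-yes (all? λ a → modelLevel (uᴹ a) ≟ 1)

    zᴹ-level : ∀ a → modelLevel (zᴹ a) ≡ 3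
    zᴹ-level = from-yes (all? λ a → modelLevel (zᴹ a) ≟ 3)

    wᴹ-level : ∀ a → modelLevel (wᴹ a) ≡ 4
    wᴹ-level = from-yes (all? λ a → modelLevel (wᴹ a) ≟ 4)

    uᴹ-covers : ∀ k → modelLevel k ≡ 1 → ∃[ a ] uᴹ a ≡ k
    uᴹ-covers = from-yes (all? λ k → (modelLevel k ≟ 1) →-dec any? λ a → uᴹ a ≟ᶠ k)

    zᴹ-covers : ∀ k → modelLevel k ≡ 3 → ∃[ a ] zᴹ a ≡ k
    zᴹ-covers = from-yes (all? λ k → (modelLevel k ≟ 3) →-dec any? λ a → zᴹ a ≟ᶠ k)

    uᴹ-yᴹ : ∀ a e → ModelAdj (uᴹ a) (yᴹ (yBelow a e))
    uᴹ-yᴹ = from-yes (all? λ a → all? λ e → modelAdj? (uᴹ a) (yᴹ (yBelow a e)))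

    yᴹ-zᴹ : ∀ j e → ModelAdj (yᴹ j) (zᴹ (zBelow j e))
    yᴹ-zᴹ = from-yes (all? λ j → all? λ e → modelAdj? (yᴹ j) (zᴹ (zBelow j e)))

    yᴹ-children : ∀ j k → ModelAdj (yᴹ j) k → modelLevel k ≡ 3 → ∃[ e ] zᴹ (zBelow j e) ≡ k
    yᴹ-children = from-yes (all? λ j → all? λ k → modelAdj? (yᴹ j) k →-dec ((modelLevel k ≟ 3) →-dec
      any? λ e → zᴹ (zBelow j e) ≟ᶠ k))

    zᴹ-zᴹ : ∀ s → ModelAdj (zᴹ s) (zᴹ (triangle-partner s))
    zᴹ-zᴹ = from-yes (all? λ s → modelAdj? (zᴹ s) (zᴹ (triangle-partner s)))

    wᴹ-source : ∀ i → ModelAdj (wᴹ i) (zᴹ (source i))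
    wᴹ-source = from-yes (all? λ i → modelAdj? (wᴹ i) (zᴹ (source i)))

    wᴹ-target : ∀ i → ModelAdj (wᴹ i) (zᴹ (target i))
    wᴹ-target = from-yes (all? λ i → modelAdj? (wᴹ i) (zᴹ (target i)))

    zᴹ-opposite : ∀ i j → ModelAdj (zᴹ i) (zᴹ j) → Opposite i j
    zᴹ-opposite = from-yes (all? λ i → all? λ j → modelAdj? (zᴹ i) (zᴹ j) →-dec opposite? i j)

    wᴹ-together : ∀ k → modelLevel k ≡ 4 → ∀ i j → ModelAdj k (zᴹ i) → ModelAdj k (zᴹ j) → Together i j
    wᴹ-together = from-yes (all? λ k → (modelLevel k ≟ 4) →-dec all? λ i → all? λ j →
      modelAdj? k (zᴹ i) →-dec (modelAdj? k (zᴹ j) →-dec together? i j))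

    twist-parent : ∀ e s → parent (twist e s) ≡ parent s
    twist-parent = from-yes (all? λ e → all? λ s → parent (twist e s) ≟ᶠ parent s)

    twist-involutive : ∀ e s → twist e (twist e s) ≡ s
    twist-involutive = from-yes (all? λ e → all? λ s → twist e (twist e s) ≟ᶠ s)

    zBelow-parent-slot : ∀ s → zBelow (parent s) (slot s) ≡ s
    zBelow-parent-slot = from-yes (all? λ s → zBelow (parent s) (slot s) ≟ᶠ s)

    zBelow-injective : ∀ j e e′ → zBelow j e ≡ zBelow j e′ → e ≡ e′
    zBelow-injective = from-yes (all? λ j → all? λ e → all? λ e′ → (zBelow j e ≟ᶠ zBelow j e′) →-dec (e ≟ᶠ e′))

    uniform-twist : ∀ ε → (∀ s → Opposite (twistBy ε s) (twistBy ε (triangle-partner s))) →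
                    (∀ i → Together (twistBy ε (source i)) (twistBy ε (target i))) → ∃[ e ] ∀ j → lookup ε j ≡ e
    uniform-twist (e₀ ∷ e₁ ∷ e₂ ∷ e₃ ∷ e₄ ∷ e₅ ∷ []) = decided e₀ e₁ e₂ e₃ e₄ e₅
      where
      decided : ∀ e₀ e₁ e₂ e₃ e₄ e₅ → let ε = e₀ ∷ e₁ ∷ e₂ ∷ e₃ ∷ e₄ ∷ e₅ ∷ [] in
        (∀ s → Opposite (twistBy ε s) (twistBy ε (triangle-partner s))) →
        (∀ i → Together (twistBy ε (source i)) (twistBy ε (target i))) → ∃[ e ] ∀ j → lookup ε j ≡ e
      decided = from-yes (all? λ e₀ → all? λ e₁ → all? λ e₂ → all? λ e₃ → all? λ e₄ → all? λ e₅ →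
        let ε = e₀ ∷ e₁ ∷ e₂ ∷ e₃ ∷ e₄ ∷ e₅ ∷ [] in
        (all? λ s → opposite? (twistBy ε s) (twistBy ε (triangle-partner s))) →-dec
        ((all? λ i → together? (twistBy ε (source i)) (twistBy ε (target i))) →-dec
         any? λ e → all? λ j → lookup ε j ≟ᶠ e))

  module Orderings {n : ℕ} (Γ : Graph n) (levels : Distance.HasNeighbourLevels Γ) (x : Fin n) where
    open Levels Γ levels

    module WithCoordinates {y : Fin 6 → Fin n} (C : Coordinates Γ x y) where
      open Coordinates C

      φ-adj : ∀ {i j} → ModelAdj i j → Adj (φ i) (φ j)
      φ-adj = Equivalence.from (φ-adjacent _ _)

      level-of : ∀ {i k} → modelLevel i ≡ k → d x (φ i) ≡ k
      level-of = trans (φ-level _)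

      located : ∀ {k} v → d x v ≡ k → ∃[ i ] (φ i ≡ v × modelLevel i ≡ k)
      located v eq = φ⁻¹ v , φ-φ⁻¹ v , trans (sym (φ-level _)) (trans (cong (d x) (φ-φ⁻¹ v)) eq)

      module _ (y-level : ∀ j → d x (y j) ≡ 2) (y-injective : Injective _≡_ _≡_ y)
               (y-covers : ∀ {t} → d x t ≡ 2 → ∃[ j ] y j ≡ t)
               (far : ∀ s → d (y (parent s)) (y (parent (triangle-partner s))) ≡ 3) where

        private
          resolve-u : ∀ {w} → ∃[ i ] (φ i ≡ w × modelLevel i ≡ 1) → ∃[ a ] φ (uᴹ a) ≡ w
          resolve-u (i , refl , eq) = Product.map₂ (cong φ) (uᴹ-covers i eq)

          resolve-z : ∀ {w} → ∃[ i ] (φ i ≡ w × modelLevel i ≡ 3) → ∃[ a ] φ (zᴹ a) ≡ w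
          resolve-z (i , refl , eq) = Product.map₂ (cong φ) (zᴹ-covers i eq)

          child-of : ∀ {j w} → Adj (y j) w → ∃[ i ] (φ i ≡ w × modelLevel i ≡ 3) →
                     w ≡ φ (zᴹ (zBelow j 0F)) ⊎ w ≡ φ (zᴹ (zBelow j 1F))
          child-of {j} adj (i , refl , eq) = which (yᴹ-children j i (Equivalence.to (φ-adjacent _ _)
              (subst (λ v → Adj v (φ i)) (sym (φ-y j)) adj)) eq)
            where
            which : ∃[ e ] zᴹ (zBelow j e) ≡ i → φ i ≡ φ (zᴹ (zBelow j 0F)) ⊎ φ i ≡ φ (zᴹ (zBelow j 1F))
            which (0F , refl) = inj₁ refl
            which (1F , refl) = inj₂ refl

          z-child : ∀ j e → Adj (y j) (φ (zᴹ (zBelow j e)))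
          z-child j e = subst (λ v → Adj v (φ (zᴹ (zBelow j e)))) (φ-y j) (φ-adj (yᴹ-zᴹ j e))

          together : ∀ {w} → ∃[ k ] (φ k ≡ w × modelLevel k ≡ 4) → ∀ i j → Adj w (φ (zᴹ i)) → Adj w (φ (zᴹ j)) → Together i j
          together (k , refl , eq) i j a a′ = wᴹ-together k eq i j (Equivalence.to (φ-adjacent _ _) a) (Equivalence.to (φ-adjacent _ _) a′)

        ordering : VertexOrdering Γ x
        ordering = record
          { u = φ ∘ uᴹ
          ; y = y
          ; z = φ ∘ zᴹ
          ; u-enumerates = (λ eq → uᴹ-injective _ _ (φ-injective eq))
                         , λ w → mk⇔ (resolve-u ∘ located w) (λ { (a , refl) → level-of (uᴹ-level a) })
          ; y-enumerates = y-injective , λ w → mk⇔ y-covers (λ { (j , refl) → y-level j })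
          ; z-enumerates = (λ eq → zᴹ-injective _ _ (φ-injective eq))
                         , λ w → mk⇔ (resolve-z ∘ located w) (λ { (a , refl) → level-of (zᴹ-level a) })
          ; y-pairs = λ a → φ (uᴹ a) , level-of (uᴹ-level a)
                    , subst (Adj (φ (uᴹ a))) (φ-y _) (φ-adj (uᴹ-yᴹ a 0F))
                    , subst (Adj (φ (uᴹ a))) (φ-y _) (φ-adj (uᴹ-yᴹ a 1F))
          ; y₁y₄ = far 1F
          ; y₁y₆ = far 0F
          ; y₄y₆ = far 7F
          ; y₂y₃ = far 3F
          ; y₂y₅ = far 2F
          ; y₃y₅ = far 5F
          ; z-children = λ j w → mk⇔ (λ (adj , eq) → child-of adj (located w eq))
              λ { (inj₁ refl) → z-child j 0F , level-of (zᴹ-level (zBelow j 0F)) ; (inj₂ refl) → z-child j 1F , level-of (zᴹ-level (zBelow j 1F)) }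
          ; Γ₃-edges = λ i j adj → zᴹ-opposite i j (Equivalence.to (φ-adjacent _ _) adj)
          ; Γ₄-neighbours = λ w eq → together (located w eq)
          }

    module OfOrdering (o : VertexOrdering Γ x) where
      private module o = VertexOrdering o

      y-level : ∀ j → d x (o.y j) ≡ 2
      y-level j = Equivalence.from (proj₂ o.y-enumerates _) (j , refl)

      tree : Tree Γ x
      tree = record
        { u = proj₁ ∘ o.y-pairs ; y = o.y ; u-level = proj₁ ∘ proj₂ ∘ o.y-pairs ; y-level = y-level
        ; u-y = λ where
            0F → proj₁ (proj₂ (proj₂ (o.y-pairs 0F)))
            1F → proj₂ (proj₂ (proj₂ (o.y-pairs 0F)))
            2F → proj₁ (proj₂ (proj₂ (o.y-pairs 1F)))
            3F → proj₂ (proj₂ (proj₂ (o.y-pairs 1F)))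
            4F → proj₁ (proj₂ (proj₂ (o.y-pairs 2F)))
            5F → proj₂ (proj₂ (proj₂ (o.y-pairs 2F)))
        ; y-injective = proj₁ o.y-enumerates ; y-covers = λ eq → Equivalence.to (proj₂ o.y-enumerates _) eq }

      far : ∀ s → d (o.y (parent s)) (o.y (parent (triangle-partner s))) ≡ 3
      far = Existence.far-triangles Γ levels x o.y o.y₁y₄ o.y₁y₆ o.y₄y₆ o.y₂y₃ o.y₂y₅ o.y₃y₅

      module _ (C : Coordinates Γ x o.y) where
        open Coordinates C
        open WithCoordinates C

        private
          u-label : ∀ i → ∃[ a ] o.u i ≡ φ (uᴹ a)
          u-label i = resolve (located (o.u i) (Equivalence.from (proj₂ o.u-enumerates _) (i , refl)))
            where
            resolve : ∃[ k ] (φ k ≡ o.u i × modelLevel k ≡ 1) → ∃[ a ] o.u i ≡ φ (uᴹ a)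
            resolve (k , eq , lev) = Product.map₂ (λ e → trans (sym eq) (cong φ (sym e))) (uᴹ-covers k lev)

        u-labels : ∃[ π ] (Injective _≡_ _≡_ (lookup π) × ∀ i → o.u i ≡ φ (uᴹ (lookup π i)))
        u-labels = π , (λ {i} {j} eq → proj₁ o.u-enumerates (trans (labelled i) (trans (cong (φ ∘ uᴹ) eq) (sym (labelled j))))) , labelled
          where
          π : Vec (Fin 3) 3
          π = tabulate (proj₁ ∘ u-label)
          labelled : ∀ i → o.u i ≡ φ (uᴹ (lookup π i))
          labelled i = trans (proj₂ (u-label i)) (cong (φ ∘ uᴹ) (sym (lookup∘tabulate (proj₁ ∘ u-label) i)))

        private
          z-label : ∀ j e → ∃[ e′ ] o.z (zBelow j e) ≡ φ (zᴹ (zBelow j e′))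
          z-label j e = resolve (located (o.z (zBelow j e)) (proj₂ child)) (proj₁ child)
            where
            child : Adj (o.y j) (o.z (zBelow j e)) × d x (o.z (zBelow j e)) ≡ 3
            child = Equivalence.from (o.z-children j _) (which e)
              where
              which : ∀ e → o.z (zBelow j e) ≡ o.z (zBelow j 0F) ⊎ o.z (zBelow j e) ≡ o.z (zBelow j 1F)
              which 0F = inj₁ refl
              which 1F = inj₂ refl
            resolve : ∀ {w} → ∃[ k ] (φ k ≡ w × modelLevel k ≡ 3) → Adj (o.y j) w → ∃[ e′ ] w ≡ φ (zᴹ (zBelow j e′))
            resolve (k , refl , lev) adj = Product.map₂ (cong φ ∘ sym) (yᴹ-children j k
              (Equivalence.to (φ-adjacent _ _) (subst (λ v → Adj v (φ k)) (sym (φ-y j)) adj)) lev)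

          ε : Vec (Fin 2) 6
          ε = tabulate λ j → proj₁ (z-label j 0F)

          z-below : ∀ j e → o.z (zBelow j e) ≡ φ (zᴹ (zBelow j (proj₁ (z-label j 0F) xor e)))
          z-below j 0F = trans (proj₂ (z-label j 0F)) (cong (φ ∘ zᴹ ∘ zBelow j) (sym (xor-0 _)))
          z-below j 1F = trans (proj₂ (z-label j 1F)) (cong (φ ∘ zᴹ ∘ zBelow j) (≢⇒xor λ eq →
            contradiction (zBelow-injective j 0F 1F (proj₁ o.z-enumerates
              (trans (proj₂ (z-label j 0F)) (trans (cong (φ ∘ zᴹ ∘ zBelow j) eq) (sym (proj₂ (z-label j 1F))))))) λ ()))

          z-twisted : ∀ s → o.z s ≡ φ (zᴹ (twistBy ε s))
          z-twisted s = trans (cong o.z (sym (zBelow-parent-slot s))) (trans (z-below (parent s) (slot s))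
            (cong (λ e → φ (zᴹ (zBelow (parent s) (e xor slot s)))) (sym (lookup∘tabulate (λ j → proj₁ (z-label j 0F)) (parent s)))))

          untwisted : ∀ s → o.z (twistBy ε s) ≡ φ (zᴹ s)
          untwisted s = trans (z-twisted (twistBy ε s)) (cong (φ ∘ zᴹ)
            (trans (cong (λ j → twist (lookup ε j) (twistBy ε s)) (twist-parent (lookup ε (parent s)) s))
                   (twist-involutive (lookup ε (parent s)) s)))

          adjacent-z : ∀ {v s} → Adj v (φ (zᴹ s)) → Adj v (o.z (twistBy ε s))
          adjacent-z {v} {s} = subst (Adj v) (sym (untwisted s))

          opposite : ∀ s → Opposite (twistBy ε s) (twistBy ε (triangle-partner s))
          opposite s = o.Γ₃-edges _ _ (adjacent-z {s = triangle-partner s} (subst (λ v → Adj v (φ (zᴹ (triangle-partner s))))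
            (sym (untwisted s)) (φ-adj (zᴹ-zᴹ s))))

          together : ∀ i → Together (twistBy ε (source i)) (twistBy ε (target i))
          together i = o.Γ₄-neighbours (φ (wᴹ i)) (level-of (wᴹ-level i)) _ _
            (adjacent-z {s = source i} (φ-adj (wᴹ-source i))) (adjacent-z {s = target i} (φ-adj (wᴹ-target i)))

        z-labels : ∃[ e ] ∀ s → o.z s ≡ φ (zᴹ (twist e s))
        z-labels = Product.map₂
          (λ uniform s → trans (z-twisted s) (cong (λ e → φ (zᴹ (twist e s))) (uniform (parent s))))
          (uniform-twist ε opposite together)

module IntegerMultiples where

  open import Algebra.Solver.Ring.AlmostCommutativeRing using (fromCommutativeRing; _-Raw-AlmostCommutative⟶_)
  import Algebra.Solver.Ring as RingSolver
  open import Data.Integer.Base using (-[1+_]; _⊖_)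
  open import Data.Maybe.Base using (Maybe)
  open import Data.Nat.Base using (zero; suc)
  open import Relation.Binary.PropositionalEquality using (_≡_)
  open import Relation.Nullary.Decidable.Core using (dec⇒maybe)

  module Integers (K : CommutativeRing 0ℓ 0ℓ) where
    open CommutativeRing K
    open RingProperties ring
    open SemiringMult semiring using (×-homo-+; ×1-homo-*; ×-congʳ) renaming (_×_ to _×ᵐ_)
    open SetoidReasoning setoid

    ι : ℤ → Carrier
    ι (+ n)    = n ×ᵐ 1#
    ι -[1+ n ] = - (suc n ×ᵐ 1#)

    private
      cancel-suc : ∀ a b → (1# + a) - (1# + b) ≈ a - b
      cancel-suc a b = begin
        (1# + a) + - (1# + b)     ≈⟨ +-congˡ (-‿+-comm 1# b) ⟨
        (1# + a) + (- 1# + - b)   ≈⟨ +-assoc _ _ _ ⟨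
        ((1# + a) + - 1#) + - b   ≈⟨ +-congʳ (+-congʳ (+-comm 1# a)) ⟩
        ((a + 1#) + - 1#) + - b   ≈⟨ +-congʳ (+-assoc a 1# (- 1#)) ⟩
        (a + (1# + - 1#)) + - b   ≈⟨ +-congʳ (+-congˡ (-‿inverseʳ 1#)) ⟩
        (a + 0#) + - b            ≈⟨ +-congʳ (+-identityʳ a) ⟩
        a + - b                   ∎

    ι-⊖ : ∀ m n → ι (m ⊖ n) ≈ m ×ᵐ 1# - n ×ᵐ 1#
    ι-⊖ zero    zero    = sym (-‿inverseʳ 0#)
    ι-⊖ zero    (suc n) = sym (+-identityˡ _)
    ι-⊖ (suc m) zero    = sym (trans (+-congˡ -0#≈0#) (+-identityʳ _))
    ι-⊖ (suc m) (suc n) = begin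
      ι (suc m ⊖ suc n)         ≡⟨ ≡.cong ι (ℤₚ.[1+m]⊖[1+n]≡m⊖n m n) ⟩
      ι (m ⊖ n)                 ≈⟨ ι-⊖ m n ⟩
      m ×ᵐ 1# - n ×ᵐ 1#           ≈⟨ cancel-suc _ _ ⟨
      suc m ×ᵐ 1# - suc n ×ᵐ 1#   ∎

    ι-+ : ∀ x y → ι (x ℤ.+ y) ≈ ι x + ι y
    ι-+ (+ m)    (+ n)    = ×-homo-+ 1# m n
    ι-+ (+ m)    -[1+ n ] = ι-⊖ m (suc n)
    ι-+ -[1+ m ] (+ n)    = trans (ι-⊖ n (suc m)) (+-comm _ _)
    ι-+ -[1+ m ] -[1+ n ] = begin
      - (suc (suc (m ℕ.+ n)) ×ᵐ 1#)       ≡⟨ ≡.cong (λ k → - (suc k ×ᵐ 1#)) (ℕₚ.+-suc m n) ⟨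
      - ((suc m ℕ.+ suc n) ×ᵐ 1#)         ≈⟨ -‿cong (×-homo-+ 1# (suc m) (suc n)) ⟩
      - (suc m ×ᵐ 1# + suc n ×ᵐ 1#)        ≈⟨ -‿+-comm _ _ ⟨
      - (suc m ×ᵐ 1#) - (suc n ×ᵐ 1#)      ∎

    ι-neg : ∀ x → ι (ℤ.- x) ≈ - ι x
    ι-neg (+ zero)  = sym -0#≈0#
    ι-neg (+ suc n) = refl
    ι-neg -[1+ n ]  = sym (-‿involutive _)

    private
      ι-*⁺ : ∀ m y → ι (+ m ℤ.* y) ≈ ι (+ m) * ι y
      ι-*⁺ m (+ n) = begin
        ι (+ m ℤ.* + n)      ≡⟨ ≡.cong ι (ℤₚ.pos-* m n) ⟨
        (m ℕ.* n) ×ᵐ 1#       ≈⟨ ×1-homo-* m n ⟩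
        m ×ᵐ 1# * (n ×ᵐ 1#)    ∎
      ι-*⁺ m -[1+ n ] = begin
        ι (+ m ℤ.* -[1+ n ])      ≡⟨ ≡.cong ι (ℤₚ.neg-distribʳ-* (+ m) (+ suc n)) ⟨
        ι (ℤ.- (+ m ℤ.* + suc n)) ≈⟨ ι-neg (+ m ℤ.* + suc n) ⟩
        - ι (+ m ℤ.* + suc n)     ≈⟨ -‿cong (ι-*⁺ m (+ suc n)) ⟩
        - (ι (+ m) * ι (+ suc n)) ≈⟨ -‿distribʳ-* _ _ ⟩
        ι (+ m) * - ι (+ suc n)   ∎

    ι-* : ∀ x y → ι (x ℤ.* y) ≈ ι x * ι y
    ι-* (+ m)    y = ι-*⁺ m y
    ι-* -[1+ m ] y = begin
      ι (-[1+ m ] ℤ.* y)        ≡⟨ ≡.cong ι (ℤₚ.neg-distribˡ-* (+ suc m) y) ⟨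
      ι (ℤ.- (+ suc m ℤ.* y))   ≈⟨ ι-neg (+ suc m ℤ.* y) ⟩
      - ι (+ suc m ℤ.* y)       ≈⟨ -‿cong (ι-*⁺ (suc m) y) ⟩
      - (ι (+ suc m) * ι y)     ≈⟨ -‿distribˡ-* _ _ ⟩
      - ι (+ suc m) * ι y       ∎

    ι-1 : ι (+ 1) ≈ 1#
    ι-1 = +-identityʳ 1#

    morphism : CommutativeRing.rawRing ℤₚ.+-*-commutativeRing -Raw-AlmostCommutative⟶ fromCommutativeRing K
    morphism = record
      { ⟦_⟧ = ι ; +-homo = ι-+ ; *-homo = ι-* ; -‿homo = ι-neg ; 0-homo = refl ; 1-homo = ι-1 }

    open RingSolver _ (fromCommutativeRing K) morphism
      (λ x y → Data.Maybe.Base.map (λ eq → reflexive (≡.cong ι eq)) (dec⇒maybe (x ℤₚ.≟ y))) public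
      using (solve; _:=_; _:+_; _:*_; :-_; _:-_; con)

module RealArithmetic where

  open import Defs
  open IntegerMultiples
  open import Algebra.Apartness.Bundles using (HeytingCommutativeRing)
  import Algebra.Apartness.Properties.HeytingCommutativeRing as HeytingProperties
  open import Data.Nat.Base using (zero; suc; _^_)
  open import Data.Nat.Solver using (module +-*-Solver)
  open import Relation.Binary.PropositionalEquality using (_≡_)
  open import Relation.Binary.Structures using (IsStrictPartialOrder)
  open import Relation.Nullary

  module Reals (R : RealNumbers) where
    open RealNumbers R public

    ℝ-ring : CommutativeRing 0ℓ 0ℓ
    ℝ-ring = HeytingCommutativeRing.commutativeRing heytingCommutativeRing

    open CommutativeRing ℝ-ring public using (ring; semiring)
    open Integers ℝ-ring public renaming (ι to fromInteger)
    open HeytingProperties heytingCommutativeRing public using (1#0; x#0y#0→xy#0; #-congʳ; #-congˡ; x-0≈x; invertibleˡ⇒#)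
    open RingProperties ring using (-0#≈0#)
    open IsStrictPartialOrder isStrictPartialOrder public
      using () renaming (irrefl to <-irrefl; trans to <-trans; <-respˡ-≈ to <-respˡ; <-respʳ-≈ to <-respʳ)

    infix 4 _≤ᵣ_
    _≤ᵣ_ : Carrier → Carrier → Set
    a ≤ᵣ b = ¬ (b <ᵣ a)

    <⇒# : ∀ {a b} → a <ᵣ b → a # b
    <⇒# = Equivalence.from (#⇔<⊎> _ _) ∘ inj₁

    #⇒<⊎> : ∀ {a b} → a # b → a <ᵣ b ⊎ b <ᵣ a
    #⇒<⊎> = Equivalence.to (#⇔<⊎> _ _)

    <-cotrans : ∀ {a b} → a <ᵣ b → ∀ c → a <ᵣ c ⊎ c <ᵣ b
    <-cotrans a<b c with #-cotrans (<⇒# a<b) c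
    ... | inj₁ a#c = Sum.map₂ (λ c<a → <-trans c<a a<b) (#⇒<⊎> a#c)
    ... | inj₂ c#b = [ inj₂ , (λ b<c → inj₁ (<-trans a<b b<c)) ]′ (#⇒<⊎> c#b)

    <-≤-trans : ∀ {a b c} → a <ᵣ b → b ≤ᵣ c → a <ᵣ c
    <-≤-trans a<b b≤c = [ (λ a<c → a<c) , ⊥-elim ∘ b≤c ]′ (<-cotrans a<b _)

    ≤-<-trans : ∀ {a b c} → a ≤ᵣ b → b <ᵣ c → a <ᵣ c
    ≤-<-trans a≤b b<c = [ ⊥-elim ∘ a≤b , (λ a<c → a<c) ]′ (<-cotrans b<c _)

    ≤-trans : ∀ {a b c} → a ≤ᵣ b → b ≤ᵣ c → a ≤ᵣ c
    ≤-trans a≤b b≤c c<a = [ b≤c , a≤b ]′ (<-cotrans c<a _)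

    <⇒≤ : ∀ {a b} → a <ᵣ b → a ≤ᵣ b
    <⇒≤ a<b b<a = <-irrefl refl (<-trans a<b b<a)

    ≈⇒≤ : ∀ {a b} → a ≈ b → a ≤ᵣ b
    ≈⇒≤ a≈b b<a = <-irrefl (sym a≈b) b<a

    0<-difference : ∀ {a b} → a <ᵣ b → 0# <ᵣ b - a
    0<-difference {a} {b} a<b = <-respˡ (-‿inverseʳ a) (+-monoˡ-< (- a) a<b)

    difference-0< : ∀ {a b} → 0# <ᵣ b - a → a <ᵣ b
    difference-0< {a} {b} p = <-respˡ (solve 1 (λ a → con (+ 0) :+ a := a) refl a)
      (<-respʳ (solve 2 (λ a b → (b :- a) :+ a := b) refl a b) (+-monoˡ-< a p))

    <-by-difference : ∀ {a b c e} → b - a ≈ e - c → a <ᵣ b → c <ᵣ e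
    <-by-difference eq a<b = difference-0< (<-respʳ eq (0<-difference a<b))

    ≤-by-difference : ∀ {a b c e} → b - a ≈ e - c → a ≤ᵣ b → c ≤ᵣ e
    ≤-by-difference {a} {b} {c} {e} eq a≤b e<c = a≤b (<-by-difference flipped e<c)
      where
      flipped : c - e ≈ a - b
      flipped = trans (solve 2 (λ c e → c :- e := :- (e :- c)) refl c e)
        (trans (-‿cong (sym eq)) (solve 2 (λ a b → :- (b :- a) := a :- b) refl a b))

    *-monoˡ-< : ∀ {a b c} → 0# <ᵣ c → a <ᵣ b → c * a <ᵣ c * b
    *-monoˡ-< {a} {b} {c} 0<c a<b = difference-0<
      (<-respʳ (solve 3 (λ a b c → c :* (b :- a) := c :* b :- c :* a) refl a b c) (*-positive 0<c (0<-difference a<b)))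

    factor#0 : ∀ {a b} → a * b # 0# → b # 0#
    factor#0 {a} {b} ab#0 with #⇒invertible ab#0
    ... | i , i* , _ = invertibleˡ⇒# (i * a , trans (*-congˡ (x-0≈x b)) (trans (*-assoc i a b) (trans (*-congˡ (sym (x-0≈x _))) i*)))

    difference#0 : ∀ {a b} → b - a # 0# → a # b
    difference#0 {a} {b} p with #⇒invertible p
    ... | i , i* , _ = #-sym (invertibleˡ⇒# (i , trans (*-congˡ (sym (x-0≈x _))) i*))

    #-by-difference : ∀ {a b c e} → a - b ≈ c - e → a # b → c # e
    #-by-difference eq a#b with #⇒invertible a#b
    ... | i , i* , *i = invertible⇒# (i , trans (*-congˡ (sym eq)) i* , trans (*-congʳ (sym eq)) *i)

    *-cancelˡ-< : ∀ {a b c} → 0# <ᵣ c → c * a <ᵣ c * b → a <ᵣ b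
    *-cancelˡ-< {a} {b} {c} 0<c ca<cb =
      [ (λ a<b → a<b) , (λ b<a → ⊥-elim (<-irrefl refl (<-trans ca<cb (*-monoˡ-< 0<c b<a)))) ]′
        (#⇒<⊎> (difference#0 (factor#0 product#0)))
      where
      product#0 : c * (b - a) # 0#
      product#0 = #-sym (<⇒# (<-respʳ (solve 3 (λ a b c → c :* b :- c :* a := c :* (b :- a)) refl a b c) (0<-difference ca<cb)))

    *-monoˡ-≤ : ∀ {a b c} → 0# <ᵣ c → a ≤ᵣ b → c * a ≤ᵣ c * b
    *-monoˡ-≤ 0<c a≤b = a≤b ∘ *-cancelˡ-< 0<c

    0<1 : 0# <ᵣ 1#
    0<1 = [ (λ 1<0 → ⊥-elim (<-irrefl refl (<-trans 1<0 (negative 1<0)))) , (λ 0<1 → 0<1) ]′ (#⇒<⊎> 1#0)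
      where
      negative : 1# <ᵣ 0# → 0# <ᵣ 1#
      negative 1<0 = <-respʳ (trans (solve 1 (λ e → (con (+ 0) :- e) :* (con (+ 0) :- e) := e :* e) refl 1#) (*-identityˡ 1#))
        (*-positive (0<-difference 1<0) (0<-difference 1<0))

    fromℕ-* : ∀ m n → fromℕ (m ℕ.* n) ≈ fromℕ m * fromℕ n
    fromℕ-* = SemiringMult.×1-homo-* semiring

    0<fromℕ : ∀ n → 0# <ᵣ fromℕ (suc n)
    0<fromℕ zero    = <-respʳ (sym ι-1) 0<1
    0<fromℕ (suc n) = <-trans (0<fromℕ n) (<-by-difference
      (solve 2 (λ e a → e :- con (+ 0) := (e :+ a) :- a) refl 1# (fromℕ (suc n))) 0<1)

    0≤fromℕ : ∀ n → 0# ≤ᵣ fromℕ n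
    0≤fromℕ zero    = ≈⇒≤ refl
    0≤fromℕ (suc n) = <⇒≤ (0<fromℕ n)

    fromℕ-mono : ∀ {m n} → m ≤ n → fromℕ m ≤ᵣ fromℕ n
    fromℕ-mono {n = n} z≤n   = 0≤fromℕ n
    fromℕ-mono (s≤s {m} {n} m≤n) = ≤-by-difference
      (solve 3 (λ e a b → b :- a := (e :+ b) :- (e :+ a)) refl 1# (fromℕ m) (fromℕ n)) (fromℕ-mono m≤n)

    square-mono : ∀ {a b} → 0# ≤ᵣ a → 0# ≤ᵣ b → a ≤ᵣ b → a * a ≤ᵣ b * b
    square-mono {a} {b} 0≤a 0≤b a≤b bb<aa = [ less , a≤b ]′ (#⇒<⊎> (#-sym (difference#0 (factor#0 product#0))))
      where
      product#0 : (a + b) * (a - b) # 0#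
      product#0 = #-sym (<⇒# (<-respʳ (solve 2 (λ a b → a :* a :- b :* b := (a :+ b) :* (a :- b)) refl a b) (0<-difference bb<aa)))
      less : ¬ (a <ᵣ b)
      less a<b = <-irrefl refl (<-trans bb<aa (difference-0< (<-respʳ
        (solve 2 (λ a b → (b :+ a) :* (b :- a) := b :* b :- a :* a) refl a b) (*-positive 0<b+a (0<-difference a<b)))))
        where
        0<b+a : 0# <ᵣ b + a
        0<b+a = <-≤-trans (≤-<-trans 0≤a a<b) (≤-by-difference (solve 2 (λ a b → a :- con (+ 0) := (b :+ a) :- b) refl a b) 0≤a)

    ≤-antisym : ∀ {a b} → a ≤ᵣ b → b ≤ᵣ a → a ≈ b
    ≤-antisym a≤b b≤a = proj₁ (tight _ _) λ a#b → [ b≤a , a≤b ]′ (#⇒<⊎> a#b)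

    +-mono-≤ : ∀ {a b c e} → a ≤ᵣ b → c ≤ᵣ e → a + c ≤ᵣ b + e
    +-mono-≤ {a} {b} {c} {e} a≤b c≤e = ≤-trans
      (≤-by-difference (solve 3 (λ a b c → b :- a := (b :+ c) :- (a :+ c)) refl a b c) a≤b)
      (≤-by-difference (solve 3 (λ b c e → e :- c := (b :+ e) :- (b :+ c)) refl b c e) c≤e)

    positive-inverse : ∀ {a} → 0# <ᵣ a → ∃[ i ] (0# <ᵣ i × a * i ≈ 1#)
    positive-inverse {a} 0<a with #⇒invertible (#-sym (<⇒# 0<a))
    ... | i , _ , *i = i
      , *-cancelˡ-< 0<a (<-respˡ (solve 1 (λ a → con (+ 0) := a :* con (+ 0)) refl a) (<-respʳ (sym a*i) 0<1))
      , a*i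
      where a*i = trans (*-congʳ (sym (x-0≈x a))) *i

  -- √2 is the limit of t n / 2ⁿ, where t n is the integer part of 2ⁿ √2.
  module SquareRoot (R : RealNumbers) where
    open Reals R
    open SetoidReasoning setoid

    private
      double : ∀ m k → Dec (suc (2 ℕ.* m) ℕ.* suc (2 ℕ.* m) ≤ k) → ℕ
      double m k (yes _) = suc (2 ℕ.* m)
      double m k (no _)  = 2 ℕ.* m

      t : ℕ → ℕ
      t zero    = 1
      t (suc n) = double (t n) (2 ℕ.* 4 ^ suc n) (_ ℕₚ.≤? _)

      lower : ∀ n → t n ℕ.* t n ≤ 2 ℕ.* 4 ^ n
      lower zero    = s≤s z≤n
      lower (suc n) = go (_ ℕₚ.≤? _)
        where
        open +-*-Solver using () renaming (solve to solveℕ; _:*_ to _⊠_; _:=_ to _⊜_; con to κ)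
        go : ∀ q → double (t n) (2 ℕ.* 4 ^ suc n) q ℕ.* double (t n) (2 ℕ.* 4 ^ suc n) q ≤ 2 ℕ.* 4 ^ suc n
        go (yes p) = p
        go (no _)  = ≡.subst₂ _≤_ (solveℕ 1 (λ m → κ 4 ⊠ (m ⊠ m) ⊜ κ 2 ⊠ m ⊠ (κ 2 ⊠ m)) ≡.refl (t n))
          (solveℕ 1 (λ p → κ 4 ⊠ (κ 2 ⊠ p) ⊜ κ 2 ⊠ (κ 4 ⊠ p)) ≡.refl (4 ^ n)) (ℕₚ.*-monoʳ-≤ 4 (lower n))

      upper : ∀ n → 2 ℕ.* 4 ^ n ≤ suc (t n) ℕ.* suc (t n)
      upper zero    = s≤s (s≤s z≤n)
      upper (suc n) = go (_ ℕₚ.≤? _)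
        where
        open +-*-Solver using () renaming (solve to solveℕ; _:*_ to _⊠_; _:+_ to _⊞_; _:=_ to _⊜_; con to κ)
        go : ∀ q → 2 ℕ.* 4 ^ suc n ≤ suc (double (t n) (2 ℕ.* 4 ^ suc n) q) ℕ.* suc (double (t n) (2 ℕ.* 4 ^ suc n) q)
        go (yes _) = ≡.subst₂ _≤_ (solveℕ 1 (λ p → κ 4 ⊠ (κ 2 ⊠ p) ⊜ κ 2 ⊠ (κ 4 ⊠ p)) ≡.refl (4 ^ n))
          (solveℕ 1 (λ m → κ 4 ⊠ ((κ 1 ⊞ m) ⊠ (κ 1 ⊞ m)) ⊜ (κ 2 ⊞ κ 2 ⊠ m) ⊠ (κ 2 ⊞ κ 2 ⊠ m)) ≡.refl (t n))
          (ℕₚ.*-monoʳ-≤ 4 (upper n))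
        go (no ¬p) = ℕₚ.<⇒≤ (ℕₚ.≰⇒> ¬p)

      2t≤ : ∀ n → 2 ℕ.* t n ≤ t (suc n)
      2t≤ n = go (_ ℕₚ.≤? _)
        where
        go : ∀ q → 2 ℕ.* t n ≤ double (t n) (2 ℕ.* 4 ^ suc n) q
        go (yes _) = ℕₚ.n≤1+n _
        go (no _)  = ℕₚ.≤-refl

      ≤2t : ∀ n → suc (t (suc n)) ≤ 2 ℕ.* suc (t n)
      ≤2t n = ≡.subst (suc (t (suc n)) ≤_) (≡.sym (ℕₚ.*-suc 2 (t n))) (s≤s (go (_ ℕₚ.≤? _)))
        where
        go : ∀ q → double (t n) (2 ℕ.* 4 ^ suc n) q ≤ suc (2 ℕ.* t n)
        go (yes _) = ℕₚ.≤-refl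
        go (no _)  = ℕₚ.n≤1+n _

      half : ∃[ h ] (0# <ᵣ h × fromℕ 2 * h ≈ 1#)
      half = positive-inverse (0<fromℕ 1)

      h : Carrier
      h = proj₁ half

      2h : fromℕ 2 * h ≈ 1#
      2h = proj₂ (proj₂ half)

      h^ : ℕ → Carrier
      h^ zero    = 1#
      h^ (suc n) = h * h^ n

      0<h^ : ∀ n → 0# <ᵣ h^ n
      0<h^ zero    = 0<1
      0<h^ (suc n) = *-positive (proj₁ (proj₂ half)) (0<h^ n)

      4^-h^ : ∀ n → (h^ n * h^ n) * fromℕ (4 ^ n) ≈ 1#
      4^-h^ zero    = trans (*-cong (*-identityˡ 1#) ι-1) (*-identityˡ 1#)
      4^-h^ (suc n) = begin
        (h * h^ n * (h * h^ n)) * fromℕ (4 ℕ.* 4 ^ n)             ≈⟨ *-congˡ (fromℕ-* 4 (4 ^ n)) ⟩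
        (h * h^ n * (h * h^ n)) * (fromℕ 4 * fromℕ (4 ^ n))       ≈⟨ solve 3 (λ h p q → (h :* p :* (h :* p)) :* (con (+ 4) :* q)
                                                                      := (con (+ 2) :* h) :* (con (+ 2) :* h) :* (p :* p :* q)) refl h (h^ n) _ ⟩
        (fromℕ 2 * h) * (fromℕ 2 * h) * (h^ n * h^ n * fromℕ (4 ^ n)) ≈⟨ *-cong (*-cong 2h 2h) (4^-h^ n) ⟩
        1# * 1# * 1#                                              ≈⟨ trans (*-identityʳ _) (*-identityˡ 1#) ⟩
        1#                                                        ∎

      scaled : ℕ → ℕ → Carrier
      scaled m n = h^ n * fromℕ m

      scaled-mono : ∀ n {m m′} → m ≤ m′ → scaled m n ≤ᵣ scaled m′ n
      scaled-mono n = *-monoˡ-≤ (0<h^ n) ∘ fromℕ-mono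

      scaled-double : ∀ m n → scaled (2 ℕ.* m) (suc n) ≈ scaled m n
      scaled-double m n = begin
        (h * h^ n) * fromℕ (2 ℕ.* m)      ≈⟨ *-congˡ (fromℕ-* 2 m) ⟩
        (h * h^ n) * (fromℕ 2 * fromℕ m)  ≈⟨ solve 4 (λ h p c q → (h :* p) :* (c :* q) := (c :* h) :* (p :* q)) refl h (h^ n) _ _ ⟩
        (fromℕ 2 * h) * (h^ n * fromℕ m)  ≈⟨ trans (*-congʳ 2h) (*-identityˡ _) ⟩
        h^ n * fromℕ m                    ∎

      scaled-square : ∀ m n → scaled m n * scaled m n ≈ (h^ n * h^ n) * fromℕ (m ℕ.* m)
      scaled-square m n = trans (solve 2 (λ p q → (p :* q) :* (p :* q) := (p :* p) :* (q :* q)) refl (h^ n) (fromℕ m)) (*-congˡ (sym (fromℕ-* m m)))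

      two : ∀ n → (h^ n * h^ n) * fromℕ (2 ℕ.* 4 ^ n) ≈ fromℕ 2
      two n = begin
        (h^ n * h^ n) * fromℕ (2 ℕ.* 4 ^ n)        ≈⟨ *-congˡ (fromℕ-* 2 (4 ^ n)) ⟩
        (h^ n * h^ n) * (fromℕ 2 * fromℕ (4 ^ n))  ≈⟨ solve 3 (λ p c q → p :* (c :* q) := (p :* q) :* c) refl _ _ _ ⟩
        (h^ n * h^ n) * fromℕ (4 ^ n) * fromℕ 2    ≈⟨ trans (*-congʳ (4^-h^ n)) (*-identityˡ _) ⟩
        fromℕ 2                                    ∎

      a b : ℕ → Carrier
      a n = scaled (t n) n
      b n = scaled (suc (t n)) n

      0≤scaled : ∀ m n → 0# ≤ᵣ scaled m n
      0≤scaled m n = ≤-trans (≈⇒≤ (solve 1 (λ p → con (+ 0) := p :* con (+ 0)) refl (h^ n))) (scaled-mono n {0} {m} z≤n)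

      a²≤2 : ∀ n → a n * a n ≤ᵣ fromℕ 2
      a²≤2 n = ≤-trans (≈⇒≤ (scaled-square (t n) n)) (≤-trans
        (*-monoˡ-≤ (*-positive (0<h^ n) (0<h^ n)) (fromℕ-mono (lower n))) (≈⇒≤ (two n)))

      2≤b² : ∀ n → fromℕ 2 ≤ᵣ b n * b n
      2≤b² n = ≤-trans (≈⇒≤ (sym (two n))) (≤-trans
        (*-monoˡ-≤ (*-positive (0<h^ n) (0<h^ n)) (fromℕ-mono (upper n))) (≈⇒≤ (sym (scaled-square (suc (t n)) n))))

      b≈a+h^ : ∀ n → b n ≈ a n + h^ n
      b≈a+h^ n = trans (distribˡ _ _ _) (trans (+-congʳ (*-identityʳ _)) (+-comm _ _))

      a≤b : ∀ n → a n ≤ᵣ b n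
      a≤b n = scaled-mono n {t n} {suc (t n)} (ℕₚ.n≤1+n _)

      a-step : ∀ n → a n ≤ᵣ a (suc n)
      a-step n = ≤-trans (≈⇒≤ (sym (scaled-double (t n) n))) (scaled-mono (suc n) (2t≤ n))

      b-step : ∀ n → b (suc n) ≤ᵣ b n
      b-step n = ≤-trans (scaled-mono (suc n) (≤2t n)) (≈⇒≤ (scaled-double (suc (t n)) n))

      a-mono : ∀ {m n} → m ℕ.≤′ n → a m ≤ᵣ a n
      a-mono     ℕ.≤′-refl           = ≈⇒≤ refl
      a-mono {m} (ℕ.≤′-step {n} m≤n) = ≤-trans (a-mono {m} {n} m≤n) (a-step n)

      b-mono : ∀ {m n} → m ℕ.≤′ n → b n ≤ᵣ b m
      b-mono     ℕ.≤′-refl           = ≈⇒≤ refl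
      b-mono {m} (ℕ.≤′-step {n} m≤n) = ≤-trans (b-step n) (b-mono {m} {n} m≤n)

      h^-bound : ∀ n → scaled (suc n) n ≤ᵣ 1#
      h^-bound zero    = ≈⇒≤ (trans (*-identityˡ _) ι-1)
      h^-bound (suc n) = ≤-trans (scaled-mono (suc n) (≡.subst (suc (suc n) ≤_) (≡.sym (ℕₚ.*-suc 2 n)) (s≤s (s≤s (ℕₚ.m≤m+n n _)))))
        (≤-trans (≈⇒≤ (scaled-double (suc n) n)) (h^-bound n))

      small : ∀ ε → 0# <ᵣ ε → ∃[ n ] h^ n <ᵣ ε
      small ε 0<ε = Product.map₂ (λ {k} → bound k) (archimedean (proj₁ inverse))
        where
        inverse : ∃[ i ] (0# <ᵣ i × ε * i ≈ 1#)
        inverse = positive-inverse 0<ε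
        bound : ∀ k → proj₁ inverse <ᵣ fromℕ k → h^ k <ᵣ ε
        bound k i<k = *-cancelˡ-< (0<fromℕ k) (≤-<-trans (≤-trans (≈⇒≤ (*-comm _ _)) (h^-bound k))
          (<-respʳ (*-comm ε _) (<-respˡ (proj₂ (proj₂ inverse)) (*-monoˡ-< 0<ε (<-≤-trans i<k (fromℕ-mono (ℕₚ.n≤1+n k)))))))

      spread : ∀ N {i j} → N ≤ i → N ≤ j → a i - a j ≤ᵣ h^ N
      spread N {i} {j} N≤i N≤j = ≤-by-difference
        (trans (+-congʳ (+-congˡ (b≈a+h^ N))) (solve 4 (λ ai aj aN p → (aj :+ (aN :+ p)) :- (ai :+ aN) := p :- (ai :- aj)) refl (a i) (a j) (a N) (h^ N)))
        (≤-trans (+-mono-≤ (≤-trans (a≤b i) (b-mono (ℕₚ.≤⇒≤′ N≤i))) (a-mono (ℕₚ.≤⇒≤′ N≤j))) (≈⇒≤ (+-comm _ _)))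

      cauchy : IsCauchy a
      cauchy ε 0<ε = Product.map₂
        (λ h^N<ε i j N≤i N≤j → ≤-<-trans (spread _ N≤i N≤j) h^N<ε , ≤-<-trans (spread _ N≤j N≤i) h^N<ε) (small ε 0<ε)

      limit : ∃[ l ] ConvergesTo a l
      limit = complete a cauchy

      l : Carrier
      l = proj₁ limit

      a≤l : ∀ n → a n ≤ᵣ l
      a≤l n l<a = absurd (proj₂ limit (a n - l) (0<-difference l<a))
        where
        absurd : ¬ (∃[ N ] (∀ i → N ≤ i → Within (a n - l) (a i) l))
        absurd (N , close) = a-mono (ℕₚ.≤⇒≤′ (ℕₚ.m≤m⊔n n N)) (<-by-difference
          (solve 3 (λ ai l an → (an :- l) :- (ai :- l) := an :- ai) refl (a (n ℕ.⊔ N)) l (a n)) (proj₁ (close (n ℕ.⊔ N) (ℕₚ.m≤n⊔m n N))))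

      l≤b : ∀ n → l ≤ᵣ b n
      l≤b n b<l = absurd (proj₂ limit (l - b n) (0<-difference b<l))
        where
        absurd : ¬ (∃[ N ] (∀ i → N ≤ i → Within (l - b n) (a i) l))
        absurd (N , close) = ≤-trans (a≤b (n ℕ.⊔ N)) (b-mono (ℕₚ.≤⇒≤′ (ℕₚ.m≤m⊔n n N))) (<-by-difference
          (solve 3 (λ ai l bn → (l :- bn) :- (l :- ai) := ai :- bn) refl (a (n ℕ.⊔ N)) l (b n)) (proj₂ (close (n ℕ.⊔ N) (ℕₚ.m≤n⊔m n N))))

      b₀≈2 : b 0 ≈ fromℕ 2
      b₀≈2 = *-identityˡ _

      l≤2 : l ≤ᵣ fromℕ 2
      l≤2 = ≤-trans (l≤b 0) (≈⇒≤ b₀≈2)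

      a≤2 : ∀ n → a n ≤ᵣ fromℕ 2
      a≤2 n = ≤-trans (a≤b n) (≤-trans (b-mono {0} {n} (ℕₚ.≤⇒≤′ z≤n)) (≈⇒≤ b₀≈2))

      0≤l : 0# ≤ᵣ l
      0≤l = ≤-trans (0≤scaled (t 0) 0) (a≤l 0)

      h^≤1 : ∀ n → h^ n ≤ᵣ 1#
      h^≤1 n = ≤-trans (≈⇒≤ (sym (trans (*-congˡ ι-1) (*-identityʳ _))))
        (≤-trans (scaled-mono n {1} {suc n} (s≤s z≤n)) (h^-bound n))

      square-close : ∀ n {x y} → 0# ≤ᵣ x → 0# ≤ᵣ y → x ≤ᵣ fromℕ 2 → y ≤ᵣ x + h^ n → y * y ≤ᵣ x * x + h^ n * fromℕ 5
      square-close n {x} {y} 0≤x 0≤y x≤2 y≤x+h = ≤-trans (square-mono 0≤y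
          (≤-trans (≈⇒≤ (solve 0 (con (+ 0) := con (+ 0) :+ con (+ 0)) refl)) (+-mono-≤ 0≤x (<⇒≤ (0<h^ n)))) y≤x+h)
        (≤-trans (≈⇒≤ (solve 2 (λ x p → (x :+ p) :* (x :+ p) := x :* x :+ p :* (x :+ x :+ p)) refl x (h^ n)))
          (+-mono-≤ (≈⇒≤ refl) (*-monoˡ-≤ (0<h^ n) (≤-trans (+-mono-≤ (+-mono-≤ x≤2 x≤2) (h^≤1 n))
            (≈⇒≤ (trans (+-congˡ (sym ι-1)) (solve 0 (con (+ 2) :+ con (+ 2) :+ con (+ 1) := con (+ 5)) refl)))))))

      squeeze : ∀ {x y} → (∀ n → x ≤ᵣ y + h^ n * fromℕ 5) → x ≤ᵣ y
      squeeze {x} {y} bound y<x = absurd (positive-inverse (0<fromℕ 4))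
        where
        absurd : ¬ (∃[ i ] (0# <ᵣ i × fromℕ 5 * i ≈ 1#))
        absurd (i , 0<i , 5i≈1) = close (small (i * (x - y)) (*-positive 0<i (0<-difference y<x)))
          where
          close : ¬ (∃[ n ] h^ n <ᵣ i * (x - y))
          close (n , h^<ε) = bound n (<-by-difference
            (trans (+-congʳ (trans (sym (*-assoc _ _ _)) (trans (*-congʳ 5i≈1) (*-identityˡ _))))
              (solve 4 (λ x y p f → (x :- y) :- f :* p := x :- (y :+ p :* f)) refl x y (h^ n) (fromℕ 5)))
            (*-monoˡ-< (0<fromℕ 4) h^<ε))

    √2-exists : ∃[ s ] IsSquareRoot (fromℕ 2) s
    √2-exists = l , 0≤l , ≤-antisym
      (squeeze λ n → ≤-trans (square-close n (0≤scaled (t n) n) 0≤l (a≤2 n) (≤-trans (l≤b n) (≈⇒≤ (b≈a+h^ n))))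
                             (+-mono-≤ (a²≤2 n) (≈⇒≤ refl)))
      (squeeze λ n → ≤-trans (2≤b² n) (square-close n 0≤l (0≤scaled (suc (t n)) n) l≤2
                               (≤-trans (≈⇒≤ (b≈a+h^ n)) (+-mono-≤ (a≤l n) (≈⇒≤ refl)))))

module ComplexArithmetic where

  open import Defs
  open IntegerMultiples
  open RealArithmetic
  open import Data.Fin.Base using (zero; suc)
  open import Data.Integer.Base using (-[1+_])
  open import Data.Nat.Base using (zero; suc)
  open import Relation.Binary.PropositionalEquality using (_≡_; _≢_)
  open import Relation.Nullary

  module ComplexNumbers (R : RealNumbers) where
    open Complex R
    private
      module ℝ = Reals R
      open ℝ using (solve; _:=_; _:+_; _:*_; :-_; _:-_; con)

    ℂ-ring : CommutativeRing 0ℓ 0ℓ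
    ℂ-ring = record
      { Carrier = ℂ ; _≈_ = _≈_ ; _+_ = _+_ ; _*_ = _*_ ; -_ = -_ ; 0# = 0# ; 1# = 1#
      ; isCommutativeRing = record
        { isRing = record
          { +-isAbelianGroup = record
            { isGroup = record
              { isMonoid = record
                { isSemigroup = record
                  { isMagma = record
                    { isEquivalence = record
                      { refl  = ℝ.refl , ℝ.refl
                      ; sym   = Product.map ℝ.sym ℝ.sym
                      ; trans = λ (p , q) (p′ , q′) → ℝ.trans p p′ , ℝ.trans q q′
                      }
                    ; ∙-cong = λ (p , q) (p′ , q′) → ℝ.+-cong p p′ , ℝ.+-cong q q′
                    }
                  ; assoc = λ a b c → ℝ.+-assoc _ _ _ , ℝ.+-assoc _ _ _
                  }
                ; identity = (λ a → ℝ.+-identityˡ _ , ℝ.+-identityˡ _) , (λ a → ℝ.+-identityʳ _ , ℝ.+-identityʳ _)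
                }
              ; inverse = (λ a → ℝ.-‿inverseˡ _ , ℝ.-‿inverseˡ _) , (λ a → ℝ.-‿inverseʳ _ , ℝ.-‿inverseʳ _)
              ; ⁻¹-cong = λ (p , q) → ℝ.-‿cong p , ℝ.-‿cong q
              }
            ; comm = λ a b → ℝ.+-comm _ _ , ℝ.+-comm _ _
            }
          ; *-cong = λ (p , q) (p′ , q′) → ℝ.+-cong (ℝ.*-cong p p′) (ℝ.-‿cong (ℝ.*-cong q q′))
                                         , ℝ.+-cong (ℝ.*-cong p q′) (ℝ.*-cong q p′)
          ; *-assoc = λ a b c →
              solve 6 (λ a a′ b b′ c c′ → (a :* b :- a′ :* b′) :* c :- (a :* b′ :+ a′ :* b) :* c′
                                       := a :* (b :* c :- b′ :* c′) :- a′ :* (b :* c′ :+ b′ :* c)) ℝ.refl _ _ _ _ _ _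
            , solve 6 (λ a a′ b b′ c c′ → (a :* b :- a′ :* b′) :* c′ :+ (a :* b′ :+ a′ :* b) :* c
                                       := a :* (b :* c′ :+ b′ :* c) :+ a′ :* (b :* c :- b′ :* c′)) ℝ.refl _ _ _ _ _ _
          ; *-identity =
              (λ a → identity-re _ _ , identity-im _ _)
            , (λ a → ℝ.trans (solve 4 (λ a a′ e z → a :* e :- a′ :* z := e :* a :- z :* a′) ℝ.refl _ _ _ _) (identity-re _ _)
                   , ℝ.trans (solve 4 (λ a a′ e z → a :* z :+ a′ :* e := e :* a′ :+ z :* a) ℝ.refl _ _ _ _) (identity-im _ _))
          ; distrib =
              (λ a b c →
                  solve 6 (λ a a′ b b′ c c′ → a :* (b :+ c) :- a′ :* (b′ :+ c′) := (a :* b :- a′ :* b′) :+ (a :* c :- a′ :* c′)) ℝ.refl _ _ _ _ _ _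
                , solve 6 (λ a a′ b b′ c c′ → a :* (b′ :+ c′) :+ a′ :* (b :+ c) := (a :* b′ :+ a′ :* b) :+ (a :* c′ :+ a′ :* c)) ℝ.refl _ _ _ _ _ _)
            , (λ a b c →
                  solve 6 (λ a a′ b b′ c c′ → (b :+ c) :* a :- (b′ :+ c′) :* a′ := (b :* a :- b′ :* a′) :+ (c :* a :- c′ :* a′)) ℝ.refl _ _ _ _ _ _
                , solve 6 (λ a a′ b b′ c c′ → (b :+ c) :* a′ :+ (b′ :+ c′) :* a := (b :* a′ :+ b′ :* a) :+ (c :* a′ :+ c′ :* a)) ℝ.refl _ _ _ _ _ _)
          }
        ; *-comm = λ a b →
              solve 4 (λ a a′ b b′ → a :* b :- a′ :* b′ := b :* a :- b′ :* a′) ℝ.refl _ _ _ _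
            , solve 4 (λ a a′ b b′ → a :* b′ :+ a′ :* b := b :* a′ :+ b′ :* a) ℝ.refl _ _ _ _
        }
      }
      where
      identity-re : ∀ a a′ → ℝ.1# ℝ.* a ℝ.- ℝ.0# ℝ.* a′ ℝ.≈ a
      identity-re a a′ = ℝ.trans (ℝ.+-congʳ (ℝ.*-identityˡ a)) (solve 2 (λ a a′ → a :- con (+ 0) :* a′ := a) ℝ.refl a a′)
      identity-im : ∀ a a′ → ℝ.1# ℝ.* a ℝ.+ ℝ.0# ℝ.* a′ ℝ.≈ a
      identity-im a a′ = ℝ.trans (ℝ.+-congʳ (ℝ.*-identityˡ a)) (solve 2 (λ a a′ → a :+ con (+ 0) :* a′ := a) ℝ.refl a a′)

    private module ℂR = CommutativeRing ℂ-ring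

    private
      +#0 : ∀ {a b} → (a ℝ.+ b) ℝ.# ℝ.0# → a ℝ.# ℝ.0# ⊎ b ℝ.# ℝ.0#
      +#0 {a} {b} p = Sum.map₁ (ℝ.#-by-difference (solve 2 (λ a b → (a :+ b) :- b := a :- con (+ 0)) ℝ.refl a b)) (ℝ.#-cotrans p b)

      -#0 : ∀ {a} → (ℝ.- a) ℝ.# ℝ.0# → a ℝ.# ℝ.0#
      -#0 {a} p = ℝ.#-sym (ℝ.#-by-difference (solve 1 (λ a → :- a :- con (+ 0) := con (+ 0) :- a) ℝ.refl a) p)

      0<square : ∀ {a} → a ℝ.# ℝ.0# → ℝ.0# ℝ.<ᵣ a ℝ.* a
      0<square {a} p = [ (λ a<0 → ℝ.<-respʳ (solve 1 (λ a → (con (+ 0) :- a) :* (con (+ 0) :- a) := a :* a) ℝ.refl a)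
                                    (ℝ.*-positive (ℝ.0<-difference a<0) (ℝ.0<-difference a<0)))
                       , (λ 0<a → ℝ.*-positive 0<a 0<a) ]′ (ℝ.#⇒<⊎> p)

      0≤square : ∀ a → ℝ.0# ℝ.≤ᵣ a ℝ.* a
      0≤square a aa<0 = ℝ.<-irrefl ℝ.refl (ℝ.<-trans aa<0 (0<square (ℝ.factor#0 (ℝ.<⇒# aa<0))))

      norm : ℂ → ℝ.Carrier
      norm a = re a ℝ.* re a ℝ.+ im a ℝ.* im a

      0<norm : ∀ {a} → a # 0# → ℝ.0# ℝ.<ᵣ norm a
      0<norm {a} (inj₁ p) = ℝ.<-≤-trans (0<square p)
        (ℝ.≤-by-difference (solve 2 (λ x y → y :- con (+ 0) := (x :+ y) :- x) ℝ.refl _ _) (0≤square (im a)))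
      0<norm {a} (inj₂ p) = ℝ.<-≤-trans (0<square p)
        (ℝ.≤-by-difference (solve 2 (λ x y → x :- con (+ 0) := (x :+ y) :- y) ℝ.refl _ _) (0≤square (re a)))

    #0-resp : ∀ {a b} → a ≈ b → a # 0# → b # 0#
    #0-resp (p , q) = Sum.map (ℝ.#-congʳ p) (ℝ.#-congʳ q)

    0≈⇒¬# : ∀ {a} → a ≈ 0# → ¬ (a # 0#)
    0≈⇒¬# (p , q) = [ ℝ.#-irrefl p , ℝ.#-irrefl q ]′

    difference#0⇒# : ∀ {a b} → a - b # 0# → a # b
    difference#0⇒# = Sum.map (ℝ.#-sym ∘ ℝ.difference#0) (ℝ.#-sym ∘ ℝ.difference#0)

    *#0ʳ : ∀ {a b} → a * b # 0# → b # 0#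
    *#0ʳ (inj₁ p) = Sum.map ℝ.factor#0 (ℝ.factor#0 ∘ -#0) (+#0 p)
    *#0ʳ (inj₂ p) = Sum.swap (Sum.map ℝ.factor#0 ℝ.factor#0 (+#0 p))

    *#0ˡ : ∀ {a b} → a * b # 0# → a # 0#
    *#0ˡ {a} {b} p = *#0ʳ {b} {a} (#0-resp (ℂR.*-comm a b) p)

    sum#0 : ∀ {n} (f : Fin n → ℂ) → sum f # 0# → ∃[ j ] f j # 0#
    sum#0 {zero}  f p = ⊥-elim (0≈⇒¬# ℂR.refl p)
    sum#0 {suc n} f p = [ (λ q → zero , q) , (λ q → Product.map suc (λ r → r) (sum#0 (f ∘ suc) q)) ]′ (split p)
      where
      split : ∀ {a b} → a + b # 0# → a # 0# ⊎ b # 0#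
      split (inj₁ p) = Sum.map inj₁ inj₁ (+#0 p)
      split (inj₂ p) = Sum.map inj₂ inj₂ (+#0 p)

    inverse : ∀ {a} → a # 0# → ∃[ i ] i * a ≈ 1#
    inverse {a} p = i
      , ℝ.trans (solve 3 (λ x y m → x :* m :* x :- (:- y :* m) :* y := (x :* x :+ y :* y) :* m) ℝ.refl _ _ _) (proj₂ (proj₂ m))
      , solve 3 (λ x y m → x :* m :* y :+ (:- y :* m) :* x := con (+ 0)) ℝ.refl _ _ _
      where
      m = ℝ.positive-inverse (0<norm p)
      i = (re a ℝ.* proj₁ m) +i (ℝ.- im a ℝ.* proj₁ m)

    private
      fromℤ-real : ∀ k → fromℤ k ≈ fromℝ (ℝ.fromInteger k)
      fromℤ-real (+ k)    = ℂR.refl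
      fromℤ-real -[1+ k ] = ℝ.refl , solve 0 (:- con (+ 0) := con (+ 0)) ℝ.refl

    fromℤ-+ : ∀ k l → fromℤ (k ℤ.+ l) ≈ fromℤ k + fromℤ l
    fromℤ-+ k l = begin
      fromℤ (k ℤ.+ l)                                    ≈⟨ fromℤ-real (k ℤ.+ l) ⟩
      fromℝ (ℝ.fromInteger (k ℤ.+ l))                    ≈⟨ ℝ.ι-+ k l , solve 0 (con (+ 0) := con (+ 0) :+ con (+ 0)) ℝ.refl ⟩
      fromℝ (ℝ.fromInteger k) + fromℝ (ℝ.fromInteger l)  ≈⟨ ℂR.+-cong (fromℤ-real k) (fromℤ-real l) ⟨
      fromℤ k + fromℤ l                                  ∎
      where open SetoidReasoning ℂR.setoid

    fromℤ-* : ∀ k l → fromℤ (k ℤ.* l) ≈ fromℤ k * fromℤ l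
    fromℤ-* k l = begin
      fromℤ (k ℤ.* l)                                    ≈⟨ fromℤ-real (k ℤ.* l) ⟩
      fromℝ (ℝ.fromInteger (k ℤ.* l))                    ≈⟨ ℝ.trans (ℝ.ι-* k l) (solve 2 (λ x y → x :* y := x :* y :- con (+ 0) :* con (+ 0)) ℝ.refl _ _)
                                                          , solve 2 (λ x y → con (+ 0) := x :* con (+ 0) :+ con (+ 0) :* y) ℝ.refl _ _ ⟩
      fromℝ (ℝ.fromInteger k) * fromℝ (ℝ.fromInteger l)  ≈⟨ ℂR.*-cong (fromℤ-real k) (fromℤ-real l) ⟨
      fromℤ k * fromℤ l                                  ∎
      where open SetoidReasoning ℂR.setoid

    fromℤ-1 : fromℤ (+ 1) ≈ 1#
    fromℤ-1 = ℝ.ι-1 , ℝ.refl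

    fromℤ#0 : ∀ {k} → k ≢ + 0 → fromℤ k # 0#
    fromℤ#0 {+ zero}    k≢0 = ⊥-elim (k≢0 ≡.refl)
    fromℤ#0 {+ suc k}   _   = inj₁ (ℝ.#-sym (ℝ.<⇒# (ℝ.0<fromℕ k)))
    fromℤ#0 { -[1+ k ]} _   = inj₁ (ℝ.#-by-difference (solve 1 (λ a → con (+ 0) :- a := :- a :- con (+ 0)) ℝ.refl _) (ℝ.<⇒# (ℝ.0<fromℕ k)))

    conj-cong : ∀ {a b} → a ≈ b → conj a ≈ conj b
    conj-cong (p , q) = p , ℝ.-‿cong q

    conj-0 : conj 0# ≈ 0#
    conj-0 = ℝ.refl , solve 0 (:- con (+ 0) := con (+ 0)) ℝ.refl

    conj-+ : ∀ a b → conj (a + b) ≈ conj a + conj b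
    conj-+ a b = ℝ.refl , solve 2 (λ x y → :- (x :+ y) := :- x :+ :- y) ℝ.refl _ _

    conj-* : ∀ a b → conj (a * b) ≈ conj a * conj b
    conj-* a b = solve 4 (λ x x′ y y′ → x :* y :- x′ :* y′ := x :* y :- (:- x′) :* (:- y′)) ℝ.refl _ _ _ _
               , solve 4 (λ x x′ y y′ → :- (x :* y′ :+ x′ :* y) := x :* (:- y′) :+ (:- x′) :* y) ℝ.refl _ _ _ _

    conj-fromℤ : ∀ k → conj (fromℤ k) ≈ fromℤ k
    conj-fromℤ k = ℂR.trans (conj-cong (fromℤ-real k)) (ℂR.trans (ℝ.refl , proj₂ conj-0) (ℂR.sym (fromℤ-real k)))

    conj-sum : ∀ {n} (f : Fin n → ℂ) → conj (sum f) ≈ sum (conj ∘ f)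
    conj-sum {zero}  f = conj-0
    conj-sum {suc n} f = ℂR.trans (conj-+ (f zero) (sum (f ∘ suc))) (ℂR.+-congˡ {conj (f zero)} (conj-sum (f ∘ suc)))

module LinearAlgebra where

  import Algebra.Properties.Semiring.Sum as SemiringSum
  import Algebra.Properties.CommutativeSemigroup as CommutativeSemigroupProperties
  open import Data.Fin.Base using (zero; suc)
  open import Data.Nat.Base using (zero; suc)
  open import Relation.Binary.PropositionalEquality using (_≡_; _≢_)
  open import Relation.Nullary

  -- Finite sums as an abstract operation: Agda infers the arguments of a neutral
  -- term sum f, but not those of the recursive function that implements it.
  record Summation (K : CommutativeRing 0ℓ 0ℓ) : Set where
    open CommutativeRing K hiding (zero)
    field
      sum          : ∀ {n} → (Fin n → Carrier) → Carrier
      sum-zero     : (f : Fin 0 → Carrier) → sum f ≈ 0#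
      sum-suc      : ∀ {n} (f : Fin (suc n) → Carrier) → sum f ≈ f zero + sum (f ∘ suc)
      sum-cong     : ∀ {n} {f g : Fin n → Carrier} → (∀ j → f j ≈ g j) → sum f ≈ sum g
      sum-+        : ∀ {n} (f g : Fin n → Carrier) → sum (λ j → f j + g j) ≈ sum f + sum g
      sum-comm     : ∀ {m n} (f : Fin m → Fin n → Carrier) → sum (λ i → sum (f i)) ≈ sum (λ j → sum λ i → f i j)
      sum-distribˡ : ∀ {n} c (f : Fin n → Carrier) → c * sum f ≈ sum (λ j → c * f j)
      sum-distribʳ : ∀ {n} c (f : Fin n → Carrier) → sum f * c ≈ sum (λ j → f j * c)

  summation : (K : CommutativeRing 0ℓ 0ℓ) → Summation K
  summation K = record
    { sum = sum ; sum-zero = λ _ → refl ; sum-suc = λ _ → refl ; sum-cong = sum-cong-≋ ; sum-+ = ∑-distrib-+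
    ; sum-comm = ∑-comm ; sum-distribˡ = *-distribˡ-sum ; sum-distribʳ = *-distribʳ-sum }
    where
    open CommutativeRing K using (refl; semiring)
    open SemiringSum semiring

  module Linear (K : CommutativeRing 0ℓ 0ℓ) (S : Summation K) where
    open CommutativeRing K hiding (zero) public
    open Summation S public
    open CommutativeSemigroupProperties *-commutativeSemigroup using () renaming (x∙yz≈y∙xz to x*yz≈y*xz) public
    open SetoidReasoning setoid

    δ : ∀ {n} → Fin n → Fin n → Carrier
    δ i j = if does (i ≟ᶠ j) then 1# else 0#

    if-cong : ∀ b {x y z w} → x ≈ y → z ≈ w → (if b then x else z) ≈ (if b then y else w)
    if-cong true  p q = p
    if-cong false p q = q

    δ-refl : ∀ {n} (i : Fin n) → δ i i ≈ 1#
    δ-refl i = reflexive (≡.cong (if_then 1# else 0#) (dec-true (i ≟ᶠ i) ≡.refl))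

    δ-≢ : ∀ {n} {i j : Fin n} → i ≢ j → δ i j ≈ 0#
    δ-≢ {i = i} {j} i≢j = reflexive (≡.cong (if_then 1# else 0#) (dec-false (i ≟ᶠ j) i≢j))

    δ-suc : ∀ {n} (i j : Fin n) → δ (suc i) (suc j) ≡ δ i j
    δ-suc i j = ≡.refl

    δ-sym : ∀ {n} (i j : Fin n) → δ i j ≈ δ j i
    δ-sym zero    zero    = refl
    δ-sym zero    (suc j) = refl
    δ-sym (suc i) zero    = refl
    δ-sym (suc i) (suc j) = trans (reflexive (δ-suc i j)) (trans (δ-sym i j) (reflexive (≡.sym (δ-suc j i))))

    sum-0 : ∀ {n} {f : Fin n → Carrier} → (∀ j → f j ≈ 0#) → sum f ≈ 0#
    sum-0 {zero}  {f} f≈0 = sum-zero f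
    sum-0 {suc n} {f} f≈0 = trans (sum-suc f) (trans (+-cong (f≈0 zero) (sum-0 (f≈0 ∘ suc))) (+-identityˡ 0#))

    sum-δ : ∀ {n} (i : Fin n) (f : Fin n → Carrier) → sum (λ j → δ i j * f j) ≈ f i
    sum-δ zero    f = trans (sum-suc _) (trans (+-cong (*-identityˡ _) (sum-0 λ j → zeroˡ _)) (+-identityʳ _))
    sum-δ (suc i) f = trans (sum-suc _) (trans (+-cong (zeroˡ _) (sum-δ i (f ∘ suc))) (+-identityˡ _))

    sum-δ′ : ∀ {n} (i : Fin n) (f : Fin n → Carrier) → sum (λ j → f j * δ j i) ≈ f i
    sum-δ′ i f = trans (sum-cong λ j → trans (*-comm _ _) (*-congʳ (δ-sym j i))) (sum-δ i f)

    sum-reindex : ∀ {m n} (g : Fin m → Fin n) → Injective _≡_ _≡_ g → (f : Fin n → Carrier) →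
                  (∀ j → (∃[ k ] g k ≡ j) ⊎ f j ≈ 0#) → sum f ≈ sum (f ∘ g)
    sum-reindex g g-inj f off = begin
      sum f                                   ≈⟨ sum-cong (λ j → split j (off j)) ⟩
      sum (λ j → sum (λ k → δ (g k) j * f j)) ≈⟨ sum-comm (λ j k → δ (g k) j * f j) ⟩
      sum (λ k → sum (λ j → δ (g k) j * f j)) ≈⟨ sum-cong (λ k → sum-δ (g k) f) ⟩
      sum (f ∘ g)                             ∎
      where
      δ-injective : ∀ k l → δ (g k) (g l) ≈ δ l k
      δ-injective k l with l ≟ᶠ k
      ... | yes ≡.refl = δ-refl (g l)
      ... | no l≢k     = δ-≢ (l≢k ∘ ≡.sym ∘ g-inj)
      split : ∀ j → (∃[ k ] g k ≡ j) ⊎ f j ≈ 0# → f j ≈ sum (λ k → δ (g k) j * f j)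
      split j (inj₂ fj≈0) = trans fj≈0 (sym (sum-0 λ k → trans (*-congˡ fj≈0) (zeroʳ _)))
      split j (inj₁ (l , ≡.refl)) = sym (trans (sum-cong λ k → *-congʳ (δ-injective k l)) (sum-δ l (λ _ → f (g l))))

    Vector : Set → Set
    Vector I = I → Carrier

    infix  4 _≈ᵥ_
    infixl 6 _+ᵥ_
    infixr 7 _*ₗ_ _·_
    infixl 7 _*ₘ_

    _≈ᵥ_ : ∀ {I} → Vector I → Vector I → Set
    v ≈ᵥ w = ∀ i → v i ≈ w i

    _+ᵥ_ : ∀ {I} → Vector I → Vector I → Vector I
    (v +ᵥ w) i = v i + w i

    _*ₗ_ : ∀ {I} → Carrier → Vector I → Vector I
    (a *ₗ v) i = a * v i

    sumᵥ : ∀ {I k} → (Fin k → Vector I) → Vector I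
    sumᵥ v i = sum λ j → v j i

    combination : ∀ {I k} → (Fin k → Carrier) → (Fin k → Vector I) → Vector I
    combination a v = sumᵥ λ j → a j *ₗ v j

    Matrix : ℕ → Set
    Matrix n = Vector (Fin n × Fin n)

    _·_ : ∀ {n} → Matrix n → Vector (Fin n) → Vector (Fin n)
    (M · v) y = sum λ z → M (y , z) * v z

    _*ₘ_ : ∀ {n} → Matrix n → Matrix n → Matrix n
    (M *ₘ N) (y , z) = sum λ w → M (y , w) * N (w , z)

    Iₘ : ∀ {n} → Matrix n
    Iₘ (y , z) = δ y z

    ⟪_,_⟫ : ∀ {n} → Vector (Fin n) → Vector (Fin n) → Carrier
    ⟪ f , v ⟫ = sum λ y → f y * v y

    combination-congˡ : ∀ {I k} {a b : Fin k → Carrier} (v : Fin k → Vector I) →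
                        (∀ j → a j ≈ b j) → combination a v ≈ᵥ combination b v
    combination-congˡ v p i = sum-cong λ j → *-congʳ (p j)

    combination-congʳ : ∀ {I k} (a : Fin k → Carrier) {v w : Fin k → Vector I} →
                        (∀ j → v j ≈ᵥ w j) → combination a v ≈ᵥ combination a w
    combination-congʳ a q i = sum-cong λ j → *-congˡ (q j i)

    combination-0 : ∀ {I k} {a : Fin k → Carrier} {v : Fin k → Vector I} → (∀ j → a j ≈ 0#) → ∀ i → combination a v i ≈ 0#
    combination-0 p i = sum-0 λ j → trans (*-congʳ (p j)) (zeroˡ _)

    combination-+ : ∀ {I k} (a b : Fin k → Carrier) (v : Fin k → Vector I) →
                    combination (λ j → a j + b j) v ≈ᵥ combination a v +ᵥ combination b v
    combination-+ a b v i = trans (sum-cong λ j → distribʳ _ _ _) (sum-+ (λ j → a j * v j i) (λ j → b j * v j i))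

    combination-* : ∀ {I k} c (a : Fin k → Carrier) (v : Fin k → Vector I) →
                    combination (λ j → c * a j) v ≈ᵥ c *ₗ combination a v
    combination-* c a v i = trans (sum-cong λ j → *-assoc _ _ _) (sym (sum-distribˡ c (λ j → a j * v j i)))

    combination-δ : ∀ {I k} (j : Fin k) (v : Fin k → Vector I) → combination (δ j) v ≈ᵥ v j
    combination-δ j v i = sum-δ j (λ l → v l i)

    combination-combination : ∀ {I k l} (a : Fin k → Carrier) (X : Fin l → Fin k → Carrier) (v : Fin l → Vector I) →
      combination a (λ j → combination (λ i → X i j) v) ≈ᵥ combination (λ i → sum λ j → X i j * a j) v
    combination-combination a X v y = begin
      sum (λ j → a j * sum (λ i → X i j * v i y))   ≈⟨ sum-cong (λ j → sum-distribˡ (a j) (λ i → X i j * v i y)) ⟩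
      sum (λ j → sum (λ i → a j * (X i j * v i y))) ≈⟨ sum-comm (λ j i → a j * (X i j * v i y)) ⟩
      sum (λ i → sum (λ j → a j * (X i j * v i y))) ≈⟨ sum-cong (λ i → sum-cong λ j → trans (sym (*-assoc _ _ _)) (*-congʳ (*-comm _ _))) ⟩
      sum (λ i → sum (λ j → X i j * a j * v i y))   ≈⟨ sum-cong (λ i → sum-distribʳ (v i y) (λ j → X i j * a j)) ⟨
      sum (λ i → sum (λ j → X i j * a j) * v i y)   ∎

    pairing-cong : ∀ {n} {f g v w : Vector (Fin n)} → f ≈ᵥ g → v ≈ᵥ w → ⟪ f , v ⟫ ≈ ⟪ g , w ⟫
    pairing-cong p q = sum-cong λ y → *-cong (p y) (q y)

    pairing-sum : ∀ {n k} (f : Vector (Fin n)) (v : Fin k → Vector (Fin n)) → ⟪ f , sumᵥ v ⟫ ≈ sum (λ j → ⟪ f , v j ⟫)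
    pairing-sum f v = trans (sum-cong λ y → sum-distribˡ (f y) (λ j → v j y)) (sum-comm (λ y j → f y * v j y))

    pairing-* : ∀ {n} (f : Vector (Fin n)) c v → ⟪ f , c *ₗ v ⟫ ≈ c * ⟪ f , v ⟫
    pairing-* f c v = trans (sum-cong λ y → x*yz≈y*xz (f y) c (v y)) (sym (sum-distribˡ c (λ y → f y * v y)))

    pairing-combination : ∀ {n k} (f : Vector (Fin n)) (a : Fin k → Carrier) (v : Fin k → Vector (Fin n)) →
                          ⟪ f , combination a v ⟫ ≈ sum (λ j → a j * ⟪ f , v j ⟫)
    pairing-combination f a v = trans (pairing-sum f (λ j → a j *ₗ v j)) (sum-cong λ j → pairing-* f (a j) (v j))

    module _ {n : ℕ} where

      ·-cong : ∀ {M N : Matrix n} {v w} → M ≈ᵥ N → v ≈ᵥ w → M · v ≈ᵥ N · w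
      ·-cong p q y = sum-cong λ z → *-cong (p (y , z)) (q z)

      ·-combination : ∀ {k} (M : Matrix n) (a : Fin k → Carrier) (v : Fin k → Vector (Fin n)) →
                      M · combination a v ≈ᵥ combination a (λ j → M · v j)
      ·-combination M a v y = pairing-combination (λ z → M (y , z)) a v

      ·-sum : ∀ {k} (M : Matrix n) (v : Fin k → Vector (Fin n)) → M · sumᵥ v ≈ᵥ sumᵥ (λ j → M · v j)
      ·-sum M v y = pairing-sum (λ z → M (y , z)) v

      ·-+ₘ : ∀ (M N : Matrix n) v → (M +ᵥ N) · v ≈ᵥ (M · v) +ᵥ (N · v)
      ·-+ₘ M N v y = trans (sum-cong λ z → distribʳ _ _ _) (sum-+ (λ z → M (y , z) * v z) (λ z → N (y , z) * v z))

      ·-*ₘ : ∀ c (M : Matrix n) v → (c *ₗ M) · v ≈ᵥ c *ₗ (M · v)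
      ·-*ₘ c M v y = trans (sum-cong λ z → *-assoc _ _ _) (sym (sum-distribˡ c (λ z → M (y , z) * v z)))

      ·-sumₘ : ∀ {k} (a : Fin k → Carrier) (M : Fin k → Matrix n) v → combination a M · v ≈ᵥ combination a (λ j → M j · v)
      ·-sumₘ a M v y = begin
        sum (λ z → sum (λ j → a j * M j (y , z)) * v z)   ≈⟨ sum-cong (λ z → sum-distribʳ (v z) (λ j → a j * M j (y , z))) ⟩
        sum (λ z → sum (λ j → a j * M j (y , z) * v z))   ≈⟨ sum-comm (λ z j → a j * M j (y , z) * v z) ⟩
        sum (λ j → sum (λ z → a j * M j (y , z) * v z))   ≈⟨ sum-cong (λ j → ·-*ₘ (a j) (M j) v y) ⟩
        sum (λ j → a j * sum (λ z → M j (y , z) * v z))   ∎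

      ·-assoc : ∀ (M N : Matrix n) v → (M *ₘ N) · v ≈ᵥ M · (N · v)
      ·-assoc M N v y = begin
        sum (λ z → sum (λ w → M (y , w) * N (w , z)) * v z)   ≈⟨ sum-cong (λ z → sum-distribʳ (v z) (λ w → M (y , w) * N (w , z))) ⟩
        sum (λ z → sum (λ w → M (y , w) * N (w , z) * v z))   ≈⟨ sum-comm (λ z w → M (y , w) * N (w , z) * v z) ⟩
        sum (λ w → sum (λ z → M (y , w) * N (w , z) * v z))   ≈⟨ sum-cong (λ w → trans (sum-cong λ z → *-assoc _ _ _)
                                                                     (sym (sum-distribˡ (M (y , w)) (λ z → N (w , z) * v z)))) ⟩
        sum (λ w → M (y , w) * sum (λ z → N (w , z) * v z))   ∎

      Iₘ-· : ∀ (v : Vector (Fin n)) → Iₘ · v ≈ᵥ v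
      Iₘ-· v y = sum-δ y v

      matrix-ext : ∀ {M N : Matrix n} → (∀ v → M · v ≈ᵥ N · v) → M ≈ᵥ N
      matrix-ext {M} {N} eq (y , z) = trans (sym (sum-δ′ z (λ w → M (y , w))))
        (trans (eq (λ w → δ w z) y) (sum-δ′ z (λ w → N (y , w))))

    -- A basis of the space of vectors indexed by Fin n, divided into blocks, with
    -- its dual basis.  Blocks of the same type have the same size.
    module Blocks {Ty : Set} (size : Ty → ℕ) {B n : ℕ} (type : Fin B → Ty)
      (basis dual : ∀ b → Fin (size (type b)) → Vector (Fin n))
      (dual-same : ∀ b i j → ⟪ dual b i , basis b j ⟫ ≈ δ i j)
      (dual-other : ∀ b b′ → b ≢ b′ → ∀ i j → ⟪ dual b i , basis b′ j ⟫ ≈ 0#)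
      (complete : ∀ (y z : Fin n) → sum (λ b → sum (λ i → dual b i z * basis b i y)) ≈ δ y z) where

      coordinate : ∀ b → Fin (size (type b)) → Vector (Fin n) → Carrier
      coordinate b i v = ⟪ dual b i , v ⟫

      component : Fin B → Vector (Fin n) → Vector (Fin n)
      component b v = combination (λ i → coordinate b i v) (basis b)

      coordinate-same : ∀ b i a → coordinate b i (combination a (basis b)) ≈ a i
      coordinate-same b i a = trans (pairing-combination (dual b i) a (basis b))
        (trans (sum-cong λ j → *-congˡ (trans (dual-same b i j) (δ-sym i j))) (sum-δ′ i a))

      coordinate-other : ∀ b b′ → b ≢ b′ → ∀ i a → coordinate b i (combination a (basis b′)) ≈ 0#
      coordinate-other b b′ b≢b′ i a = trans (pairing-combination (dual b i) a (basis b′))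
        (sum-0 λ j → trans (*-congˡ (dual-other b b′ b≢b′ i j)) (zeroʳ _))

      expand : ∀ v → v ≈ᵥ sumᵥ (λ b → component b v)
      expand v y = sym (begin
        sum (λ b → sum (λ i → ⟪ dual b i , v ⟫ * basis b i y))           ≈⟨ sum-cong (λ b → inner b) ⟩
        sum (λ b → sum (λ z → sum (λ i → dual b i z * basis b i y) * v z)) ≈⟨ sum-comm (λ b z → sum (λ i → dual b i z * basis b i y) * v z) ⟩
        sum (λ z → sum (λ b → sum (λ i → dual b i z * basis b i y) * v z)) ≈⟨ sum-cong (λ z → sum-distribʳ (v z) (λ b → sum (λ i → dual b i z * basis b i y))) ⟨
        sum (λ z → sum (λ b → sum (λ i → dual b i z * basis b i y)) * v z) ≈⟨ sum-cong (λ z → *-congʳ (complete y z)) ⟩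
        sum (λ z → δ y z * v z)                                          ≈⟨ sum-δ y v ⟩
        v y                                                              ∎)
        where
        inner : ∀ b → sum (λ i → ⟪ dual b i , v ⟫ * basis b i y) ≈ sum (λ z → sum (λ i → dual b i z * basis b i y) * v z)
        inner b = begin
          sum (λ i → ⟪ dual b i , v ⟫ * basis b i y)            ≈⟨ sum-cong (λ i → sum-distribʳ (basis b i y) (λ z → dual b i z * v z)) ⟩
          sum (λ i → sum (λ z → dual b i z * v z * basis b i y)) ≈⟨ sum-comm (λ i z → dual b i z * v z * basis b i y) ⟩
          sum (λ z → sum (λ i → dual b i z * v z * basis b i y)) ≈⟨ sum-cong (λ z → sum-cong λ i →
                                                                      trans (*-assoc _ _ _) (trans (*-congˡ (*-comm _ _)) (sym (*-assoc _ _ _)))) ⟩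
          sum (λ z → sum (λ i → dual b i z * basis b i y * v z)) ≈⟨ sum-cong (λ z → sum-distribʳ (v z) (λ i → dual b i z * basis b i y)) ⟨
          sum (λ z → sum (λ i → dual b i z * basis b i y) * v z) ∎

      BlockMatrix : Set
      BlockMatrix = ∀ τ → Fin (size τ) → Fin (size τ) → Carrier

      record Acts (M : Matrix n) (X : BlockMatrix) : Set where
        constructor acting
        field act : ∀ b j → M · basis b j ≈ᵥ combination (λ i → X (type b) i j) (basis b)
      open Acts public

      acts-combination : ∀ {M X} → Acts M X → ∀ b a →
        M · combination a (basis b) ≈ᵥ combination (λ i → sum λ j → X (type b) i j * a j) (basis b)
      acts-combination {M} {X} acts b a y = trans (·-combination M a (basis b) y)
        (trans (combination-congʳ a (act acts b) y) (combination-combination a (X (type b)) (basis b) y))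

      acts-resp : ∀ {M N X} → M ≈ᵥ N → Acts M X → Acts N X
      acts-resp eq acts = acting λ b j y → trans (·-cong (sym ∘ eq) (λ _ → refl) y) (act acts b j y)

      acts-ext : ∀ {M X X′} → (∀ τ i j → X τ i j ≈ X′ τ i j) → Acts M X → Acts M X′
      acts-ext eq acts = acting λ b j y → trans (act acts b j y) (combination-congˡ (basis b) (λ i → eq (type b) i j) y)

      acts-I : Acts Iₘ (λ _ i j → δ i j)
      acts-I = acting λ b j y → trans (Iₘ-· (basis b j) y) (sym (trans (combination-congˡ (basis b) (λ i → δ-sym i j) y) (combination-δ j (basis b) y)))

      acts-+ : ∀ {M N X X′} → Acts M X → Acts N X′ → Acts (M +ᵥ N) (λ τ i j → X τ i j + X′ τ i j)
      acts-+ {M} {N} {X} {X′} acts acts′ = acting λ b j y → trans (·-+ₘ M N (basis b j) y)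
        (trans (+-cong (act acts b j y) (act acts′ b j y)) (sym (combination-+ (λ i → X (type b) i j) (λ i → X′ (type b) i j) (basis b) y)))

      acts-* : ∀ {M X} c → Acts M X → Acts (c *ₗ M) (λ τ i j → c * X τ i j)
      acts-* {M} {X} c acts = acting λ b j y → trans (·-*ₘ c M (basis b j) y)
        (trans (*-congˡ (act acts b j y)) (sym (combination-* c (λ i → X (type b) i j) (basis b) y)))

      acts-∘ : ∀ {M N X X′} → Acts M X → Acts N X′ → Acts (M *ₘ N) (λ τ i j → sum λ k → X τ i k * X′ τ k j)
      acts-∘ {M} {N} {X} {X′} acts acts′ = acting λ b j y → trans (·-assoc M N (basis b j) y)
        (trans (·-cong {M = M} (λ _ → refl) (act acts′ b j) y) (acts-combination {X = X} acts b (λ k → X′ (type b) k j) y))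

      acts-sum : ∀ {k} (a : Fin k → Carrier) (M : Fin k → Matrix n) (X : Fin k → BlockMatrix) → (∀ l → Acts (M l) (X l)) →
                 Acts (combination a M) (λ τ i j → sum λ l → a l * X l τ i j)
      acts-sum a M X acts = acting λ b j y → begin
        (combination a M · basis b j) y                                    ≈⟨ ·-sumₘ a M (basis b j) y ⟩
        sum (λ l → a l * (M l · basis b j) y)                              ≈⟨ sum-cong (λ l → *-congˡ (act (acts l) b j y)) ⟩
        sum (λ l → a l * sum (λ i → X l (type b) i j * basis b i y))       ≈⟨ combination-combination a (λ i l → X l (type b) i j) (basis b) y ⟩
        sum (λ i → sum (λ l → X l (type b) i j * a l) * basis b i y)       ≈⟨ sum-cong (λ i → *-congʳ (sum-cong λ l → *-comm _ _)) ⟩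
        sum (λ i → sum (λ l → a l * X l (type b) i j) * basis b i y)       ∎

      acts-unique : ∀ {M N X} → Acts M X → Acts N X → M ≈ᵥ N
      acts-unique {M} {N} {X} acts acts′ = matrix-ext λ v y → begin
        (M · v) y                                  ≈⟨ ·-cong {M = M} (λ _ → refl) (expand v) y ⟩
        (M · sumᵥ (λ b → component b v)) y         ≈⟨ ·-sum M (λ b → component b v) y ⟩
        sum (λ b → (M · component b v) y)          ≈⟨ sum-cong (λ b → acts-combination {X = X} acts b (λ i → coordinate b i v) y) ⟩
        _                                          ≈⟨ sum-cong (λ b → acts-combination {X = X} acts′ b (λ i → coordinate b i v) y) ⟨
        sum (λ b → (N · component b v) y)          ≈⟨ ·-sum N (λ b → component b v) y ⟨
        (N · sumᵥ (λ b → component b v)) y         ≈⟨ ·-cong {M = N} (λ _ → refl) (expand v) y ⟨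
        (N · v) y                                  ∎

      independent : ∀ b a a′ → combination a (basis b) ≈ᵥ combination a′ (basis b) → ∀ i → a i ≈ a′ i
      independent b a a′ eq i = trans (sym (coordinate-same b i a))
        (trans (pairing-cong {f = dual b i} (λ _ → refl) eq) (coordinate-same b i a′))

      acts-injective : ∀ {M X X′} → Acts M X → Acts M X′ → ∀ b i j → X (type b) i j ≈ X′ (type b) i j
      acts-injective {M} {X} {X′} acts acts′ b i j =
        independent b (λ i → X (type b) i j) (λ i → X′ (type b) i j) (λ y → trans (sym (act acts b j y)) (act acts′ b j y)) i

module IntegerBases where

  open import Defs hiding (S)
  open Model
  open VertexOrderings
  open import Data.Fin.Base using (zero; suc)
  open import Data.Integer.Base using (_+_; _*_)
  open import Data.Nat.Base using (zero; suc)
  open import Data.Vec.Base using ([]; _∷_; map; zipWith; replicate)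
  open import Relation.Binary.PropositionalEquality
  open import Relation.Nullary
  open import Agda.Builtin.FromNat using (fromNat)
  open import Agda.Builtin.FromNeg using (fromNeg)

  size : ModuleType → ℕ
  size typeI   = 5
  size typeII  = 5
  size typeIII = 2
  size typeIV  = 4
  size typeV   = 1
  size typeVI  = 2

  SquareMatrix : ℕ → Set
  SquareMatrix k = Vec (Vec ℤ k) k

  rows : ∀ τ → SquareMatrix (size τ)
  rows typeI   = (0 ∷ 3 ∷ 0 ∷ 0 ∷ 0 ∷ [])
               ∷ (1 ∷ 0 ∷ 2 ∷ 0 ∷ 0 ∷ [])
               ∷ (0 ∷ 1 ∷ 0 ∷ 2 ∷ 0 ∷ [])
               ∷ (0 ∷ 0 ∷ 1 ∷ 1 ∷ 1 ∷ [])
               ∷ (0 ∷ 0 ∷ 0 ∷ 2 ∷ 1 ∷ []) ∷ []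
  rows typeII  = (0 ∷ 2 ∷ 0 ∷ 0 ∷ 0 ∷ [])
               ∷ (1 ∷ 0 ∷ 2 ∷ -1 ∷ 0 ∷ [])
               ∷ (0 ∷ 1 ∷ 0 ∷ 1 ∷ 0 ∷ [])
               ∷ (0 ∷ 0 ∷ 1 ∷ 0 ∷ -1 ∷ [])
               ∷ (0 ∷ 0 ∷ 1 ∷ -2 ∷ 1 ∷ []) ∷ []
  rows typeIII = (0 ∷ 2 ∷ []) ∷ (1 ∷ 1 ∷ []) ∷ []
  rows typeIV  = (0 ∷ 2 ∷ -1 ∷ 0 ∷ [])
               ∷ (1 ∷ 0 ∷ 1 ∷ 2 ∷ [])
               ∷ (0 ∷ 1 ∷ 0 ∷ 1 ∷ [])
               ∷ (0 ∷ 1 ∷ 0 ∷ -1 ∷ []) ∷ []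
  rows typeV   = (-1 ∷ []) ∷ []
  rows typeVI  = (-1 ∷ 2 ∷ []) ∷ (1 ∷ -1 ∷ []) ∷ []

  supports : ∀ τ → Vec ℕ (size τ)
  supports typeI   = 0 ∷ 1 ∷ 2 ∷ 3 ∷ 4 ∷ []
  supports typeII  = 1 ∷ 2 ∷ 3 ∷ 3 ∷ 4 ∷ []
  supports typeIII = 2 ∷ 3 ∷ []
  supports typeIV  = 2 ∷ 3 ∷ 3 ∷ 4 ∷ []
  supports typeV   = 3 ∷ []
  supports typeVI  = 3 ∷ 4 ∷ []

  -- A multiple of the inverse of the Gram matrix of the basis of a module of type τ.
  gramInverse : ∀ τ → SquareMatrix (size τ)
  gramInverse typeI   = (12 ∷ 0 ∷ 0 ∷ 0 ∷ 0 ∷ [])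
                      ∷ (0 ∷ 4 ∷ 0 ∷ 0 ∷ 0 ∷ [])
                      ∷ (0 ∷ 0 ∷ 2 ∷ 0 ∷ 0 ∷ [])
                      ∷ (0 ∷ 0 ∷ 0 ∷ 1 ∷ 0 ∷ [])
                      ∷ (0 ∷ 0 ∷ 0 ∷ 0 ∷ 2 ∷ []) ∷ []
  gramInverse typeII  = (6 ∷ 0 ∷ 0 ∷ 0 ∷ 0 ∷ [])
                      ∷ (0 ∷ 3 ∷ 0 ∷ 0 ∷ 0 ∷ [])
                      ∷ (0 ∷ 0 ∷ 2 ∷ 1 ∷ 0 ∷ [])
                      ∷ (0 ∷ 0 ∷ 1 ∷ 2 ∷ 0 ∷ [])
                      ∷ (0 ∷ 0 ∷ 0 ∷ 0 ∷ 3 ∷ []) ∷ []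
  gramInverse typeIII = (2 ∷ 0 ∷ []) ∷ (0 ∷ 1 ∷ []) ∷ []
  gramInverse typeIV  = (3 ∷ 0 ∷ 0 ∷ 0 ∷ [])
                      ∷ (0 ∷ 2 ∷ 1 ∷ 0 ∷ [])
                      ∷ (0 ∷ 1 ∷ 2 ∷ 0 ∷ [])
                      ∷ (0 ∷ 0 ∷ 0 ∷ 1 ∷ []) ∷ []
  gramInverse typeV   = (1 ∷ []) ∷ []
  gramInverse typeVI  = (2 ∷ 0 ∷ []) ∷ (0 ∷ 1 ∷ []) ∷ []

  blockType : Fin 8 → ModuleType
  blockType = lookup (typeI ∷ typeII ∷ typeII ∷ typeIII ∷ typeIV ∷ typeIV ∷ typeV ∷ typeVI ∷ [])

  blockScale : Fin 8 → ℤ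
  blockScale = lookup (6 ∷ 6 ∷ 2 ∷ 6 ∷ 6 ∷ 2 ∷ 6 ∷ 3 ∷ [])

  ℤVector : Set
  ℤVector = Vec ℤ 28

  dot : ∀ {k} → Vec ℤ k → Vec ℤ k → ℤ
  dot []       []       = 0
  dot (x ∷ xs) (y ∷ ys) = x * y + dot xs ys

  sumᶻ : ∀ {k} → (Fin k → ℤ) → ℤ
  sumᶻ {zero}  f = 0
  sumᶻ {suc k} f = f zero + sumᶻ (λ j → f (suc j))

  linear : ∀ {k} → Vec ℤ k → Vec ℤVector k → ℤVector
  linear []       []       = replicate 28 0
  linear (a ∷ as) (v ∷ vs) = zipWith _+_ (map (a *_) v) (linear as vs)

  adjacentSum : ℤVector → ℤVector
  adjacentSum v = tabulate λ y → sumᶻ λ k → lookup v (lookup (modelNeighbours y) k)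

  restrict : ℕ → ℤVector → ℤVector
  restrict i v = tabulate λ y → if does (modelLevel y ≟ i) then lookup v y else 0

  indicator : ℕ → ℤVector
  indicator i = tabulate λ y → if does (modelLevel y ≟ i) then 1 else 0

  essential : ∀ {m} → (Fin m → Fin 28) → Vec ℤ m → ℤVector
  essential ρ a = tabulate λ y → sumᶻ λ j → if does (ρ j ≟ᶠ y) then lookup a j else 0

  record Family : Set where
    constructor family
    field
      block₀ : Vec ℤVector 5
      block₁ : Vec ℤVector 5
      block₂ : Vec ℤVector 5
      block₃ : Vec ℤVector 2
      block₄ : Vec ℤVector 4
      block₅ : Vec ℤVector 4
      block₆ : Vec ℤVector 1
      block₇ : Vec ℤVector 2

  block : Family → ∀ b → Vec ℤVector (size (blockType b))
  block F 0F = Family.block₀ F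
  block F 1F = Family.block₁ F
  block F 2F = Family.block₂ F
  block F 3F = Family.block₃ F
  block F 4F = Family.block₄ F
  block F 5F = Family.block₅ F
  block F 6F = Family.block₆ F
  block F 7F = Family.block₇ F

  member : Family → ∀ b → Fin (size (blockType b)) → ℤVector
  member F b = lookup (block F b)

  integerII : ℤVector → Vec ℤVector 5
  integerII ν = ν ∷ adjacentSum ν ∷ restrict 3 (adjacentSum (adjacentSum ν)) ∷ restrict 3 (adjacentSum (adjacentSum (adjacentSum ν)))
              ∷ restrict 4 (adjacentSum (adjacentSum (adjacentSum ν))) ∷ []

  integerIII : ℤVector → Vec ℤVector 2
  integerIII ν = ν ∷ adjacentSum ν ∷ []

  integerIV : ℤVector → Vec ℤVector 4
  integerIV ν = ν ∷ adjacentSum ν ∷ restrict 3 (adjacentSum (adjacentSum ν)) ∷ restrict 4 (adjacentSum (adjacentSum ν)) ∷ []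

  integerVI : ℤVector → Vec ℤVector 2
  integerVI ν = ν ∷ restrict 4 (adjacentSum ν) ∷ []

  -- π and e record how an ordering of the vertices differs from the order of the model.
  basisFamily : Vec (Fin 3) 3 → Fin 2 → Family
  basisFamily π e = family
    (indicator 0 ∷ indicator 1 ∷ indicator 2 ∷ indicator 3 ∷ indicator 4 ∷ [])
    (integerII (essential u (1 ∷ -1 ∷ 0 ∷ [])))
    (integerII (essential u (1 ∷ 1 ∷ -2 ∷ [])))
    (integerIII (essential yᴹ (1 ∷ -1 ∷ -1 ∷ 1 ∷ -1 ∷ 1 ∷ [])))
    (integerIV (essential yᴹ (1 ∷ -1 ∷ 0 ∷ 0 ∷ 1 ∷ -1 ∷ [])))
    (integerIV (essential yᴹ (1 ∷ -1 ∷ 2 ∷ -2 ∷ -1 ∷ 1 ∷ [])))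
    (essential z (-1 ∷ 1 ∷ -1 ∷ 1 ∷ -1 ∷ 1 ∷ -1 ∷ 1 ∷ 1 ∷ -1 ∷ 1 ∷ -1 ∷ []) ∷ [])
    (integerVI (essential z (-1 ∷ 1 ∷ 1 ∷ -1 ∷ 1 ∷ -1 ∷ -1 ∷ 1 ∷ -1 ∷ 1 ∷ 1 ∷ -1 ∷ [])))
    where
    u : Fin 3 → Fin 28
    u i = uᴹ (lookup π i)
    z : Fin 12 → Fin 28
    z s = zᴹ (twist e s)

  dualFamily : Family → Family
  dualFamily F = family (duals 0F) (duals 1F) (duals 2F) (duals 3F) (duals 4F) (duals 5F) (duals 6F) (duals 7F)
    where
    duals : ∀ b → Vec ℤVector (size (blockType b))
    duals b = map (λ cs → map (blockScale b *_) (linear cs (block F b))) (gramInverse (blockType b))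

  -- The common denominator of the dual basis.
  denominator : ℤ
  denominator = 72

  scaledδ : ∀ {k} → Fin k → Fin k → ℤ
  scaledδ i j = if does (i ≟ᶠ j) then denominator else 0

  record Good (F G : Family) : Set where
    field
      dual-same  : ∀ b i j → dot (member G b i) (member F b j) ≡ scaledδ i j
      dual-other : ∀ b b′ → b ≢ b′ → ∀ i j → dot (member G b i) (member F b′ j) ≡ 0ℤ
      complete   : ∀ y z → sumᶻ (λ b → sumᶻ λ i → lookup (member G b i) z * lookup (member F b i) y) ≡ scaledδ y z
      action     : ∀ b j y → lookup (adjacentSum (member F b j)) y ≡
                   sumᶻ (λ i → lookup (lookup (rows (blockType b)) i) j * lookup (member F b i) y)
      supported  : ∀ b j y → modelLevel y ≡ lookup (supports (blockType b)) j ⊎ lookup (member F b j) y ≡ 0ℤ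
      orthogonal : ∀ b b′ → b ≢ b′ → ∀ i j → dot (member F b i) (member F b′ j) ≡ 0ℤ

  good? : ∀ F G → Dec (Good F G)
  good? F G = map′ (λ (d , o , c , a , s , t) → record { dual-same = d ; dual-other = o ; complete = c ; action = a ; supported = s ; orthogonal = t })
    (λ g → let open Good g in dual-same , dual-other , complete , action , supported , orthogonal)
    ((all? λ b → all? λ i → all? λ j → dot (member G b i) (member F b j) ≟ᶻ scaledδ i j) ×-dec
     ((all? λ b → all? λ b′ → ¬? (b ≟ᶠ b′) →-dec all? λ i → all? λ j → dot (member G b i) (member F b′ j) ≟ᶻ 0ℤ) ×-dec
     ((all? λ y → all? λ z → sumᶻ (λ b → sumᶻ λ i → lookup (member G b i) z * lookup (member F b i) y) ≟ᶻ scaledδ y z) ×-dec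
     ((all? λ b → all? λ j → all? λ y → lookup (adjacentSum (member F b j)) y ≟ᶻ
        sumᶻ (λ i → lookup (lookup (rows (blockType b)) i) j * lookup (member F b i) y)) ×-dec
     ((all? λ b → all? λ j → all? λ y → (modelLevel y ≟ lookup (supports (blockType b)) j) ⊎-dec (lookup (member F b j) y ≟ᶻ 0ℤ)) ×-dec
      (all? λ b → all? λ b′ → ¬? (b ≟ᶠ b′) →-dec all? λ i → all? λ j → dot (member F b i) (member F b′ j) ≟ᶻ 0ℤ))))))
    where open import Relation.Nullary.Decidable using (map′)

  goodBasis? : ∀ F → Dec (Good F (dualFamily F))
  goodBasis? F = good? F (dualFamily F)

  abstract
    basisFamily-good : ∀ π e → (∀ i j → lookup π i ≡ lookup π j → i ≡ j) → Good (basisFamily π e) (dualFamily (basisFamily π e))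
    basisFamily-good (i ∷ j ∷ k ∷ []) e = decided i j k e
      where
      decided : ∀ i j k e → (∀ l m → lookup (i ∷ j ∷ k ∷ []) l ≡ lookup (i ∷ j ∷ k ∷ []) m → l ≡ m) →
                Good (basisFamily (i ∷ j ∷ k ∷ []) e) (dualFamily (basisFamily (i ∷ j ∷ k ∷ []) e))
      decided = from-yes (all? λ i → all? λ j → all? λ k → all? λ e →
        (all? λ l → all? λ m → (lookup (i ∷ j ∷ k ∷ []) l ≟ᶠ lookup (i ∷ j ∷ k ∷ []) m) →-dec (l ≟ᶠ m))
        →-dec goodBasis? (basisFamily (i ∷ j ∷ k ∷ []) e))

module Coordinatisation where

  open import Defs hiding (S; module Complex; module Terwilliger)
  open Model
  open VertexOrderings
  open LinearAlgebra
  open IntegerBases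
  open import Data.Fin.Base using (zero; suc)
  open import Data.Nat.Base using (zero; suc)
  open import Data.Vec.Base using ([]; _∷_)
  open import Relation.Binary.PropositionalEquality using (_≡_; _≢_)
  open import Relation.Nullary

  record Embedding (K : CommutativeRing 0ℓ 0ℓ) : Set where
    open CommutativeRing K
    field
      ι   : ℤ → Carrier
      ι-0 : ι 0ℤ ≈ 0#
      ι-1 : ι 1ℤ ≈ 1#
      ι-+ : ∀ k l → ι (k ℤ.+ l) ≈ ι k + ι l
      ι-* : ∀ k l → ι (k ℤ.* l) ≈ ι k * ι l

  lookup-adjacentSum : ∀ p i → lookup (adjacentSum p) i ≡ sumᶻ (λ k → lookup p (lookup (modelNeighbours i) k))
  lookup-adjacentSum p i = lookup∘tabulate (λ y → sumᶻ λ k → lookup p (lookup (modelNeighbours y) k)) i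

  lookup-restrict : ∀ k p i → lookup (restrict k p) i ≡ (if does (modelLevel i ≟ k) then lookup p i else 0ℤ)
  lookup-restrict k p i = lookup∘tabulate (λ y → if does (modelLevel y ≟ k) then lookup p y else 0ℤ) i

  lookup-indicator : ∀ k i → lookup (indicator k) i ≡ (if does (modelLevel i ≟ k) then 1ℤ else 0ℤ)
  lookup-indicator k i = lookup∘tabulate (λ y → if does (modelLevel y ≟ k) then 1ℤ else 0ℤ) i

  lookup-essential : ∀ {m} (ρ : Fin m → Fin 28) a i → lookup (essential ρ a) i ≡ sumᶻ (λ j → if does (ρ j ≟ᶠ i) then lookup a j else 0ℤ)
  lookup-essential ρ a i = lookup∘tabulate (λ y → sumᶻ λ j → if does (ρ j ≟ᶠ y) then lookup a j else 0ℤ) i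

  module Embedded (K : CommutativeRing 0ℓ 0ℓ) (S : Summation K) (embedding : Embedding K) where
    open Linear K S public
    open Embedding embedding public

    if-* : ∀ b x → (if b then x else 0#) ≈ (if b then 1# else 0#) * x
    if-* true  x = sym (*-identityˡ x)
    if-* false x = sym (zeroˡ x)

    ι-cong : ∀ {k l} → k ≡ l → ι k ≈ ι l
    ι-cong = reflexive ∘ ≡.cong ι

    ι-if : ∀ b {k l} → ι (if b then k else l) ≈ (if b then ι k else ι l)
    ι-if true  = refl
    ι-if false = refl

    ι-bit : ∀ b → ι (if b then 1ℤ else 0ℤ) ≈ (if b then 1# else 0#)
    ι-bit true  = ι-1
    ι-bit false = ι-0

    ι-sum : ∀ {k} (f : Fin k → ℤ) → ι (sumᶻ f) ≈ sum (ι ∘ f)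
    ι-sum {zero}  f = trans ι-0 (sym (sum-zero (ι ∘ f)))
    ι-sum {suc k} f = trans (ι-+ _ _) (trans (+-congˡ (ι-sum (f ∘ suc))) (sym (sum-suc (ι ∘ f))))

    ι-sum-* : ∀ {k} (f g : Fin k → ℤ) → ι (sumᶻ λ j → f j ℤ.* g j) ≈ sum (λ j → ι (f j) * ι (g j))
    ι-sum-* f g = trans (ι-sum (λ j → f j ℤ.* g j)) (sum-cong λ j → ι-* (f j) (g j))

    ι-dot : ∀ {k} (xs ys : Vec ℤ k) → ι (dot xs ys) ≈ sum (λ j → ι (lookup xs j) * ι (lookup ys j))
    ι-dot []       []       = trans ι-0 (sym (sum-zero _))
    ι-dot (x ∷ xs) (y ∷ ys) = trans (ι-+ _ _) (trans (+-cong (ι-* x y) (ι-dot xs ys)) (sym (sum-suc _)))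

    module Transport {n : ℕ} (φ : Fin 28 → Fin n) (φ⁻¹ : Fin n → Fin 28) (φ-φ⁻¹ : ∀ v → φ (φ⁻¹ v) ≡ v)
      (φ-injective : Injective _≡_ _≡_ φ) where

      φ⁻¹-φ : ∀ i → φ⁻¹ (φ i) ≡ i
      φ⁻¹-φ i = φ-injective (φ-φ⁻¹ (φ i))

      everywhere : ∀ {P : Fin n → Set} → (∀ i → P (φ i)) → ∀ y → P y
      everywhere {P} p y = ≡.subst P (φ-φ⁻¹ y) (p (φ⁻¹ y))

      sum-φ : (f : Fin n → Carrier) → sum f ≈ sum (f ∘ φ)
      sum-φ f = sum-reindex φ φ-injective f λ j → inj₁ (φ⁻¹ j , φ-φ⁻¹ j)

      Represents : Vector (Fin n) → ℤVector → Set
      Represents v p = ∀ i → v (φ i) ≈ ι (lookup p i)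

      δ-φ : ∀ i j → δ (φ i) (φ j) ≈ δ i j
      δ-φ i j with i ≟ᶠ j
      ... | yes ≡.refl = δ-refl (φ i)
      ... | no i≢j     = δ-≢ (i≢j ∘ φ-injective)

      represents-essential : ∀ {m} {o : Fin m → Fin n} {ρ : Fin m → Fin 28} → (∀ j → o j ≡ φ (ρ j)) → (a : Vec ℤ m) →
        Represents (λ y → sum λ j → if does (o j ≟ᶠ y) then ι (lookup a j) else 0#) (essential ρ a)
      represents-essential {o = o} {ρ} eq a i = sym (trans (ι-cong (lookup-essential ρ a i)) (trans (ι-sum (λ j → if does (ρ j ≟ᶠ i) then lookup a j else 0ℤ)) (sum-cong λ j →
        trans (ι-if (does (ρ j ≟ᶠ i))) (trans (if-cong (does (ρ j ≟ᶠ i)) refl ι-0)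
          (reflexive (≡.cong (if_then ι (lookup a j) else 0#) (same j)))))))
        where
        same : ∀ j → does (ρ j ≟ᶠ i) ≡ does (o j ≟ᶠ φ i)
        same j with ρ j ≟ᶠ i
        ... | yes e = ≡.sym (dec-true (o j ≟ᶠ φ i) (≡.trans (eq j) (≡.cong φ e)))
        ... | no ¬e = ≡.sym (dec-false (o j ≟ᶠ φ i) (λ e → ¬e (φ-injective (≡.trans (≡.sym (eq j)) e))))

      represents-indicator : ∀ k {v : Vector (Fin n)} → (∀ i → v (φ i) ≈ (if does (modelLevel i ≟ k) then 1# else 0#)) → Represents v (indicator k)
      represents-indicator k eq i = trans (eq i) (sym (trans (ι-cong (lookup-indicator k i)) (ι-bit (does (modelLevel i ≟ k)))))

      module Operators (A : Matrix n) (E : ℕ → Matrix n)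
        (A-φ : ∀ i j → A (φ i , φ j) ≈ (if does (modelAdj? i j) then 1# else 0#))
        (E-· : ∀ k v i → (E k · v) (φ i) ≈ (if does (modelLevel i ≟ k) then v (φ i) else 0#)) where

        represents-A : ∀ {v p} → Represents v p → Represents (A · v) (adjacentSum p)
        represents-A {v} {p} rep i = begin
          sum (λ y → A (φ i , y) * v y)                                  ≈⟨ sum-φ (λ y → A (φ i , y) * v y) ⟩
          sum (λ j → A (φ i , φ j) * v (φ j))                            ≈⟨ sum-reindex (lookup (modelNeighbours i))
                                                                              (λ {k} {l} → modelNeighbours-distinct i k l) _ off ⟩
          sum (λ k → A (φ i , φ (N k)) * v (φ (N k)))                    ≈⟨ sum-cong (λ k → *-cong (on k) (rep (N k))) ⟩
          sum (λ k → 1# * ι (lookup p (N k)))                            ≈⟨ sum-cong (λ k → *-identityˡ _) ⟩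
          sum (λ k → ι (lookup p (N k)))                                 ≈⟨ ι-sum (λ k → lookup p (N k)) ⟨
          ι (sumᶻ λ k → lookup p (N k))                                  ≈⟨ ι-cong (lookup-adjacentSum p i) ⟨
          ι (lookup (adjacentSum p) i)                                   ∎
          where
          open SetoidReasoning setoid
          N = lookup (modelNeighbours i)
          on : ∀ k → A (φ i , φ (N k)) ≈ 1#
          on k = trans (A-φ i (N k)) (reflexive (≡.cong (if_then 1# else 0#) (dec-true (modelAdj? i (N k)) (k , ≡.refl))))
          off : ∀ j → (∃[ k ] N k ≡ j) ⊎ A (φ i , φ j) * v (φ j) ≈ 0#
          off j = decide (modelAdj? i j) (A-φ i j)
            where
            decide : (adj? : Dec (ModelAdj i j)) → A (φ i , φ j) ≈ (if does adj? then 1# else 0#) →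
                     (∃[ k ] N k ≡ j) ⊎ A (φ i , φ j) * v (φ j) ≈ 0#
            decide (yes p) _ = inj₁ p
            decide (no _)  e = inj₂ (trans (*-congʳ e) (zeroˡ _))

        represents-E : ∀ k {v p} → Represents v p → Represents (E k · v) (restrict k p)
        represents-E k {v} {p} rep i = trans (E-· k v i) (trans (if-cong (does (modelLevel i ≟ k)) (rep i) (sym ι-0))
          (trans (sym (ι-if (does (modelLevel i ≟ k)))) (ι-cong (≡.sym (lookup-restrict k p i)))))

        module Basis (F : Family) (good : Good F (dualFamily F)) (d⁻¹ : Carrier) (d⁻¹-inverse : d⁻¹ * ι denominator ≈ 1#)
          (basis : ∀ b → Fin (size (blockType b)) → Vector (Fin n)) (represented : ∀ b j → Represents (basis b j) (member F b j)) where
          open Good good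
          open SetoidReasoning setoid

          dual : ∀ b → Fin (size (blockType b)) → Vector (Fin n)
          dual b i y = d⁻¹ * ι (lookup (member (dualFamily F) b i) (φ⁻¹ y))

          dual-φ : ∀ b i k → dual b i (φ k) ≈ d⁻¹ * ι (lookup (member (dualFamily F) b i) k)
          dual-φ b i k = *-congˡ (ι-cong (≡.cong (lookup (member (dualFamily F) b i)) (φ⁻¹-φ k)))

          dual-pairing : ∀ b b′ i j → ⟪ dual b i , basis b′ j ⟫ ≈ d⁻¹ * ι (dot (member (dualFamily F) b i) (member F b′ j))
          dual-pairing b b′ i j = begin
            sum (λ y → dual b i y * basis b′ j y)             ≈⟨ sum-φ (λ y → dual b i y * basis b′ j y) ⟩
            sum (λ k → dual b i (φ k) * basis b′ j (φ k))     ≈⟨ sum-cong (λ k → trans (*-cong (dual-φ b i k) (represented b′ j k)) (*-assoc _ _ _)) ⟩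
            sum (λ k → d⁻¹ * (ι (lookup (member (dualFamily F) b i) k) * ι (lookup (member F b′ j) k)))
                                                              ≈⟨ sum-distribˡ d⁻¹ _ ⟨
            d⁻¹ * sum (λ k → ι (lookup (member (dualFamily F) b i) k) * ι (lookup (member F b′ j) k))
                                                              ≈⟨ *-congˡ (ι-dot (member (dualFamily F) b i) (member F b′ j)) ⟨
            d⁻¹ * ι (dot (member (dualFamily F) b i) (member F b′ j)) ∎

          unscale : ∀ {k} (i j : Fin k) → d⁻¹ * ι (scaledδ i j) ≈ δ i j
          unscale i j with does (i ≟ᶠ j)
          ... | true  = d⁻¹-inverse
          ... | false = trans (*-congˡ ι-0) (zeroʳ _)

          dual-same′ : ∀ b i j → ⟪ dual b i , basis b j ⟫ ≈ δ i j
          dual-same′ b i j = trans (dual-pairing b b i j) (trans (*-congˡ (ι-cong (dual-same b i j))) (unscale i j))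

          dual-other′ : ∀ b b′ → b ≢ b′ → ∀ i j → ⟪ dual b i , basis b′ j ⟫ ≈ 0#
          dual-other′ b b′ b≢b′ i j = trans (dual-pairing b b′ i j)
            (trans (*-congˡ (trans (ι-cong (dual-other b b′ b≢b′ i j)) ι-0)) (zeroʳ _))

          complete-φ : ∀ k l → sum (λ b → sum λ i → dual b i (φ l) * basis b i (φ k)) ≈ δ (φ k) (φ l)
          complete-φ k l = begin
            sum (λ b → sum λ i → dual b i (φ l) * basis b i (φ k))           ≈⟨ sum-cong (λ b → sum-cong λ i →
              trans (*-cong (dual-φ b i l) (represented b i k)) (trans (*-assoc _ _ _) (*-congˡ (sym (ι-* (D b i) (P b i)))))) ⟩
            sum (λ b → sum λ i → d⁻¹ * ι (D b i ℤ.* P b i))                  ≈⟨ sum-cong (λ b → sum-distribˡ d⁻¹ (λ i → ι (D b i ℤ.* P b i))) ⟨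
            sum (λ b → d⁻¹ * sum λ i → ι (D b i ℤ.* P b i))                  ≈⟨ sum-distribˡ d⁻¹ (λ b → sum λ i → ι (D b i ℤ.* P b i)) ⟨
            d⁻¹ * sum (λ b → sum λ i → ι (D b i ℤ.* P b i))                  ≈⟨ *-congˡ (sum-cong λ b → ι-sum (λ i → D b i ℤ.* P b i)) ⟨
            d⁻¹ * sum (λ b → ι (sumᶻ λ i → D b i ℤ.* P b i))                 ≈⟨ *-congˡ (ι-sum λ b → sumᶻ λ i → D b i ℤ.* P b i) ⟨
            d⁻¹ * ι (sumᶻ λ b → sumᶻ λ i → D b i ℤ.* P b i)                  ≈⟨ *-congˡ (ι-cong (complete k l)) ⟩
            d⁻¹ * ι (scaledδ k l)                                            ≈⟨ unscale k l ⟩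
            δ k l                                                            ≈⟨ δ-φ k l ⟨
            δ (φ k) (φ l)                                                    ∎
            where
            D P : ∀ b → Fin (size (blockType b)) → ℤ
            D b i = lookup (member (dualFamily F) b i) l
            P b i = lookup (member F b i) k

          complete′ : ∀ y z → sum (λ b → sum λ i → dual b i z * basis b i y) ≈ δ y z
          complete′ y z = everywhere {λ z → sum (λ b → sum λ i → dual b i z * basis b i y) ≈ δ y z}
            (λ l → everywhere {λ y → sum (λ b → sum λ i → dual b i (φ l) * basis b i y) ≈ δ y (φ l)} (λ k → complete-φ k l) y) z

          open Blocks size blockType basis dual dual-same′ dual-other′ complete′ public

          rowEntry : ∀ τ → Fin (size τ) → Fin (size τ) → ℤ
          rowEntry τ i j = lookup (lookup (rows τ) i) j

          levelEntry : ℕ → ∀ τ → Fin (size τ) → Fin (size τ) → ℤ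
          levelEntry k τ i j = if does (i ≟ᶠ j) ∧ does (lookup (supports τ) j ≟ k) then 1ℤ else 0ℤ

          acts-A : Acts A (λ τ i j → ι (rowEntry τ i j))
          acts-A = acting λ b j → everywhere λ k → begin
            (A · basis b j) (φ k)                                      ≈⟨ represents-A {p = member F b j} (represented b j) k ⟩
            ι (lookup (adjacentSum (member F b j)) k)                  ≈⟨ ι-cong (action b j k) ⟩
            ι (sumᶻ λ i → rowEntry (blockType b) i j ℤ.* lookup (member F b i) k)
                                                                       ≈⟨ ι-sum-* (λ i → rowEntry (blockType b) i j) (λ i → lookup (member F b i) k) ⟩
            sum (λ i → ι (rowEntry (blockType b) i j) * ι (lookup (member F b i) k))
                                                                       ≈⟨ sum-cong (λ i → *-congˡ (represented b i k)) ⟨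
            sum (λ i → ι (rowEntry (blockType b) i j) * basis b i (φ k)) ∎

          E-basis : ∀ k b j → E k · basis b j ≈ᵥ (if does (lookup (supports (blockType b)) j ≟ k) then 1# else 0#) *ₗ basis b j
          E-basis k b j = everywhere λ y → trans (E-· k (basis b j) y) (at-level y (supported b j y))
            where
            s = lookup (supports (blockType b)) j
            at-level : ∀ y → modelLevel y ≡ s ⊎ lookup (member F b j) y ≡ 0ℤ →
                       (if does (modelLevel y ≟ k) then basis b j (φ y) else 0#) ≈ (if does (s ≟ k) then 1# else 0#) * basis b j (φ y)
            at-level y (inj₁ eq) = trans (reflexive (≡.cong (λ m → if does (m ≟ k) then basis b j (φ y) else 0#) eq)) (if-* (does (s ≟ k)) _)
            at-level y (inj₂ eq) = trans (both (does (modelLevel y ≟ k))) (sym (trans (*-congˡ vanishes) (zeroʳ _)))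
              where
              vanishes : basis b j (φ y) ≈ 0#
              vanishes = trans (represented b j y) (trans (ι-cong eq) ι-0)
              both : ∀ c → (if c then basis b j (φ y) else 0#) ≈ 0#
              both true  = vanishes
              both false = refl

          E-combination : ∀ k b j → E k · basis b j ≈ᵥ combination (λ i → ι (levelEntry k (blockType b) i j)) (basis b)
          E-combination k b j y = trans (E-basis k b j y) (sym (trans (combination-congˡ (basis b) (λ i → entry i) y)
            (trans (combination-* c (δ j) (basis b) y) (*-congˡ (combination-δ j (basis b) y)))))
            where
            c = if does (lookup (supports (blockType b)) j ≟ k) then 1# else 0#
            entry : ∀ i → ι (levelEntry k (blockType b) i j) ≈ c * δ j i
            entry i = trans (ι-bit (does (i ≟ᶠ j) ∧ does (lookup (supports (blockType b)) j ≟ k)))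
              (trans (split (does (i ≟ᶠ j)) (does (lookup (supports (blockType b)) j ≟ k))) (*-congˡ (δ-sym i j)))
              where
              split : ∀ p q → (if p ∧ q then 1# else 0#) ≈ (if q then 1# else 0#) * (if p then 1# else 0#)
              split true  true  = sym (*-identityˡ _)
              split true  false = sym (zeroˡ _)
              split false q     = sym (zeroʳ _)

          acts-E : ∀ k → Acts (E k) (λ τ i j → ι (levelEntry k τ i j))
          acts-E k = acting (E-combination k)

          orthogonal′ : ∀ b b′ → b ≢ b′ → ∀ i j → ⟪ basis b i , basis b′ j ⟫ ≈ 0#
          orthogonal′ b b′ b≢b′ i j = begin
            sum (λ y → basis b i y * basis b′ j y)                                  ≈⟨ sum-φ (λ y → basis b i y * basis b′ j y) ⟩
            sum (λ k → basis b i (φ k) * basis b′ j (φ k))                          ≈⟨ sum-cong (λ k → *-cong (represented b i k) (represented b′ j k)) ⟩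
            sum (λ k → ι (lookup (member F b i) k) * ι (lookup (member F b′ j) k))  ≈⟨ ι-dot (member F b i) (member F b′ j) ⟨
            ι (dot (member F b i) (member F b′ j))                                  ≈⟨ ι-cong (orthogonal b b′ b≢b′ i j) ⟩
            ι 0ℤ                                                                    ≈⟨ ι-0 ⟩
            0#                                                                      ∎

module MatrixUnits where

  open import Defs hiding (S; module Complex; module Terwilliger)
  open LinearAlgebra
  open IntegerBases
  open Coordinatisation
  open import Data.Fin.Base using (combine; splitAt; _↑ˡ_; _↑ʳ_)
  open import Data.Vec.Base using ([]; _∷_)
  open import Data.Product.Properties using (≡-dec)
  open import Relation.Binary.PropositionalEquality using (_≡_; _≢_)
  open import Relation.Nullary
  open import Relation.Nullary.Decidable using (False; toWitnessFalse)

  allTypes? : {P : ModuleType → Set} → (∀ τ → Dec (P τ)) → Dec (∀ τ → P τ)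
  allTypes? {P} P? = map′
    (λ { (p , q , r , s , t , u) → λ { typeI → p ; typeII → q ; typeIII → r ; typeIV → s ; typeV → t ; typeVI → u } })
    (λ p → p typeI , p typeII , p typeIII , p typeIV , p typeV , p typeVI)
    (P? typeI ×-dec (P? typeII ×-dec (P? typeIII ×-dec (P? typeIV ×-dec (P? typeV ×-dec P? typeVI)))))

  Entry : Set
  Entry = Σ[ τ ∈ ModuleType ] (Fin (size τ) × Fin (size τ))

  offset : ∀ τ → Fin (size τ ℕ.* size τ) → Fin 75
  offset typeI   k = k ↑ˡ 50
  offset typeII  k = 25 ↑ʳ (k ↑ˡ 25)
  offset typeIII k = 50 ↑ʳ (k ↑ˡ 21)
  offset typeIV  k = 54 ↑ʳ (k ↑ˡ 5)
  offset typeV   k = 70 ↑ʳ (k ↑ˡ 4)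
  offset typeVI  k = 71 ↑ʳ k

  position : ∀ τ → Fin (size τ) → Fin (size τ) → Fin 75
  position τ i j = offset τ (combine i j)

  private
    rest₅ : Fin 5 → Entry
    rest₅ = [ (λ k → typeV , remQuot 1 k) , (λ k → typeVI , remQuot {2} 2 k) ]′ ∘ splitAt 1

    rest₂₁ : Fin 21 → Entry
    rest₂₁ = [ (λ k → typeIV , remQuot {4} 4 k) , rest₅ ]′ ∘ splitAt 16

    rest₂₅ : Fin 25 → Entry
    rest₂₅ = [ (λ k → typeIII , remQuot {2} 2 k) , rest₂₁ ]′ ∘ splitAt 4

    rest₅₀ : Fin 50 → Entry
    rest₅₀ = [ (λ k → typeII , remQuot {5} 5 k) , rest₂₅ ]′ ∘ splitAt 25

  entry : Fin 75 → Entry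
  entry = [ (λ k → typeI , remQuot {5} 5 k) , rest₅₀ ]′ ∘ splitAt 25

  IntegerBlocks : Set
  IntegerBlocks = ∀ τ → Fin (size τ) → Fin (size τ) → ℤ

  infix 4 _≗_ _≗?_
  _≗_ : IntegerBlocks → IntegerBlocks → Set
  X ≗ Y = ∀ τ i j → X τ i j ≡ Y τ i j

  _≗?_ : ∀ X Y → Dec (X ≗ Y)
  X ≗? Y = allTypes? λ τ → all? λ i → all? λ j → X τ i j ≟ᶻ Y τ i j

  infixl 6 _⊕_
  infixl 7 _⊗_
  infixr 8 _⊙_
  _⊕_ _⊗_ : IntegerBlocks → IntegerBlocks → IntegerBlocks
  (X ⊕ Y) τ i j = X τ i j ℤ.+ Y τ i j
  (X ⊗ Y) τ i j = sumᶻ λ k → X τ i k ℤ.* Y τ k j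

  _⊙_ : ℤ → IntegerBlocks → IntegerBlocks
  (c ⊙ X) τ i j = c ℤ.* X τ i j

  adjacency : IntegerBlocks
  adjacency τ i j = lookup (lookup (rows τ) i) j

  level : ℕ → IntegerBlocks
  level k τ i j = if does (i ≟ᶠ j) ∧ does (lookup (supports τ) j ≟ k) then 1ℤ else 0ℤ

  unitAt : Fin 75 → IntegerBlocks
  unitAt k τ i j = if does (position τ i j ≟ᶠ k) then 1ℤ else 0ℤ

  unit : ∀ τ → Fin (size τ) → Fin (size τ) → IntegerBlocks
  unit τ i j = unitAt (position τ i j)

  abstract
    position-entry : ∀ k → let τ , i , j = entry k in position τ i j ≡ k
    position-entry = from-yes (all? λ k → let τ , i , j = entry k in position τ i j ≟ᶠ k)

  typeCode : ModuleType → Fin 6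
  typeCode typeI   = 0F
  typeCode typeII  = 1F
  typeCode typeIII = 2F
  typeCode typeIV  = 3F
  typeCode typeV   = 4F
  typeCode typeVI  = 5F

  typeOf : Fin 6 → ModuleType
  typeOf = lookup (typeI ∷ typeII ∷ typeIII ∷ typeIV ∷ typeV ∷ typeVI ∷ [])

  typeOf-typeCode : ∀ τ → typeOf (typeCode τ) ≡ τ
  typeOf-typeCode typeI   = ≡.refl
  typeOf-typeCode typeII  = ≡.refl
  typeOf-typeCode typeIII = ≡.refl
  typeOf-typeCode typeIV  = ≡.refl
  typeOf-typeCode typeV   = ≡.refl
  typeOf-typeCode typeVI  = ≡.refl

  _≟ᵀ_ : DecidableEquality ModuleType
  τ ≟ᵀ τ′ = map′ (λ eq → ≡.trans (≡.sym (typeOf-typeCode τ)) (≡.trans (≡.cong typeOf eq) (typeOf-typeCode τ′)))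
                 (≡.cong typeCode) (typeCode τ ≟ᶠ typeCode τ′)

  abstract
    entry-position : ∀ τ i j → entry (position τ i j) ≡ (τ , i , j)
    entry-position = from-yes (allTypes? λ τ → all? λ i → all? λ j →
      ≡-dec _≟ᵀ_ (≡-dec _≟ᶠ_ _≟ᶠ_) (entry (position τ i j)) (τ , i , j))

  infixl 6 _⊖_
  _⊖_ : IntegerBlocks → IntegerBlocks → IntegerBlocks
  X ⊖ Y = X ⊕ -1ℤ ⊙ Y

  first : ∀ τ → Fin (size τ)
  first typeI   = 0F
  first typeII  = 0F
  first typeIII = 0F
  first typeIV  = 0F
  first typeV   = 0F
  first typeVI  = 0F

  abstract
    column-row : ∀ τ i j → unit τ i (first τ) ⊗ unit τ (first τ) j ≗ unit τ i j
    column-row = from-yes (allTypes? λ τ → all? λ i → all? λ j → (unit τ i (first τ) ⊗ unit τ (first τ) j) ≗? unit τ i j)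

  module Generation (K : CommutativeRing 0ℓ 0ℓ) (S : Summation K) (embedding : Embedding K) where
    open Embedded K S embedding

    BlockMatrix : Set
    BlockMatrix = ∀ τ → Fin (size τ) → Fin (size τ) → Carrier

    module Closed (Realised : BlockMatrix → Set)
      (ext    : ∀ X Y → (∀ τ i j → X τ i j ≈ Y τ i j) → Realised X → Realised Y)
      (plus   : ∀ X Y → Realised X → Realised Y → Realised (λ τ i j → X τ i j + Y τ i j))
      (scale  : ∀ c X → Realised X → Realised (λ τ i j → c * X τ i j))
      (times  : ∀ X Y → Realised X → Realised Y → Realised (λ τ i j → sum λ k → X τ i k * Y τ k j))
      (A∈     : Realised (λ τ i j → ι (adjacency τ i j)))
      (E∈     : ∀ k → k ≤ 4 → Realised (λ τ i j → ι (level k τ i j)))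
      (ι-inverse : ∀ {k} → k ≢ 0ℤ → ∃[ c ] c * ι k ≈ 1#) where

      record Generated (X : IntegerBlocks) : Set where
        constructor generated
        field realised : Realised (λ τ i j → ι (X τ i j))
      open Generated public

      infixl 6 _⊞_
      infixl 7 _⊠_
      infixr 8 _⊡_

      _⊞_ : ∀ {X Y} → Generated X → Generated Y → Generated (X ⊕ Y)
      generated x ⊞ generated y = generated (ext _ _ (λ τ i j → sym (ι-+ _ _)) (plus _ _ x y))

      _⊠_ : ∀ {X Y} → Generated X → Generated Y → Generated (X ⊗ Y)
      _⊠_ {X} {Y} (generated x) (generated y) = generated (ext _ _ (λ τ i j → sym (ι-sum-* (X τ i) (λ k → Y τ k j))) (times _ _ x y))

      _⊡_ : ∀ c {X} → Generated X → Generated (c ⊙ X)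
      c ⊡ generated x = generated (ext _ _ (λ τ i j → sym (ι-* c _)) (scale (ι c) _ x))

      resp : ∀ {X Y} → X ≗ Y → Generated X → Generated Y
      resp eq (generated x) = generated (ext _ _ (λ τ i j → ι-cong (eq τ i j)) x)

      divide : ∀ k {X} Y {k≢0 : False (k ≟ᶻ 0ℤ)} {_ : True (X ≗? k ⊙ Y)} → Generated X → Generated Y
      divide k {X} Y {k≢0} {X≗kY} (generated x) = generated (ext _ _ cancel (scale c _ x))
        where
        inverse = ι-inverse (toWitnessFalse k≢0)
        c = proj₁ inverse
        cancel : ∀ τ i j → c * ι (X τ i j) ≈ ι (Y τ i j)
        cancel τ i j = trans (*-congˡ (trans (ι-cong (toWitness X≗kY τ i j)) (ι-* k (Y τ i j))))
          (trans (sym (*-assoc _ _ _)) (trans (*-congʳ (proj₂ inverse)) (*-identityˡ _)))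

      rewritten : ∀ {X} Y {_ : True (X ≗? Y)} → Generated X → Generated Y
      rewritten Y {X≗Y} = resp (toWitness X≗Y)

      a : Generated adjacency
      a = generated A∈

      e₀ : Generated (level 0)
      e₀ = generated (E∈ 0 z≤n)
      e₁ : Generated (level 1)
      e₁ = generated (E∈ 1 (s≤s z≤n))
      e₂ : Generated (level 2)
      e₂ = generated (E∈ 2 (s≤s (s≤s z≤n)))
      e₃ : Generated (level 3)
      e₃ = generated (E∈ 3 (s≤s (s≤s (s≤s z≤n))))
      e₄ : Generated (level 4)
      e₄ = generated (E∈ 4 (s≤s (s≤s (s≤s (s≤s z≤n)))))

      infixl 6 _⊟_
      _⊟_ : ∀ {X Y} → Generated X → Generated Y → Generated (X ⊖ Y)
      x ⊟ y = x ⊞ -1ℤ ⊡ y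

      below : ∀ {X k} → Generated (level k) → Generated X → Generated (level k ⊗ (adjacency ⊗ X))
      below e x = e ⊠ (a ⊠ x)

      above : ∀ {X k} → Generated (level k) → Generated X → Generated (X ⊗ (adjacency ⊗ level k))
      above e x = x ⊠ (a ⊠ e)

      private
        products : ∀ τ → (∀ i → Generated (unit τ i (first τ))) → (∀ j → Generated (unit τ (first τ) j)) → ∀ i j → Generated (unit τ i j)
        products τ columns rs i j = resp (column-row τ i j) (columns i ⊠ rs j)

        unit-I : ∀ i j → Generated (unit typeI i j)
        unit-I = products typeI (λ { 0F → c0 ; 1F → c1 ; 2F → c2 ; 3F → c3 ; 4F → c4 }) (λ { 0F → c0 ; 1F → r1 ; 2F → r2 ; 3F → r3 ; 4F → r4 })
          where
          c0 = rewritten (unit typeI 0F 0F) e₀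
          c1 = rewritten (unit typeI 1F 0F) (below e₁ c0)
          c2 = rewritten (unit typeI 2F 0F) (below e₂ c1)
          c3 = rewritten (unit typeI 3F 0F) (below e₃ c2)
          c4 = divide (+ 2) (unit typeI 4F 0F) (below e₄ c3)
          r1 = divide (+ 3) (unit typeI 0F 1F) (above e₁ c0)
          r2 = divide (+ 2) (unit typeI 0F 2F) (above e₂ r1)
          r3 = divide (+ 2) (unit typeI 0F 3F) (above e₃ r2)
          r4 = rewritten (unit typeI 0F 4F) (above e₄ r3)

        unit-II : ∀ i j → Generated (unit typeII i j)
        unit-II = products typeII (λ { 0F → c0 ; 1F → c1 ; 2F → c2 ; 3F → c3 ; 4F → c4 }) (λ { 0F → c0 ; 1F → r1 ; 2F → r2 ; 3F → r3 ; 4F → r4 })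
          where
          c0 = rewritten (unit typeII 0F 0F) (e₁ ⊟ unit-I 1F 1F)
          c1 = rewritten (unit typeII 1F 0F) (below e₂ c0)
          c2 = rewritten (unit typeII 2F 0F) (below e₃ c1)
          c3 = rewritten (unit typeII 3F 0F) (below e₃ c2)
          c4 = rewritten (unit typeII 4F 0F) (below e₄ c2)
          r1 = divide (+ 2) (unit typeII 0F 1F) (above e₂ c0)
          x  = rewritten ((+ 2) ⊙ unit typeII 0F 2F ⊖ unit typeII 0F 3F) (above e₃ r1)
          y  = rewritten ((+ 2) ⊙ unit typeII 0F 3F ⊖ unit typeII 0F 2F) (above e₃ x)
          r2 = divide (+ 3) (unit typeII 0F 2F) ((+ 2) ⊡ x ⊞ y)
          r3 = divide (+ 3) (unit typeII 0F 3F) ((+ 2) ⊡ y ⊞ x)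
          r4 = divide -1ℤ (unit typeII 0F 4F) (above e₄ r3)

        seeds₂ : Generated (unit typeIII 0F 0F ⊕ unit typeIV 0F 0F)
        seeds₂ = rewritten _ (e₂ ⊟ unit-I 2F 2F ⊟ unit-II 1F 1F)

        unit-III : ∀ i j → Generated (unit typeIII i j)
        unit-III = products typeIII (λ { 0F → c0 ; 1F → c1 }) (λ { 0F → c0 ; 1F → r1 })
          where
          l₁ = rewritten (unit typeIII 1F 0F ⊕ unit typeIV 1F 0F) (below e₃ seeds₂)
          l₂ = rewritten (unit typeIII 1F 0F ⊕ unit typeIV 2F 0F) (below e₃ l₁)
          c0 = divide (+ 3) (unit typeIII 0F 0F) (below e₂ l₂ ⊞ seeds₂)
          c1 = rewritten (unit typeIII 1F 0F) (below e₃ c0)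
          r1 = divide (+ 2) (unit typeIII 0F 1F) (above e₃ c0)

        unit-IV : ∀ i j → Generated (unit typeIV i j)
        unit-IV = products typeIV (λ { 0F → c0 ; 1F → c1 ; 2F → c2 ; 3F → c3 }) (λ { 0F → c0 ; 1F → r1 ; 2F → r2 ; 3F → r3 })
          where
          c0 = rewritten (unit typeIV 0F 0F) (seeds₂ ⊟ unit-III 0F 0F)
          c1 = rewritten (unit typeIV 1F 0F) (below e₃ c0)
          c2 = rewritten (unit typeIV 2F 0F) (below e₃ c1)
          c3 = rewritten (unit typeIV 3F 0F) (below e₄ c1)
          x  = rewritten ((+ 2) ⊙ unit typeIV 0F 1F ⊖ unit typeIV 0F 2F) (above e₃ c0)
          y  = rewritten ((+ 2) ⊙ unit typeIV 0F 2F ⊖ unit typeIV 0F 1F) (above e₃ x)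
          r1 = divide (+ 3) (unit typeIV 0F 1F) ((+ 2) ⊡ x ⊞ y)
          r2 = divide (+ 3) (unit typeIV 0F 2F) ((+ 2) ⊡ y ⊞ x)
          r3 = divide (+ 2) (unit typeIV 0F 3F) (above e₄ r1)

        seeds₃ : Generated (unit typeV 0F 0F ⊕ unit typeVI 0F 0F)
        seeds₃ = rewritten _ (e₃ ⊟ unit-I 3F 3F ⊟ unit-II 2F 2F ⊟ unit-II 3F 3F ⊟ unit-III 1F 1F ⊟ unit-IV 1F 1F ⊟ unit-IV 2F 2F)

        unit-VI : ∀ i j → Generated (unit typeVI i j)
        unit-VI = products typeVI (λ { 0F → c0 ; 1F → c1 }) (λ { 0F → c0 ; 1F → r1 })
          where
          l  = rewritten (unit typeVI 1F 0F) (below e₄ seeds₃)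
          c0 = divide (+ 2) (unit typeVI 0F 0F) (below e₃ l)
          c1 = rewritten (unit typeVI 1F 0F) (below e₄ c0)
          r1 = divide (+ 2) (unit typeVI 0F 1F) (above e₄ c0)

        unit-V : ∀ i j → Generated (unit typeV i j)
        unit-V = products typeV (λ { 0F → c0 }) (λ { 0F → c0 })
          where
          c0 = rewritten (unit typeV 0F 0F) (seeds₃ ⊟ unit-VI 0F 0F)

      unit-generated : ∀ τ i j → Generated (unit τ i j)
      unit-generated typeI   = unit-I
      unit-generated typeII  = unit-II
      unit-generated typeIII = unit-III
      unit-generated typeIV  = unit-IV
      unit-generated typeV   = unit-V
      unit-generated typeVI  = unit-VI

      unitAt-generated : ∀ k → Generated (unitAt k)
      unitAt-generated k = let τ , i , j = entry k in ≡.subst (Generated ∘ unitAt) (position-entry k) (unit-generated τ i j)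

module Eigenvectors where

  open import Defs hiding (S; module Complex; module Terwilliger)
  open VertexOrderings
  open IntegerBases
  open import Data.Vec.Base using ([]; _∷_; map; zipWith; replicate; _++_)
  open import Relation.Binary.PropositionalEquality using (_≡_)
  open import Relation.Nullary hiding (⌊_⌋)
  open import Agda.Builtin.FromNat using (fromNat)
  open import Agda.Builtin.FromNeg using (fromNeg)

  -- a +√ b stands for a + b √2.
  infix 5 _+√_
  record ℤ√2 : Set where
    constructor _+√_
    field
      rational irrational : ℤ
  open ℤ√2 public

  infix 4 _≟√_
  _≟√_ : DecidableEquality ℤ√2
  (a +√ b) ≟√ (c +√ d) = map′ (λ { (≡.refl , ≡.refl) → ≡.refl }) (λ { ≡.refl → ≡.refl , ≡.refl }) ((a ≟ᶻ c) ×-dec (b ≟ᶻ d))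

  infixl 6 _+₂_
  infixl 7 _*₂_
  _+₂_ _*₂_ : ℤ√2 → ℤ√2 → ℤ√2
  (a +√ b) +₂ (c +√ d) = (a ℤ.+ c) +√ (b ℤ.+ d)
  (a +√ b) *₂ (c +√ d) = (a ℤ.* c ℤ.+ 2 ℤ.* (b ℤ.* d)) +√ (a ℤ.* d ℤ.+ b ℤ.* c)

  infix 8 ⌊_⌋
  ⌊_⌋ : ℤ → ℤ√2
  ⌊ k ⌋ = k +√ 0

  dot₂ : ∀ {k} → Vec ℤ√2 k → Vec ℤ√2 k → ℤ√2
  dot₂ []       []       = ⌊ 0 ⌋
  dot₂ (x ∷ xs) (y ∷ ys) = x *₂ y +₂ dot₂ xs ys

  linear₂ : ∀ {k n} → Vec ℤ√2 k → Vec (Vec ℤ n) k → Vec ℤ√2 n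
  linear₂ []       []       = replicate _ ⌊ 0 ⌋
  linear₂ (a ∷ as) (v ∷ vs) = zipWith _+₂_ (map (λ k → a *₂ ⌊ k ⌋) v) (linear₂ as vs)

  Table : ℕ → Set
  Table n = Vec (Vec ℤ√2 n) n

  columns : ∀ {n} → Table n → Table n
  columns T = tabulate λ z → tabulate λ k → lookup (lookup T k) z

  lookup-columns : ∀ {n} (T : Table n) z k → lookup (lookup (columns T) z) k ≡ lookup (lookup T k) z
  lookup-columns T z k = ≡.trans (≡.cong (λ v → lookup v k) (lookup∘tabulate (λ z → tabulate λ k → lookup (lookup T k) z) z))
    (lookup∘tabulate (λ k → lookup (lookup T k) z) k)

  scaledδ₂ : ∀ {n} → ℤ → Fin n → Fin n → ℤ√2
  scaledδ₂ N i j = if does (i ≟ᶠ j) then ⌊ N ⌋ else ⌊ 0 ⌋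

  record Diagonalizes {n : ℕ} (M V D : Table n) (θ : Vec ℤ√2 n) (N : ℤ) : Set where
    field
      eigen    : ∀ k y → dot₂ (lookup M y) (lookup V k) ≡ lookup θ k *₂ lookup (lookup V k) y
      dual     : ∀ k l → dot₂ (lookup D k) (lookup V l) ≡ scaledδ₂ N k l
      complete : ∀ y z → dot₂ (lookup (columns D) z) (lookup (columns V) y) ≡ scaledδ₂ N y z

  diagonalizes? : ∀ {n} (M V D : Table n) θ N → Dec (Diagonalizes M V D θ N)
  diagonalizes? M V D θ N = go (columns V) (columns D) ≡.refl ≡.refl
    where
    go : ∀ V′ D′ → V′ ≡ columns V → D′ ≡ columns D → Dec (Diagonalizes M V D θ N)
    go V′ D′ ≡.refl ≡.refl = map′
      (λ (e , d , c) → record { eigen = e ; dual = d ; complete = c })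
      (λ g → let open Diagonalizes g in eigen , dual , complete)
      ((all? λ k → all? λ y → dot₂ (lookup M y) (lookup V k) ≟√ lookup θ k *₂ lookup (lookup V k) y) ×-dec
       ((all? λ k → all? λ l → dot₂ (lookup D k) (lookup V l) ≟√ scaledδ₂ N k l) ×-dec
        (all? λ y → all? λ z → dot₂ (lookup D′ z) (lookup V′ y) ≟√ scaledδ₂ N y z)))

  eigenvalues : ∀ τ → Vec ℤ√2 (size τ)
  eigenvalues typeI   = (3 +√ 0) ∷ (2 +√ 0) ∷ (-1 +√ 1) ∷ (-1 +√ 0) ∷ (-1 +√ -1) ∷ []
  eigenvalues typeII  = (2 +√ 0) ∷ (2 +√ 0) ∷ (-1 +√ 1) ∷ (-1 +√ 0) ∷ (-1 +√ -1) ∷ []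
  eigenvalues typeIII = (2 +√ 0) ∷ (-1 +√ 0) ∷ []
  eigenvalues typeIV  = (2 +√ 0) ∷ (-1 +√ 1) ∷ (-1 +√ 0) ∷ (-1 +√ -1) ∷ []
  eigenvalues typeV   = (-1 +√ 0) ∷ []
  eigenvalues typeVI  = (-1 +√ 1) ∷ (-1 +√ -1) ∷ []

  eigenvectors : ∀ τ → Table (size τ)
  eigenvectors typeI   =
      ((1 +√ 0) ∷ (1 +√ 0) ∷ (1 +√ 0) ∷ (1 +√ 0) ∷ (1 +√ 0) ∷ [])
    ∷ ((-6 +√ 0) ∷ (-4 +√ 0) ∷ (-1 +√ 0) ∷ (1 +√ 0) ∷ (2 +√ 0) ∷ [])
    ∷ ((12 +√ -6) ∷ (-8 +√ 6) ∷ (4 +√ -4) ∷ (-2 +√ 1) ∷ (2 +√ 0) ∷ [])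
    ∷ ((-3 +√ 0) ∷ (1 +√ 0) ∷ (1 +√ 0) ∷ (-1 +√ 0) ∷ (1 +√ 0) ∷ [])
    ∷ ((12 +√ 6) ∷ (-8 +√ -6) ∷ (4 +√ 4) ∷ (-2 +√ -1) ∷ (2 +√ 0) ∷ []) ∷ []
  eigenvectors typeII  =
      ((3 +√ 0) ∷ (3 +√ 0) ∷ (2 +√ 0) ∷ (1 +√ 0) ∷ (0 +√ 0) ∷ [])
    ∷ ((2 +√ 0) ∷ (2 +√ 0) ∷ (1 +√ 0) ∷ (0 +√ 0) ∷ (1 +√ 0) ∷ [])
    ∷ ((-2 +√ 0) ∷ (1 +√ -1) ∷ (0 +√ 1) ∷ (1 +√ 0) ∷ (1 +√ 0) ∷ [])
    ∷ ((2 +√ 0) ∷ (-1 +√ 0) ∷ (0 +√ 0) ∷ (1 +√ 0) ∷ (1 +√ 0) ∷ [])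
    ∷ ((-2 +√ 0) ∷ (1 +√ 1) ∷ (0 +√ -1) ∷ (1 +√ 0) ∷ (1 +√ 0) ∷ []) ∷ []
  eigenvectors typeIII =
      ((1 +√ 0) ∷ (1 +√ 0) ∷ [])
    ∷ ((-2 +√ 0) ∷ (1 +√ 0) ∷ []) ∷ []
  eigenvectors typeIV  =
      ((2 +√ 0) ∷ (3 +√ 0) ∷ (2 +√ 0) ∷ (1 +√ 0) ∷ [])
    ∷ ((-3 +√ -3) ∷ (0 +√ 1) ∷ (3 +√ 2) ∷ (1 +√ 0) ∷ [])
    ∷ ((-1 +√ 0) ∷ (0 +√ 0) ∷ (-1 +√ 0) ∷ (1 +√ 0) ∷ [])
    ∷ ((-3 +√ 3) ∷ (0 +√ -1) ∷ (3 +√ -2) ∷ (1 +√ 0) ∷ []) ∷ []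
  eigenvectors typeV   =
      ((1 +√ 0) ∷ []) ∷ []
  eigenvectors typeVI  =
      ((0 +√ 1) ∷ (1 +√ 0) ∷ [])
    ∷ ((0 +√ -1) ∷ (1 +√ 0) ∷ []) ∷ []

  -- The inverse of the matrix of eigenvectors, times 168.
  dualEigenvectors : ∀ τ → Table (size τ)
  dualEigenvectors typeI   =
      ((6 +√ 0) ∷ (18 +√ 0) ∷ (36 +√ 0) ∷ (72 +√ 0) ∷ (36 +√ 0) ∷ [])
    ∷ ((-8 +√ 0) ∷ (-16 +√ 0) ∷ (-8 +√ 0) ∷ (16 +√ 0) ∷ (16 +√ 0) ∷ [])
    ∷ ((6 +√ 3) ∷ (0 +√ 3) ∷ (-12 +√ -12) ∷ (-12 +√ -6) ∷ (18 +√ 12) ∷ [])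
    ∷ ((-14 +√ 0) ∷ (14 +√ 0) ∷ (28 +√ 0) ∷ (-56 +√ 0) ∷ (28 +√ 0) ∷ [])
    ∷ ((6 +√ -3) ∷ (0 +√ -3) ∷ (-12 +√ 12) ∷ (-12 +√ 6) ∷ (18 +√ -12) ∷ []) ∷ []
  dualEigenvectors typeII  =
      ((8 +√ 0) ∷ (16 +√ 0) ∷ (16 +√ 0) ∷ (64 +√ 0) ∷ (-64 +√ 0) ∷ [])
    ∷ ((8 +√ 0) ∷ (16 +√ 0) ∷ (16 +√ 0) ∷ (-104 +√ 0) ∷ (104 +√ 0) ∷ [])
    ∷ ((-18 +√ -6) ∷ (6 +√ -12) ∷ (6 +√ 30) ∷ (24 +√ -6) ∷ (18 +√ 6) ∷ [])
    ∷ ((28 +√ 0) ∷ (-28 +√ 0) ∷ (-28 +√ 0) ∷ (56 +√ 0) ∷ (28 +√ 0) ∷ [])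
    ∷ ((-18 +√ 6) ∷ (6 +√ 12) ∷ (6 +√ -30) ∷ (24 +√ 6) ∷ (18 +√ -6) ∷ []) ∷ []
  dualEigenvectors typeIII =
      ((56 +√ 0) ∷ (112 +√ 0) ∷ [])
    ∷ ((-56 +√ 0) ∷ (56 +√ 0) ∷ []) ∷ []
  dualEigenvectors typeIV  =
      ((16 +√ 0) ∷ (32 +√ 0) ∷ (8 +√ 0) ∷ (24 +√ 0) ∷ [])
    ∷ ((6 +√ -12) ∷ (-30 +√ 18) ∷ (24 +√ -6) ∷ (30 +√ -18) ∷ [])
    ∷ ((-28 +√ 0) ∷ (28 +√ 0) ∷ (-56 +√ 0) ∷ (84 +√ 0) ∷ [])
    ∷ ((6 +√ 12) ∷ (-30 +√ -18) ∷ (24 +√ 6) ∷ (30 +√ 18) ∷ []) ∷ []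
  dualEigenvectors typeV   =
      ((168 +√ 0) ∷ []) ∷ []
  dualEigenvectors typeVI  =
      ((0 +√ 42) ∷ (84 +√ 0) ∷ [])
    ∷ ((0 +√ -42) ∷ (84 +√ 0) ∷ []) ∷ []

  typeMatrix : ∀ τ → Table (size τ)
  typeMatrix τ = map (map ⌊_⌋) (rows τ)

  dualDenominator : ℤ
  dualDenominator = 168

  abstract
    type-diagonalizes : ∀ τ → Diagonalizes (typeMatrix τ) (eigenvectors τ) (dualEigenvectors τ) (eigenvalues τ) dualDenominator
    type-diagonalizes typeI   = from-yes (diagonalizes? (typeMatrix typeI) (eigenvectors typeI) (dualEigenvectors typeI) (eigenvalues typeI) dualDenominator)
    type-diagonalizes typeII  = from-yes (diagonalizes? (typeMatrix typeII) (eigenvectors typeII) (dualEigenvectors typeII) (eigenvalues typeII) dualDenominator)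
    type-diagonalizes typeIII = from-yes (diagonalizes? (typeMatrix typeIII) (eigenvectors typeIII) (dualEigenvectors typeIII) (eigenvalues typeIII) dualDenominator)
    type-diagonalizes typeIV  = from-yes (diagonalizes? (typeMatrix typeIV) (eigenvectors typeIV) (dualEigenvectors typeIV) (eigenvalues typeIV) dualDenominator)
    type-diagonalizes typeV   = from-yes (diagonalizes? (typeMatrix typeV) (eigenvectors typeV) (dualEigenvectors typeV) (eigenvalues typeV) dualDenominator)
    type-diagonalizes typeVI  = from-yes (diagonalizes? (typeMatrix typeVI) (eigenvectors typeVI) (dualEigenvectors typeVI) (eigenvalues typeVI) dualDenominator)

  -- The eigenvectors of the whole graph come from those of its modules.
  assemble : (∀ b → Vec (Vec ℤ√2 28) (size (blockType b))) → Table 28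
  assemble f = f 0F ++ f 1F ++ f 2F ++ f 3F ++ f 4F ++ f 5F ++ f 6F ++ f 7F

  modelMatrix : Table 28
  modelMatrix = tabulate λ y → tabulate λ z → ⌊ if does (modelAdj? y z) then 1 else 0 ⌋

  standardFamily : Family
  standardFamily = basisFamily (0F ∷ 1F ∷ 2F ∷ []) 0F

  modelEigenvectors modelDuals : Family → Table 28
  modelEigenvectors F = assemble λ b → map (λ as → linear₂ as (block F b)) (eigenvectors (blockType b))
  modelDuals G        = assemble λ b → map (λ as → linear₂ as (block G b)) (dualEigenvectors (blockType b))

  modelEigenvalues : Vec ℤ√2 28
  modelEigenvalues = eigenvalues (blockType 0F) ++ eigenvalues (blockType 1F) ++ eigenvalues (blockType 2F) ++ eigenvalues (blockType 3F)
                  ++ eigenvalues (blockType 4F) ++ eigenvalues (blockType 5F) ++ eigenvalues (blockType 6F) ++ eigenvalues (blockType 7F)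

  modelDenominator : ℤ
  modelDenominator = dualDenominator ℤ.* denominator

  abstract
    model-diagonalizes : Diagonalizes modelMatrix (modelEigenvectors standardFamily) (modelDuals (dualFamily standardFamily)) modelEigenvalues modelDenominator
    model-diagonalizes = from-yes (diagonalizes? modelMatrix (modelEigenvectors standardFamily) (modelDuals (dualFamily standardFamily)) modelEigenvalues modelDenominator)

module Eigenbases where

  open LinearAlgebra
  open Eigenvectors
  open import Data.Fin.Base using (zero)
  open import Data.Nat.Base using (zero)
  open import Data.Vec.Base using ([]; _∷_)
  open import Relation.Binary.PropositionalEquality using (_≡_)
  open import Relation.Nullary hiding (⌊_⌋)

  -- The elements apart from zero of a field.
  record Apartness (K : CommutativeRing 0ℓ 0ℓ) (S : Summation K) : Set₁ where
    open CommutativeRing K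
    open Summation S
    field
      _#0     : Carrier → Set
      #0-resp : ∀ {a b} → a ≈ b → a #0 → b #0
      ¬0#0    : ∀ {a} → a ≈ 0# → ¬ (a #0)
      1#0     : 1# #0
      *#0ˡ    : ∀ {a b} → (a * b) #0 → a #0
      *#0ʳ    : ∀ {a b} → (a * b) #0 → b #0
      sum#0   : ∀ {n} (f : Fin n → Carrier) → sum f #0 → ∃[ j ] f j #0
      inverse : ∀ {a} → a #0 → ∃[ i ] i * a ≈ 1#

  module Subspaces (K : CommutativeRing 0ℓ 0ℓ) (S : Summation K) (apartness : Apartness K S) where
    open Linear K S public
    open Apartness apartness public
    open RingProperties ring public using (x[y-z]≈xy-xz; [y-z]x≈yx-zx; x≈y⇒x∙y⁻¹≈ε; x∙y⁻¹≈ε⇒x≈y)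
    open SetoidReasoning setoid

    *≈0⇒≈0 : ∀ {a b} → a * b ≈ 0# → a #0 → b ≈ 0#
    *≈0⇒≈0 {a} {b} ab≈0 a#0 = begin
      b                        ≈⟨ *-identityˡ b ⟨
      1# * b                   ≈⟨ *-congʳ (proj₂ (inverse a#0)) ⟨
      proj₁ (inverse a#0) * a * b    ≈⟨ *-assoc _ a b ⟩
      proj₁ (inverse a#0) * (a * b)  ≈⟨ *-congˡ ab≈0 ⟩
      proj₁ (inverse a#0) * 0#       ≈⟨ zeroʳ _ ⟩
      0#                       ∎

    *-cancelʳ : ∀ {a b c} → a * c ≈ b * c → c #0 → a ≈ b
    *-cancelʳ {a} {b} {c} ac≈bc c#0 = x∙y⁻¹≈ε⇒x≈y a b (*≈0⇒≈0 (begin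
      c * (a - b)     ≈⟨ x[y-z]≈xy-xz c a b ⟩
      c * a - c * b   ≈⟨ +-cong (*-comm c a) (-‿cong (*-comm c b)) ⟩
      a * c - b * c   ≈⟨ x≈y⇒x∙y⁻¹≈ε ac≈bc ⟩
      0#              ∎) c#0)

    Independent : ∀ {I k} → (Fin k → Vector I) → Set
    Independent v = ∀ a → combination a v ≈ᵥ (λ _ → 0#) → ∀ j → a j ≈ 0#

    record Basis {I : Set} (W : Vector I → Set) {k : ℕ} (v : Fin k → Vector I) : Set where
      field
        members     : ∀ j → W (v j)
        independent : Independent v
        spanning    : ∀ w → W w → Σ[ a ∈ (Fin k → Carrier) ] w ≈ᵥ combination a v

    Nonzero : ∀ {I} → (Vector I → Set) → Set
    Nonzero W = ∃[ v ] (W v × ∃[ i ] v i #0)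

    module _ {I : Set} {m n : ℕ} (g : Fin m → Fin n) (g-injective : Injective _≡_ _≡_ g) (v : Fin n → Vector I) where

      sub-independent : Independent v → Independent (v ∘ g)
      sub-independent ind a eq k = begin
        a k                              ≈⟨ sum-δ′ k a ⟨
        sum (λ l → a l * δ l k)          ≈⟨ sum-cong (λ l → *-congˡ (δ-g l k)) ⟨
        sum (λ l → a l * δ (g l) (g k))  ≈⟨ sum-cong (λ l → *-comm _ _) ⟩
        sum (λ l → δ (g l) (g k) * a l)  ≈⟨ ind (λ j → sum λ l → δ (g l) j * a l) zero-combination (g k) ⟩
        0#                               ∎
        where
        δ-g : ∀ l k → δ (g l) (g k) ≈ δ l k
        δ-g l k with l ≟ᶠ k
        ... | yes ≡.refl = δ-refl (g l)
        ... | no l≢k     = δ-≢ (l≢k ∘ g-injective)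
        zero-combination : combination (λ j → sum λ l → δ (g l) j * a l) v ≈ᵥ (λ _ → 0#)
        zero-combination i = trans (sym (combination-combination a (λ j l → δ (g l) j) v i))
          (trans (combination-congʳ a (λ l → combination-δ (g l) v) i) (eq i))

      sub-combination : ∀ c → (∀ j → (∃[ k ] g k ≡ j) ⊎ c j ≈ 0#) → combination c v ≈ᵥ combination (c ∘ g) (v ∘ g)
      sub-combination c off i = sum-reindex g g-injective (λ j → c j * v j i) λ j →
        [ inj₁ , (λ cj≈0 → inj₂ (trans (*-congʳ cj≈0) (zeroˡ _))) ]′ (off j)

      sub-basis : (W : Vector I → Set) → (∀ k → W (v (g k))) → Independent v →
                  (∀ w → W w → Σ[ c ∈ (Fin n → Carrier) ] (w ≈ᵥ combination c v × (∀ j → (∃[ k ] g k ≡ j) ⊎ c j ≈ 0#))) →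
                  Basis W (v ∘ g)
      sub-basis W mem ind span = record
        { members     = mem
        ; independent = sub-independent ind
        ; spanning    = λ w w∈W → let c , eq , off = span w w∈W in c ∘ g , λ i → trans (eq i) (sub-combination c off i)
        }

  record Embedding₂ (K : CommutativeRing 0ℓ 0ℓ) : Set where
    open CommutativeRing K
    field
      ι   : ℤ√2 → Carrier
      ι-0 : ι ⌊ 0ℤ ⌋ ≈ 0#
      ι-+ : ∀ x y → ι (x +₂ y) ≈ ι x + ι y
      ι-* : ∀ x y → ι (x *₂ y) ≈ ι x * ι y

  module Spectral (K : CommutativeRing 0ℓ 0ℓ) (S : Summation K) (apartness : Apartness K S) (embedding : Embedding₂ K) where
    open Subspaces K S apartness public
    open Embedding₂ embedding
    open SetoidReasoning setoid

    ι-cong : ∀ {x y} → x ≡ y → ι x ≈ ι y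
    ι-cong = reflexive ∘ ≡.cong ι

    ι-dot₂ : ∀ {k} (xs ys : Vec ℤ√2 k) → ι (dot₂ xs ys) ≈ sum (λ j → ι (lookup xs j) * ι (lookup ys j))
    ι-dot₂ []       []       = trans ι-0 (sym (sum-zero _))
    ι-dot₂ (x ∷ xs) (y ∷ ys) = trans (ι-+ _ _) (trans (+-cong (ι-* x y) (ι-dot₂ xs ys)) (sym (sum-suc _)))

    module Eigenbasis {n m : ℕ} (φ : Fin m → Fin n) (φ⁻¹ : Fin n → Fin m) (φ-φ⁻¹ : ∀ y → φ (φ⁻¹ y) ≡ y) (φ-injective : Injective _≡_ _≡_ φ)
      {Mᵗ V D : Table m} {θ : Vec ℤ√2 m} {N : ℤ} (table : Diagonalizes Mᵗ V D θ N) (N⁻¹ : Carrier) (N⁻¹-inverse : N⁻¹ * ι ⌊ N ⌋ ≈ 1#)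
      (M : Matrix n) (M-φ : ∀ y z → M (φ y , φ z) ≈ ι (lookup (lookup Mᵗ y) z)) where
      open Diagonalizes table

      private
        φ⁻¹-φ : ∀ i → φ⁻¹ (φ i) ≡ i
        φ⁻¹-φ i = φ-injective (φ-φ⁻¹ (φ i))

        everywhere : ∀ {P : Fin n → Set} → (∀ i → P (φ i)) → ∀ y → P y
        everywhere {P} p y = ≡.subst P (φ-φ⁻¹ y) (p (φ⁻¹ y))

        sum-φ : (f : Fin n → Carrier) → sum f ≈ sum (f ∘ φ)
        sum-φ f = sum-reindex φ φ-injective f λ j → inj₁ (φ⁻¹ j , φ-φ⁻¹ j)

      eigenvector covector : Fin m → Vector (Fin n)
      eigenvector k y = ι (lookup (lookup V k) (φ⁻¹ y))
      covector k y = N⁻¹ * ι (lookup (lookup D k) (φ⁻¹ y))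

      private
        eigenvector-φ : ∀ k i → eigenvector k (φ i) ≈ ι (lookup (lookup V k) i)
        eigenvector-φ k i = ι-cong (≡.cong (lookup (lookup V k)) (φ⁻¹-φ i))

        covector-φ : ∀ k i → covector k (φ i) ≈ N⁻¹ * ι (lookup (lookup D k) i)
        covector-φ k i = *-congˡ (ι-cong (≡.cong (lookup (lookup D k)) (φ⁻¹-φ i)))

        unscale : ∀ {k} (i j : Fin k) → N⁻¹ * ι (scaledδ₂ N i j) ≈ δ i j
        unscale i j with does (i ≟ᶠ j)
        ... | true  = N⁻¹-inverse
        ... | false = trans (*-congˡ ι-0) (zeroʳ _)

      eigen-equation : ∀ k → M · eigenvector k ≈ᵥ ι (lookup θ k) *ₗ eigenvector k
      eigen-equation k = everywhere λ y → begin
        sum (λ z → M (φ y , z) * eigenvector k z)                          ≈⟨ sum-φ (λ z → M (φ y , z) * eigenvector k z) ⟩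
        sum (λ z → M (φ y , φ z) * eigenvector k (φ z))                    ≈⟨ sum-cong (λ z → *-cong (M-φ y z) (eigenvector-φ k z)) ⟩
        sum (λ z → ι (lookup (lookup Mᵗ y) z) * ι (lookup (lookup V k) z)) ≈⟨ ι-dot₂ (lookup Mᵗ y) (lookup V k) ⟨
        ι (dot₂ (lookup Mᵗ y) (lookup V k))                                ≈⟨ ι-cong (eigen k y) ⟩
        ι (lookup θ k *₂ lookup (lookup V k) y)                            ≈⟨ ι-* _ _ ⟩
        ι (lookup θ k) * ι (lookup (lookup V k) y)                         ≈⟨ *-congˡ (eigenvector-φ k y) ⟨
        ι (lookup θ k) * eigenvector k (φ y)                               ∎

      duality : ∀ k l → ⟪ covector k , eigenvector l ⟫ ≈ δ k l
      duality k l = begin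
        sum (λ y → covector k y * eigenvector l y)                                   ≈⟨ sum-φ (λ y → covector k y * eigenvector l y) ⟩
        sum (λ y → covector k (φ y) * eigenvector l (φ y))                           ≈⟨ sum-cong (λ y → trans (*-cong (covector-φ k y) (eigenvector-φ l y)) (*-assoc _ _ _)) ⟩
        sum (λ y → N⁻¹ * (ι (lookup (lookup D k) y) * ι (lookup (lookup V l) y)))    ≈⟨ sum-distribˡ N⁻¹ _ ⟨
        N⁻¹ * sum (λ y → ι (lookup (lookup D k) y) * ι (lookup (lookup V l) y))      ≈⟨ *-congˡ (ι-dot₂ (lookup D k) (lookup V l)) ⟨
        N⁻¹ * ι (dot₂ (lookup D k) (lookup V l))                                     ≈⟨ *-congˡ (ι-cong (dual k l)) ⟩
        N⁻¹ * ι (scaledδ₂ N k l)                                                     ≈⟨ unscale k l ⟩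
        δ k l                                                                        ∎

      completeness : ∀ y z → sum (λ k → covector k z * eigenvector k y) ≈ δ y z
      completeness y z = everywhere {λ z → sum (λ k → covector k z * eigenvector k y) ≈ δ y z}
        (λ j → everywhere {λ y → sum (λ k → covector k (φ j) * eigenvector k y) ≈ δ y (φ j)} (λ i → at i j) y) z
        where
        δ-φ : ∀ i j → δ (φ i) (φ j) ≈ δ i j
        δ-φ i j with i ≟ᶠ j
        ... | yes ≡.refl = δ-refl (φ i)
        ... | no i≢j     = δ-≢ (i≢j ∘ φ-injective)
        at : ∀ i j → sum (λ k → covector k (φ j) * eigenvector k (φ i)) ≈ δ (φ i) (φ j)
        at i j = begin
          sum (λ k → covector k (φ j) * eigenvector k (φ i))                            ≈⟨ sum-cong (λ k → trans (*-cong (covector-φ k j) (eigenvector-φ k i)) (*-assoc _ _ _)) ⟩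
          sum (λ k → N⁻¹ * (ι (lookup (lookup D k) j) * ι (lookup (lookup V k) i)))     ≈⟨ sum-distribˡ N⁻¹ _ ⟨
          N⁻¹ * sum (λ k → ι (lookup (lookup D k) j) * ι (lookup (lookup V k) i))       ≈⟨ *-congˡ (sum-cong λ k → *-cong
                                                                                              (ι-cong (lookup-columns D j k)) (ι-cong (lookup-columns V i k))) ⟨
          N⁻¹ * sum (λ k → ι (lookup (lookup (columns D) j) k) * ι (lookup (lookup (columns V) i) k))
                                                                                        ≈⟨ *-congˡ (ι-dot₂ (lookup (columns D) j) (lookup (columns V) i)) ⟨
          N⁻¹ * ι (dot₂ (lookup (columns D) j) (lookup (columns V) i))                  ≈⟨ *-congˡ (ι-cong (complete i j)) ⟩
          N⁻¹ * ι (scaledδ₂ N i j)                                                      ≈⟨ unscale i j ⟩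
          δ i j                                                                         ≈⟨ δ-φ i j ⟨
          δ (φ i) (φ j)                                                                 ∎

      coordinates : Vector (Fin n) → Fin m → Carrier
      coordinates w k = ⟪ covector k , w ⟫

      expand : ∀ w → w ≈ᵥ combination (coordinates w) eigenvector
      expand w y = sym (begin
        sum (λ k → ⟪ covector k , w ⟫ * eigenvector k y)                    ≈⟨ sum-cong (λ k → sum-distribʳ (eigenvector k y) (λ z → covector k z * w z)) ⟩
        sum (λ k → sum (λ z → covector k z * w z * eigenvector k y))        ≈⟨ sum-comm (λ k z → covector k z * w z * eigenvector k y) ⟩
        sum (λ z → sum (λ k → covector k z * w z * eigenvector k y))        ≈⟨ sum-cong (λ z → sum-cong λ k →
                                                                                 trans (*-assoc _ _ _) (trans (*-congˡ (*-comm _ _)) (sym (*-assoc _ _ _)))) ⟩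
        sum (λ z → sum (λ k → covector k z * eigenvector k y * w z))        ≈⟨ sum-cong (λ z → sum-distribʳ (w z) (λ k → covector k z * eigenvector k y)) ⟨
        sum (λ z → sum (λ k → covector k z * eigenvector k y) * w z)        ≈⟨ sum-cong (λ z → *-congʳ (completeness y z)) ⟩
        sum (λ z → δ y z * w z)                                             ≈⟨ sum-δ y w ⟩
        w y                                                                 ∎)

      coordinates-combination : ∀ a k → coordinates (combination a eigenvector) k ≈ a k
      coordinates-combination a k = trans (pairing-combination (covector k) a eigenvector)
        (trans (sum-cong λ l → *-congˡ (trans (duality k l) (δ-sym k l))) (sum-δ′ k a))

      independent : Independent eigenvector
      independent a eq k = trans (sym (coordinates-combination a k))
        (trans (pairing-cong {f = covector k} (λ _ → refl) eq) (sum-0 λ y → zeroʳ _))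

      coordinates-eigen : ∀ {w μ} → M · w ≈ᵥ μ *ₗ w → ∀ k → ι (lookup θ k) * coordinates w k ≈ μ * coordinates w k
      coordinates-eigen {w} {μ} eq k = begin
        ι (lookup θ k) * coordinates w k                                    ≈⟨ *-comm _ _ ⟩
        coordinates w k * ι (lookup θ k)                                    ≈⟨ coordinates-combination (λ l → coordinates w l * ι (lookup θ l)) k ⟨
        coordinates (combination (λ l → coordinates w l * ι (lookup θ l)) eigenvector) k
                                                                            ≈⟨ pairing-cong {f = covector k} (λ _ → refl) image ⟩
        ⟪ covector k , μ *ₗ w ⟫                                             ≈⟨ pairing-* (covector k) μ w ⟩
        μ * coordinates w k                                                 ∎
        where
        image : combination (λ l → coordinates w l * ι (lookup θ l)) eigenvector ≈ᵥ μ *ₗ w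
        image y = begin
          sum (λ l → coordinates w l * ι (lookup θ l) * eigenvector l y)    ≈⟨ sum-cong (λ l → trans (*-assoc _ _ _) (*-congˡ (sym (eigen-equation l y)))) ⟩
          sum (λ l → coordinates w l * (M · eigenvector l) y)               ≈⟨ ·-combination M (coordinates w) eigenvector y ⟨
          (M · combination (coordinates w) eigenvector) y                   ≈⟨ ·-cong {M = M} (λ _ → refl) (expand w) y ⟨
          (M · w) y                                                         ≈⟨ eq y ⟩
          μ * w y                                                           ∎

      eigenvector-nonzero : ∀ k → ∃[ y ] eigenvector k y #0
      eigenvector-nonzero k = Product.map₂ *#0ʳ (sum#0 _ (#0-resp (sym (trans (duality k k) (δ-refl k))) 1#0))

      Eigenspace : Carrier → Vector (Fin n) → Set
      Eigenspace μ w = M · w ≈ᵥ μ *ₗ w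

      eigenvalue-of : ∀ {μ} → Nonzero (Eigenspace μ) → ∃[ k ] μ ≈ ι (lookup θ k)
      eigenvalue-of {μ} (w , w∈ , y , wy#0) = resolve (sum#0 _ (#0-resp (expand w y) wy#0))
        where
        resolve : ∃[ k ] (coordinates w k * eigenvector k y) #0 → ∃[ k ] μ ≈ ι (lookup θ k)
        resolve (k , p) = k , sym (*-cancelʳ (coordinates-eigen w∈ k) (*#0ˡ p))

      eigenspace-basis : ∀ μ {r} (g : Fin r → Fin m) → Injective _≡_ _≡_ g → (∀ i → ι (lookup θ (g i)) ≈ μ) →
                         (∀ k → (∃[ i ] g i ≡ k) ⊎ (ι (lookup θ k) - μ) #0) → Basis (Eigenspace μ) (eigenvector ∘ g)
      eigenspace-basis μ g g-inj same cover = sub-basis g g-inj eigenvector (Eigenspace μ)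
        (λ i y → trans (eigen-equation (g i) y) (*-congʳ (same i))) independent
        (λ w w∈ → coordinates w , expand w , λ k → [ inj₁ , (λ apart → inj₂ (*≈0⇒≈0 (begin
            (ι (lookup θ k) - μ) * coordinates w k                      ≈⟨ [y-z]x≈yx-zx (coordinates w k) (ι (lookup θ k)) μ ⟩
            ι (lookup θ k) * coordinates w k - μ * coordinates w k      ≈⟨ x≈y⇒x∙y⁻¹≈ε (coordinates-eigen w∈ k) ⟩
            0#                                                          ∎) apart)) ]′ (cover k))

module BlockModules where

  open import Defs using (ModuleType; typeI; typeII; typeIII; typeIV; typeV; typeVI)
  open LinearAlgebra
  open IntegerBases
  open Coordinatisation
  open MatrixUnits
  open Eigenbases
  open import Data.Fin.Base using (zero; suc)
  open import Data.Nat.Base using (zero; suc)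
  open import Relation.Binary.PropositionalEquality using (_≡_; _≢_)
  open import Relation.Nullary hiding (⌊_⌋)

  representative : ∀ τ → ∃[ b ] blockType b ≡ τ
  representative typeI   = 0F , ≡.refl
  representative typeII  = 1F , ≡.refl
  representative typeIII = 3F , ≡.refl
  representative typeIV  = 4F , ≡.refl
  representative typeV   = 6F , ≡.refl
  representative typeVI  = 7F , ≡.refl

  BlockVectors : CommutativeRing 0ℓ 0ℓ → ℕ → Set
  BlockVectors K n = ∀ b → Fin (size (blockType b)) → Fin n → CommutativeRing.Carrier K

  record BlockBasis (K : CommutativeRing 0ℓ 0ℓ) (S : Summation K) {n : ℕ} (basis : BlockVectors K n) : Set where
    open Linear K S
    field
      dual       : BlockVectors K n
      dual-same  : ∀ b i j → ⟪ dual b i , basis b j ⟫ ≈ δ i j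
      dual-other : ∀ b b′ → b ≢ b′ → ∀ i j → ⟪ dual b i , basis b′ j ⟫ ≈ 0#
      complete   : ∀ (y z : Fin n) → sum (λ b → sum (λ i → dual b i z * basis b i y)) ≈ δ y z
      orthogonal : ∀ b b′ → b ≢ b′ → ∀ i j → ⟪ basis b i , basis b′ j ⟫ ≈ 0#
    open Blocks size blockType basis dual dual-same dual-other complete public

  module Modules (K : CommutativeRing 0ℓ 0ℓ) (S : Summation K) (embedding : Embedding K) (apartness : Apartness K S)
    {n : ℕ} (basis : BlockVectors K n) (blockBasis : BlockBasis K S basis) where
    open Embedding embedding
    open Embedded K S embedding using (ι-cong; ι-bit)
    open Subspaces K S apartness
    open BlockBasis blockBasis
    open SetoidReasoning setoid

    zeroᵥ : ∀ {I} → Vector I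
    zeroᵥ _ = 0#

    -- T-acts is the only way in which the modules below depend on T being
    -- generated by A and the E k.
    module Algebra (A : Matrix n) (E : ℕ → Matrix n) (acts-A : Acts A (λ τ i j → ι (adjacency τ i j)))
      (acts-E : ∀ k → Acts (E k) (λ τ i j → ι (level k τ i j)))
      (E-basis : ∀ k b j → E k · basis b j ≈ᵥ (if does (lookup (supports (blockType b)) j ≟ k) then 1# else 0#) *ₗ basis b j)
      (T : Matrix n → Set) (T-A : T A) (T-E : ∀ k → k ≤ 4 → T (E k)) (T-+ : ∀ {M N} → T M → T N → T (M +ᵥ N)) (T-* : ∀ c {M} → T M → T (c *ₗ M))
      (T-∘ : ∀ {M N} → T M → T N → T (M *ₘ N)) (T-acts : ∀ {M} → T M → Σ[ X ∈ BlockMatrix ] Acts M X)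
      (ι-inverse : ∀ {k} → k ≢ 0ℤ → ∃[ c ] c * ι k ≈ 1#) where

      Realised : BlockMatrix → Set
      Realised X = Σ[ M ∈ Matrix n ] (T M × Acts M X)

      private
        realised-ext : ∀ X Y → (∀ τ i j → X τ i j ≈ Y τ i j) → Realised X → Realised Y
        realised-ext X Y eq (M , M∈T , acts) = M , M∈T , acts-ext {X = X} {Y} eq acts

        realised-+ : ∀ X Y → Realised X → Realised Y → Realised (λ τ i j → X τ i j + Y τ i j)
        realised-+ X Y (M , M∈T , acts) (N , N∈T , acts′) = M +ᵥ N , T-+ M∈T N∈T , acts-+ {X = X} {Y} acts acts′

        realised-* : ∀ c X → Realised X → Realised (λ τ i j → c * X τ i j)
        realised-* c X (M , M∈T , acts) = c *ₗ M , T-* c M∈T , acts-* {X = X} c acts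

        realised-∘ : ∀ X Y → Realised X → Realised Y → Realised (λ τ i j → sum λ k → X τ i k * Y τ k j)
        realised-∘ X Y (M , M∈T , acts) (N , N∈T , acts′) = M *ₘ N , T-∘ M∈T N∈T , acts-∘ {X = X} {Y} acts acts′

        realised-E : ∀ k → k ≤ 4 → Realised (λ τ i j → ι (level k τ i j))
        realised-E k k≤4 = E k , T-E k k≤4 , acts-E k

        module G = Generation.Closed K S embedding Realised realised-ext realised-+ realised-* realised-∘ (A , T-A , acts-A) realised-E ι-inverse

      abstract
        unitMatrix-realised : ∀ k → Realised (λ τ i j → ι (unitAt k τ i j))
        unitMatrix-realised k = G.Generated.realised (G.unitAt-generated k)

      unitMatrix : Fin 75 → Matrix n
      unitMatrix k = proj₁ (unitMatrix-realised k)

      unitMatrix∈T : ∀ k → T (unitMatrix k)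
      unitMatrix∈T k = proj₁ (proj₂ (unitMatrix-realised k))

      unitMatrix-acts : ∀ k → Acts (unitMatrix k) (λ τ i j → ι (unitAt k τ i j))
      unitMatrix-acts k = proj₂ (proj₂ (unitMatrix-realised k))

      ι-unitAt : ∀ k τ i j → ι (unitAt k τ i j) ≈ δ (position τ i j) k
      ι-unitAt k τ i j = ι-bit (does (position τ i j ≟ᶠ k))

      sum-unitAt : ∀ (a : Fin 75 → Carrier) τ i j → sum (λ k → a k * ι (unitAt k τ i j)) ≈ a (position τ i j)
      sum-unitAt a τ i j = trans (sum-cong λ k → trans (*-comm _ _) (*-congʳ (ι-unitAt k τ i j))) (sum-δ (position τ i j) a)

      acts-0 : Acts zeroᵥ (λ _ _ _ → 0#)
      acts-0 = acting λ b j y → trans (sum-0 λ z → zeroˡ _) (sym (combination-0 {v = basis b} (λ i → refl) y))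

      acts-determines : ∀ {M X X′} → Acts M X → Acts M X′ → ∀ τ i j → X τ i j ≈ X′ τ i j
      acts-determines {M} {X} {X′} acts acts′ τ = go (representative τ)
        where
        go : ∃[ b ] blockType b ≡ τ → ∀ i j → X τ i j ≈ X′ τ i j
        go (b , ≡.refl) = acts-injective acts acts′ b

      T-basis : Basis T unitMatrix
      T-basis = record { members = unitMatrix∈T ; independent = ind ; spanning = span }
        where
        acts-combination-of-units : ∀ a → Acts (combination a unitMatrix) (λ τ i j → a (position τ i j))
        acts-combination-of-units a = acts-ext (sum-unitAt a)
          (acts-sum a unitMatrix (λ k τ i j → ι (unitAt k τ i j)) unitMatrix-acts)
        ind : Independent unitMatrix
        ind a eq k = trans (reflexive (≡.cong a (≡.sym (position-entry k))))
          (acts-determines (acts-resp eq (acts-combination-of-units a)) acts-0 (proj₁ (entry k)) (proj₁ (proj₂ (entry k))) (proj₂ (proj₂ (entry k))))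
        span : ∀ M → T M → Σ[ a ∈ (Fin 75 → Carrier) ] M ≈ᵥ combination a unitMatrix
        span M M∈T = a , acts-unique acts (acts-ext a-position (acts-combination-of-units a))
          where
          X = proj₁ (T-acts M∈T)
          acts = proj₂ (T-acts M∈T)
          at : Entry → Carrier
          at (τ , i , j) = X τ i j
          a : Fin 75 → Carrier
          a = at ∘ entry
          a-position : ∀ τ i j → a (position τ i j) ≈ X τ i j
          a-position τ i j = reflexive (≡.cong at (entry-position τ i j))

      W : Fin 8 → Vector (Fin n) → Set
      W b v = Σ[ a ∈ (Fin (size (blockType b)) → Carrier) ] v ≈ᵥ combination a (basis b)

      module _ (b : Fin 8) where

        W-resp : ∀ {v w} → v ≈ᵥ w → W b v → W b w
        W-resp eq (a , eq′) = a , λ y → trans (sym (eq y)) (eq′ y)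

        W-0 : W b zeroᵥ
        W-0 = (λ _ → 0#) , λ y → sym (combination-0 {v = basis b} (λ i → refl) y)

        W-+ : ∀ {v w} → W b v → W b w → W b (v +ᵥ w)
        W-+ (a , eq) (a′ , eq′) = (λ j → a j + a′ j) , λ y → trans (+-cong (eq y) (eq′ y)) (sym (combination-+ a a′ (basis b) y))

        W-* : ∀ c {v} → W b v → W b (c *ₗ v)
        W-* c (a , eq) = (λ j → c * a j) , λ y → trans (*-congˡ (eq y)) (sym (combination-* c a (basis b) y))

        W-acts : ∀ {M X v} → Acts M X → ((a , _) : W b v) → M · v ≈ᵥ combination (λ i → sum λ j → X (blockType b) i j * a j) (basis b)
        W-acts {M} acts (a , eq) y = trans (·-cong {M = M} (λ _ → refl) eq y) (acts-combination acts b a y)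

        W-T : ∀ {M} → T M → ∀ {v} → W b v → W b (M · v)
        W-T M∈T v∈W = _ , W-acts (proj₂ (T-acts M∈T)) v∈W

        basis∈W : ∀ j → W b (basis b j)
        basis∈W j = δ j , λ y → sym (combination-δ j (basis b) y)

        basis-independent : Independent (basis b)
        basis-independent a eq j = independent b a (λ _ → 0#) (λ y → trans (eq y) (sym (combination-0 {v = basis b} (λ i → refl) y))) j

        W-basis : Basis (W b) (basis b)
        W-basis = record { members = basis∈W ; independent = basis-independent ; spanning = λ w w∈W → w∈W }

        basis-nonzero : ∀ j → ∃[ y ] basis b j y #0
        basis-nonzero j = Product.map₂ *#0ʳ (sum#0 _ (#0-resp (sym (trans (dual-same b j j) (δ-refl j))) 1#0))

        coordinate-of : ∀ {v} ((a , _) : W b v) → ∀ i → coordinate b i v ≈ a i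
        coordinate-of (a , eq) i = trans (pairing-cong {f = dual b i} (λ _ → refl) eq) (coordinate-same b i a)

        coordinate-elsewhere : ∀ {b′ v} → b ≢ b′ → W b′ v → ∀ i → coordinate b i v ≈ 0#
        coordinate-elsewhere {b′} b≢b′ (a , eq) i = trans (pairing-cong {f = dual b i} (λ _ → refl) eq) (coordinate-other b b′ b≢b′ i a)

        component∈W : ∀ v → W b (component b v)
        component∈W v = (λ i → coordinate b i v) , λ y → refl

        component-of : ∀ {v} → W b v → v ≈ᵥ component b v
        component-of w@(a , eq) y = trans (eq y) (combination-congˡ (basis b) (λ i → sym (coordinate-of w i)) y)

        unit-moves : ∀ i j v → W b v → unitMatrix (position (blockType b) i j) · v ≈ᵥ coordinate b j v *ₗ basis b i
        unit-moves i j v v∈W y = begin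
          (unitMatrix k · v) y                                                          ≈⟨ W-acts (unitMatrix-acts k) v∈W y ⟩
          combination (λ i′ → sum λ j′ → ι (unitAt k τ i′ j′) * proj₁ v∈W j′) (basis b) y ≈⟨ combination-congˡ (basis b) matrix-entry y ⟩
          combination (λ i′ → coordinate b j v * δ i i′) (basis b) y                    ≈⟨ combination-* (coordinate b j v) (δ i) (basis b) y ⟩
          coordinate b j v * combination (δ i) (basis b) y                              ≈⟨ *-congˡ (combination-δ i (basis b) y) ⟩
          coordinate b j v * basis b i y                                                ∎
          where
          τ = blockType b
          k = position τ i j
          separate : ∀ i′ j′ → ι (unitAt k τ i′ j′) ≈ δ i i′ * δ j j′
          separate i′ j′ with i ≟ᶠ i′ | j ≟ᶠ j′
          ... | yes ≡.refl | yes ≡.refl = trans (trans (ι-unitAt k τ i j) (δ-refl k)) (sym (*-identityˡ _))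
          ... | no i≢i′ | _ = trans (trans (ι-unitAt k τ i′ j′) (δ-≢ λ eq → i≢i′ (same-row eq))) (sym (zeroˡ _))
            where
            same-row : position τ i′ j′ ≡ k → i ≡ i′
            same-row eq with ≡.trans (≡.sym (entry-position τ i′ j′)) (≡.trans (≡.cong entry eq) (entry-position τ i j))
            ... | ≡.refl = ≡.refl
          ... | yes _ | no j≢j′ = trans (trans (ι-unitAt k τ i′ j′) (δ-≢ λ eq → j≢j′ (same-column eq))) (sym (zeroʳ _))
            where
            same-column : position τ i′ j′ ≡ k → j ≡ j′
            same-column eq with ≡.trans (≡.sym (entry-position τ i′ j′)) (≡.trans (≡.cong entry eq) (entry-position τ i j))
            ... | ≡.refl = ≡.refl
          matrix-entry : ∀ i′ → sum (λ j′ → ι (unitAt k τ i′ j′) * proj₁ v∈W j′) ≈ coordinate b j v * δ i i′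
          matrix-entry i′ = begin
            sum (λ j′ → ι (unitAt k τ i′ j′) * proj₁ v∈W j′)  ≈⟨ sum-cong (λ j′ → trans (*-congʳ (separate i′ j′)) (*-assoc _ _ _)) ⟩
            sum (λ j′ → δ i i′ * (δ j j′ * proj₁ v∈W j′))     ≈⟨ sum-distribˡ (δ i i′) (λ j′ → δ j j′ * proj₁ v∈W j′) ⟨
            δ i i′ * sum (λ j′ → δ j j′ * proj₁ v∈W j′)       ≈⟨ *-congˡ (sum-cong λ j′ → *-congʳ (δ-sym j j′)) ⟩
            δ i i′ * sum (λ j′ → δ j′ j * proj₁ v∈W j′)       ≈⟨ *-congˡ (trans (sum-cong λ j′ → *-comm _ _) (sum-δ′ j (proj₁ v∈W))) ⟩
            δ i i′ * proj₁ v∈W j                              ≈⟨ *-congˡ (coordinate-of v∈W j) ⟨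
            δ i i′ * coordinate b j v                         ≈⟨ *-comm _ _ ⟩
            coordinate b j v * δ i i′                         ∎

        module _ (U : Vector (Fin n) → Set) (U-resp : ∀ {v w} → v ≈ᵥ w → U v → U w) (U-0 : U zeroᵥ)
                 (U-+ : ∀ {v w} → U v → U w → U (v +ᵥ w)) (U-* : ∀ c {v} → U v → U (c *ₗ v)) (U-T : ∀ {M} → T M → ∀ {v} → U v → U (M · v)) where

          combination∈ : ∀ {k} (a : Fin k → Carrier) (v : Fin k → Vector (Fin n)) → (∀ j → U (v j)) → U (combination a v)
          combination∈ {zero}  a v v∈U = U-resp (λ y → sym (sum-zero _)) U-0
          combination∈ {suc k} a v v∈U = U-resp (λ y → sym (sum-suc _))
            (U-+ (U-* (a zero) (v∈U zero)) (combination∈ (a ∘ suc) (v ∘ suc) (v∈U ∘ suc)))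

          simple : Nonzero U → (∀ {v} → U v → W b v) → ∀ {v} → W b v → U v
          simple (v , v∈U , y , vy#0) U⊆W {w} (a , eq) = U-resp (λ y → sym (eq y)) (combination∈ a (basis b) (basis∈U nonzero-coordinate))
            where
            v∈W = U⊆W v∈U
            nonzero-coordinate : ∃[ j ] coordinate b j v #0
            nonzero-coordinate = Product.map₂ *#0ˡ (sum#0 _ (#0-resp (component-of v∈W y) vy#0))
            basis∈U : ∃[ j ] coordinate b j v #0 → ∀ i → U (basis b i)
            basis∈U (j , p) i = U-resp cancel (U-* (proj₁ (inverse p)) (U-T (unitMatrix∈T (position (blockType b) i j)) v∈U))
              where
              cancel : proj₁ (inverse p) *ₗ (unitMatrix (position (blockType b) i j) · v) ≈ᵥ basis b i
              cancel y = trans (*-congˡ (unit-moves i j v v∈W y)) (trans (sym (*-assoc _ _ _)) (trans (*-congʳ (proj₂ (inverse p))) (*-identityˡ _)))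

        Image : ℕ → Vector (Fin n) → Set
        Image k v = ∃[ w ] (W b w × v ≈ᵥ E k · w)

        support : Fin (size (blockType b)) → ℕ
        support = lookup (supports (blockType b))

        onLevel : ℕ → Fin (size (blockType b)) → Carrier
        onLevel k j = if does (support j ≟ k) then 1# else 0#

        onLevel-on : ∀ {k j} → support j ≡ k → onLevel k j ≈ 1#
        onLevel-on {k} {j} eq = reflexive (≡.cong (if_then 1# else 0#) (dec-true (support j ≟ k) eq))

        onLevel-off : ∀ {k j} → support j ≢ k → onLevel k j ≈ 0#
        onLevel-off {k} {j} eq = reflexive (≡.cong (if_then 1# else 0#) (dec-false (support j ≟ k) eq))

        E-fixes : ∀ {k j} → support j ≡ k → basis b j ≈ᵥ E k · basis b j
        E-fixes {k} {j} eq y = sym (trans (E-basis k b j y) (trans (*-congʳ (onLevel-on eq)) (*-identityˡ _)))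

        image-expansion : ∀ {k v} ((w , (a , _) , _) : Image k v) → v ≈ᵥ combination (λ j → a j * onLevel k j) (basis b)
        image-expansion {k} (w , (a , eq) , eq′) y = begin
          _                                                ≈⟨ eq′ y ⟩
          (E k · w) y                                      ≈⟨ ·-cong {M = E k} (λ _ → refl) eq y ⟩
          (E k · combination a (basis b)) y                ≈⟨ ·-combination (E k) a (basis b) y ⟩
          sum (λ j → a j * (E k · basis b j) y)            ≈⟨ sum-cong (λ j → trans (*-congˡ (E-basis k b j y)) (sym (*-assoc _ _ _))) ⟩
          sum (λ j → a j * onLevel k j * basis b j y)      ∎

        image-member : ∀ {k j} → support j ≡ k → Image k (basis b j)
        image-member {k} {j} eq = basis b j , basis∈W j , E-fixes eq

        image-basis : ∀ {r} k (g : Fin r → Fin (size (blockType b))) → Injective _≡_ _≡_ g → (∀ i → support (g i) ≡ k) →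
                      (∀ j → (∃[ i ] g i ≡ j) ⊎ support j ≢ k) → Basis (Image k) (basis b ∘ g)
        image-basis k g g-inj on off = sub-basis g g-inj (basis b) (Image k) (image-member ∘ on) basis-independent
          (λ w w∈ → (λ j → proj₁ (proj₁ (proj₂ w∈)) j * onLevel k j) , image-expansion w∈
                  , λ j → [ inj₁ , (λ s≢k → inj₂ (trans (*-congˡ (onLevel-off s≢k)) (zeroʳ _))) ]′ (off j))

        image-nonzero : ∀ {k} j → support j ≡ k → Nonzero (Image k)
        image-nonzero j eq = basis b j , image-member eq , basis-nonzero j

        image-zero : ∀ {k} → (∀ j → support j ≢ k) → ¬ Nonzero (Image k)
        image-zero off (v , v∈ , y , p) = ¬0#0 (trans (image-expansion v∈ y)
          (combination-0 {v = basis b} (λ j → trans (*-congˡ (onLevel-off (off j))) (zeroʳ _)) y)) p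

      W-orthogonal : ∀ b b′ → b ≢ b′ → ∀ {v w} → W b v → W b′ w → ⟪ v , w ⟫ ≈ 0#
      W-orthogonal b b′ b≢b′ {v} {w} (a , eq) (a′ , eq′) = begin
        ⟪ v , w ⟫                                             ≈⟨ pairing-cong {v = w} eq (λ _ → refl) ⟩
        ⟪ combination a (basis b) , w ⟫                       ≈⟨ sum-cong (λ y → *-comm _ _) ⟩
        ⟪ w , combination a (basis b) ⟫                       ≈⟨ pairing-combination w a (basis b) ⟩
        sum (λ j → a j * ⟪ w , basis b j ⟫)                   ≈⟨ sum-0 (λ j → trans (*-congˡ (vanish j)) (zeroʳ _)) ⟩
        0#                                                    ∎
        where
        vanish : ∀ j → ⟪ w , basis b j ⟫ ≈ 0#
        vanish j = begin
          ⟪ w , basis b j ⟫                                    ≈⟨ sum-cong (λ y → *-comm _ _) ⟩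
          ⟪ basis b j , w ⟫                                    ≈⟨ pairing-cong {f = basis b j} (λ _ → refl) eq′ ⟩
          ⟪ basis b j , combination a′ (basis b′) ⟫            ≈⟨ pairing-combination (basis b j) a′ (basis b′) ⟩
          sum (λ l → a′ l * ⟪ basis b j , basis b′ l ⟫)        ≈⟨ sum-0 (λ l → trans (*-congˡ (orthogonal b b′ b≢b′ j l)) (zeroʳ _)) ⟩
          0#                                                   ∎

      W-direct : ∀ (w : Fin 8 → Vector (Fin n)) → (∀ b → W b (w b)) → sumᵥ w ≈ᵥ zeroᵥ → ∀ b → w b ≈ᵥ zeroᵥ
      W-direct w w∈W eq b y = trans (component-of b (w∈W b) y) (combination-0 {v = basis b} vanish y)
        where
        vanish : ∀ i → coordinate b i (w b) ≈ 0#
        vanish i = begin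
          coordinate b i (w b)                            ≈⟨ sum-δ b (λ b′ → coordinate b i (w b′)) ⟨
          sum (λ b′ → δ b b′ * coordinate b i (w b′))     ≈⟨ sum-cong select ⟩
          sum (λ b′ → coordinate b i (w b′))              ≈⟨ pairing-sum (dual b i) w ⟨
          ⟪ dual b i , sumᵥ w ⟫                           ≈⟨ pairing-cong {f = dual b i} (λ _ → refl) eq ⟩
          ⟪ dual b i , zeroᵥ ⟫                            ≈⟨ sum-0 (λ y → zeroʳ _) ⟩
          0#                                              ∎
          where
          select : ∀ b′ → δ b b′ * coordinate b i (w b′) ≈ coordinate b i (w b′)
          select b′ = decide (b ≟ᶠ b′)
            where
            decide : Dec (b ≡ b′) → δ b b′ * coordinate b i (w b′) ≈ coordinate b i (w b′)
            decide (yes ≡.refl) = trans (*-congʳ (δ-refl b)) (*-identityˡ _)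
            decide (no b≢b′)    = trans (*-congˡ elsewhere) (trans (zeroʳ _) (sym elsewhere))
              where elsewhere = coordinate-elsewhere b b≢b′ (w∈W b′) i

      module Isomorphism (τ : ModuleType) where

        -- The basis of a block of type τ, indexed in a way that does not depend on the block.
        basisOf : ∀ b → blockType b ≡ τ → Fin (size τ) → Vector (Fin n)
        basisOf b ≡.refl = basis b

        coordinateOf : ∀ b → blockType b ≡ τ → Fin (size τ) → Vector (Fin n) → Carrier
        coordinateOf b ≡.refl = coordinate b

        transfer : ∀ b b′ → blockType b ≡ τ → blockType b′ ≡ τ → Vector (Fin n) → Vector (Fin n)
        transfer b b′ p p′ v = combination (λ i → coordinateOf b p i v) (basisOf b′ p′)

        private
          coordinateOf-cong : ∀ b p i {v w} → v ≈ᵥ w → coordinateOf b p i v ≈ coordinateOf b p i w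
          coordinateOf-cong b ≡.refl i eq = pairing-cong {f = dual b i} (λ _ → refl) eq

          coordinateOf-+ : ∀ b p i v w → coordinateOf b p i (v +ᵥ w) ≈ coordinateOf b p i v + coordinateOf b p i w
          coordinateOf-+ b ≡.refl i v w = trans (sum-cong λ y → distribˡ _ _ _) (sum-+ (λ y → dual b i y * v y) (λ y → dual b i y * w y))

          coordinateOf-* : ∀ b p i c v → coordinateOf b p i (c *ₗ v) ≈ c * coordinateOf b p i v
          coordinateOf-* b ≡.refl i c v = pairing-* (dual b i) c v

          combination∈W : ∀ b p a → W b (combination a (basisOf b p))
          combination∈W b ≡.refl a = a , λ y → refl

          coordinateOf-combination : ∀ b p a i → coordinateOf b p i (combination a (basisOf b p)) ≈ a i
          coordinateOf-combination b ≡.refl a i = coordinate-same b i a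

          expansion : ∀ b p {v} → W b v → v ≈ᵥ combination (λ i → coordinateOf b p i v) (basisOf b p)
          expansion b ≡.refl = component-of b

          coordinateOf-acts : ∀ b p {M X v} → Acts M X → W b v → ∀ i → coordinateOf b p i (M · v) ≈ sum (λ j → X τ i j * coordinateOf b p j v)
          coordinateOf-acts b ≡.refl {M} {X} {v} acts v∈W i = trans (pairing-cong {f = dual b i} (λ _ → refl) (W-acts b acts v∈W))
            (trans (coordinate-same b i (λ i → sum λ j → X τ i j * proj₁ v∈W j)) (sum-cong λ j → *-congˡ (sym (coordinate-of b v∈W j))))

          acts-on : ∀ b p {M X} → Acts M X → ∀ a → M · combination a (basisOf b p) ≈ᵥ combination (λ i → sum λ j → X τ i j * a j) (basisOf b p)
          acts-on b ≡.refl acts = acts-combination acts b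

        module _ (b b′ : Fin 8) (p : blockType b ≡ τ) (p′ : blockType b′ ≡ τ) where

          transfer∈W : ∀ v → W b′ (transfer b b′ p p′ v)
          transfer∈W v = combination∈W b′ p′ (λ i → coordinateOf b p i v)

          transfer-cong : ∀ {v w} → v ≈ᵥ w → transfer b b′ p p′ v ≈ᵥ transfer b b′ p p′ w
          transfer-cong eq = combination-congˡ (basisOf b′ p′) (λ i → coordinateOf-cong b p i eq)

          transfer-+ : ∀ {u v w} → w ≈ᵥ u +ᵥ v → transfer b b′ p p′ w ≈ᵥ transfer b b′ p p′ u +ᵥ transfer b b′ p p′ v
          transfer-+ {u} {v} eq y = trans (transfer-cong eq y) (trans (combination-congˡ (basisOf b′ p′) (λ i → coordinateOf-+ b p i u v) y)
            (combination-+ (λ i → coordinateOf b p i u) (λ i → coordinateOf b p i v) (basisOf b′ p′) y))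

          transfer-* : ∀ c {v w} → w ≈ᵥ c *ₗ v → transfer b b′ p p′ w ≈ᵥ c *ₗ transfer b b′ p p′ v
          transfer-* c {v} eq y = trans (transfer-cong eq y) (trans (combination-congˡ (basisOf b′ p′) (λ i → coordinateOf-* b p i c v) y)
            (combination-* c (λ i → coordinateOf b p i v) (basisOf b′ p′) y))

          transfer-T : ∀ {M} → T M → ∀ {v w} → W b v → w ≈ᵥ M · v → transfer b b′ p p′ w ≈ᵥ M · transfer b b′ p p′ v
          transfer-T M∈T {v} v∈W eq y = trans (transfer-cong eq y)
            (trans (combination-congˡ (basisOf b′ p′) (coordinateOf-acts b p (proj₂ (T-acts M∈T)) v∈W) y)
              (sym (acts-on b′ p′ (proj₂ (T-acts M∈T)) (λ i → coordinateOf b p i v) y)))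

          transfer-injective : ∀ {v w} → W b v → W b w → transfer b b′ p p′ v ≈ᵥ transfer b b′ p p′ w → v ≈ᵥ w
          transfer-injective {v} {w} v∈W w∈W eq y = trans (expansion b p v∈W y) (trans (combination-congˡ (basisOf b p) same y) (sym (expansion b p w∈W y)))
            where
            same : ∀ i → coordinateOf b p i v ≈ coordinateOf b p i w
            same i = trans (sym (coordinateOf-combination b′ p′ (λ i → coordinateOf b p i v) i))
              (trans (coordinateOf-cong b′ p′ i eq) (coordinateOf-combination b′ p′ (λ i → coordinateOf b p i w) i))

        transfer-transfer : ∀ b b′ p p′ {v} → W b′ v → transfer b b′ p p′ (transfer b′ b p′ p v) ≈ᵥ v
        transfer-transfer b b′ p p′ {v} v∈W y = trans (combination-congˡ (basisOf b′ p′)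
          (λ i → coordinateOf-combination b p (λ i → coordinateOf b′ p′ i v) i) y) (sym (expansion b′ p′ v∈W y))

      -- The matrix unit that fixes the first basis vector of W b, and annihilates the modules of the other types.
      detector : Fin 8 → Matrix n
      detector b = unitMatrix (position (blockType b) (first (blockType b)) (first (blockType b)))

      detector-fixes : ∀ b → detector b · basis b (first (blockType b)) ≈ᵥ basis b (first (blockType b))
      detector-fixes b y = trans (unit-moves b _ _ _ (basis∈W b _) y)
        (trans (*-congʳ (trans (dual-same b _ _) (δ-refl (first (blockType b))))) (*-identityˡ _))

      detector-annihilates : ∀ b b′ → blockType b ≢ blockType b′ → ∀ {v} → W b′ v → detector b · v ≈ᵥ zeroᵥ
      detector-annihilates b b′ τ≢τ′ v∈W y = trans (W-acts b′ (unitMatrix-acts _) v∈W y)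
        (combination-0 {v = basis b′} (λ i → sum-0 λ j → trans (*-congʳ (trans (ι-unitAt _ (blockType b′) i j) (δ-≢ (τ≢τ′ ∘ same-type i j)))) (zeroˡ _)) y)
        where
        same-type : ∀ i j → position (blockType b′) i j ≡ position (blockType b) (first (blockType b)) (first (blockType b)) → blockType b ≡ blockType b′
        same-type i j eq = ≡.sym (≡.cong proj₁ (≡.trans (≡.sym (entry-position _ i j)) (≡.trans (≡.cong entry eq) (entry-position _ _ _))))

module ComplexLinearAlgebra where

  open import Defs hiding (S)
  open RealArithmetic
  open ComplexArithmetic
  open LinearAlgebra
  open Coordinatisation using (Embedding)
  open Eigenvectors
  open Eigenbases
  open import Data.Fin.Properties using (any?)
  open import Data.List.Base as List using ([]; _∷_; length)
  open import Data.List.Relation.Binary.Pointwise.Base using (Pointwise; []; _∷_)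
  open import Data.List.Relation.Unary.All using ([]; _∷_)
  open import Data.List.Relation.Unary.AllPairs using (AllPairs; []; _∷_; allPairs?)
  open import Data.List.Relation.Unary.Any using (Any; here; there)
  open import Data.Vec.Base using ([]; _∷_)
  open import Relation.Binary.PropositionalEquality using (_≡_; _≢_)
  open import Relation.Nullary hiding (⌊_⌋)

  conjugate : ℤ√2 → ℤ√2
  conjugate (a +√ b) = a +√ (ℤ.- b)

  gap : ℤ√2 → ℤ√2 → ℤ√2
  gap x y = x +₂ ⌊ -1ℤ ⌋ *₂ y

  -- The difference of x and y has nonzero norm.
  Separated : ℤ√2 → ℤ√2 → Set
  Separated x y = y +₂ gap x y ≡ x × irrational (gap x y *₂ conjugate (gap x y)) ≡ 0ℤ × rational (gap x y *₂ conjugate (gap x y)) ≢ 0ℤ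

  separated? : ∀ x y → Dec (Separated x y)
  separated? x y = (y +₂ gap x y ≟√ x) ×-dec ((irrational (gap x y *₂ conjugate (gap x y)) ℤₚ.≟ 0ℤ)
                   ×-dec ¬? (rational (gap x y *₂ conjugate (gap x y)) ℤₚ.≟ 0ℤ))

  -- Each eigenvalue in the list θ with its positions there.
  Groups : ℕ → Set
  Groups m = List (ℤ√2 × List (Fin m))

  record Grouping {m : ℕ} (θ : Vec ℤ√2 m) (groups : Groups m) : Set where
    field
      values     : All (λ (x , ks) → ∀ i → lookup θ (List.lookup ks i) ≡ x) groups
      injective  : All (λ (x , ks) → ∀ i j → List.lookup ks i ≡ List.lookup ks j → i ≡ j) groups
      inhabited  : All (λ (x , ks) → Σ[ k ∈ Fin m ] lookup θ k ≡ x) groups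
      exhaustive : All (λ (x , ks) → ∀ k → (∃[ i ] List.lookup ks i ≡ k) ⊎ Separated (lookup θ k) x) groups
      covering   : ∀ k → Any (λ (x , ks) → lookup θ k ≡ x) groups
      distinct   : AllPairs (λ (x , _) (y , _) → Separated x y) groups

  grouping? : ∀ {m} (θ : Vec ℤ√2 m) groups → Dec (Grouping θ groups)
  grouping? θ groups = map′
    (λ (v , i , h , e , c , d) → record { values = v ; injective = i ; inhabited = h ; exhaustive = e ; covering = c ; distinct = d })
    (λ g → let open Grouping g in values , injective , inhabited , exhaustive , covering , distinct)
    (All.all? (λ (x , ks) → all? λ i → lookup θ (List.lookup ks i) ≟√ x) groups ×-dec
     (All.all? (λ (x , ks) → all? λ i → all? λ j → (List.lookup ks i ≟ᶠ List.lookup ks j) →-dec (i ≟ᶠ j)) groups ×-dec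
     (All.all? (λ (x , ks) → any? λ k → lookup θ k ≟√ x) groups ×-dec
     (All.all? (λ (x , ks) → all? λ k → (any? λ i → List.lookup ks i ≟ᶠ k) ⊎-dec separated? (lookup θ k) x) groups ×-dec
     ((all? λ k → Any.any? (λ (x , ks) → lookup θ k ≟√ x) groups) ×-dec
      allPairs? (λ (x , _) (y , _) → separated? x y) groups)))))

  module _ {A B : Set} {R : A → B → Set} where

    All-transport : ∀ {P : A → Set} {Q : B → Set} → (∀ {x y} → R x y → P x → Q y) → ∀ {xs ys} → Pointwise R xs ys → All P xs → All Q ys
    All-transport f []       []       = []
    All-transport f (r ∷ rs) (p ∷ ps) = f r p ∷ All-transport f rs ps

    Any-transport : ∀ {P : A → Set} {Q : B → Set} → (∀ {x y} → R x y → P x → Q y) → ∀ {xs ys} → Pointwise R xs ys → Any P xs → Any Q ys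
    Any-transport f (r ∷ rs) (here p)  = here (f r p)
    Any-transport f (r ∷ rs) (there i) = there (Any-transport f rs i)

    AllPairs-transport : ∀ {P : A → A → Set} {Q : B → B → Set} → (∀ {x y x′ y′} → R x y → R x′ y′ → P x x′ → Q y y′) →
                         ∀ {xs ys} → Pointwise R xs ys → AllPairs P xs → AllPairs Q ys
    AllPairs-transport f []       []       = []
    AllPairs-transport f (r ∷ rs) (p ∷ ps) = All-transport (λ r′ → f r r′) rs p ∷ AllPairs-transport f rs ps

  module ComplexAlgebra (R : RealNumbers) where
    open Complex R
    open ComplexNumbers R

    S : Summation ℂ-ring
    S = summation ℂ-ring

    embedding : Embedding ℂ-ring
    embedding = record { ι = fromℤ ; ι-0 = CommutativeRing.refl ℂ-ring ; ι-1 = fromℤ-1 ; ι-+ = fromℤ-+ ; ι-* = fromℤ-* }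

    apartness : Apartness ℂ-ring S
    apartness = record
      { _#0 = _# 0# ; #0-resp = #0-resp ; ¬0#0 = 0≈⇒¬# ; 1#0 = #0-resp fromℤ-1 (fromℤ#0 {+ 1} λ ())
      ; *#0ˡ = *#0ˡ ; *#0ʳ = *#0ʳ ; sum#0 = sum#0 ; inverse = inverse }

    fromℤ-inverse : ∀ {k} → k ≢ 0ℤ → ∃[ c ] c * fromℤ k ≈ 1#
    fromℤ-inverse k≢0 = inverse (fromℤ#0 k≢0)

    √2 : RealNumbers.Carrier R
    √2 = proj₁ (SquareRoot.√2-exists R)

    √2-isSquareRoot : RealNumbers.IsSquareRoot R (RealNumbers.fromℕ R 2) √2
    √2-isSquareRoot = proj₂ (SquareRoot.√2-exists R)

    private
      module ℝ = Reals R
      module ℂR = CommutativeRing ℂ-ring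
      open IntegerMultiples using (module Integers)
      open Integers ℂ-ring using (solve; _:=_; _:+_; _:*_)

      r : ℂ
      r = fromℝ √2

      rr≈2 : r * r ≈ fromℤ (+ 2)
      rr≈2 = ℝ.trans (ℝ.solve 1 (λ s → s ℝ.:* s ℝ.:- ℝ.con (+ 0) ℝ.:* ℝ.con (+ 0) ℝ.:= s ℝ.:* s) ℝ.refl √2) (proj₂ √2-isSquareRoot)
           , ℝ.solve 1 (λ s → s ℝ.:* ℝ.con (+ 0) ℝ.:+ ℝ.con (+ 0) ℝ.:* s ℝ.:= ℝ.con (+ 0)) ℝ.refl √2

    value : ℤ√2 → ℂ
    value (a +√ b) = fromℤ a + fromℤ b * r

    value-⌊⌋ : ∀ k → value ⌊ k ⌋ ≈ fromℤ k
    value-⌊⌋ k = ℂR.trans (ℂR.+-congˡ {fromℤ k} (ℂR.zeroˡ r)) (ℂR.+-identityʳ (fromℤ k))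

    embedding₂ : Embedding₂ ℂ-ring
    embedding₂ = record { ι = value ; ι-0 = value-⌊⌋ 0ℤ ; ι-+ = value-+ ; ι-* = value-* }
      where
      value-+ : ∀ x y → value (x +₂ y) ≈ value x + value y
      value-+ (a +√ b) (c +√ d) = ℂR.trans (ℂR.+-cong (fromℤ-+ a c) (ℂR.*-congʳ {r} (fromℤ-+ b d)))
        (solve 5 (λ a b c d r → (a :+ c) :+ (b :+ d) :* r := (a :+ b :* r) :+ (c :+ d :* r)) ℂR.refl (fromℤ a) (fromℤ b) (fromℤ c) (fromℤ d) r)
      value-* : ∀ x y → value (x *₂ y) ≈ value x * value y
      value-* (a +√ b) (c +√ d) = ℂR.trans (ℂR.+-cong
        (ℂR.trans (fromℤ-+ (a ℤ.* c) (+ 2 ℤ.* (b ℤ.* d))) (ℂR.+-cong (fromℤ-* a c)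
          (ℂR.trans (fromℤ-* (+ 2) (b ℤ.* d)) (ℂR.*-cong (ℂR.sym rr≈2) (fromℤ-* b d)))))
        (ℂR.*-congʳ {r} (ℂR.trans (fromℤ-+ (a ℤ.* d) (b ℤ.* c)) (ℂR.+-cong (fromℤ-* a d) (fromℤ-* b c)))))
        (solve 5 (λ a b c d r → (a :* c :+ r :* r :* (b :* d)) :+ (a :* d :+ b :* c) :* r := (a :+ b :* r) :* (c :+ d :* r))
          ℂR.refl (fromℤ a) (fromℤ b) (fromℤ c) (fromℤ d) r)

    open Embedding₂ embedding₂ using (ι-+; ι-*)
    open Spectral ℂ-ring S apartness embedding₂ public using (module Eigenbasis)
    open Subspaces ℂ-ring S apartness public using (Basis)

    separated-gap : ∀ {x y} → Separated x y → (value x - value y) # 0#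
    separated-gap {x} {y} (sum≡ , irr≡0 , rat≢0) = #0-resp (ℂR.sym difference) (*#0ˡ {value g} {value (conjugate g)}
        (#0-resp (ℂR.trans (ℂR.sym (value-⌊⌋ k)) (ℂR.trans (ℂR.reflexive (≡.cong (λ b → value (k +√ b)) (≡.sym irr≡0))) (ι-* g (conjugate g))))
          (fromℤ#0 rat≢0)))
      where
      g = gap x y
      k = rational (g *₂ conjugate g)
      difference : value x - value y ≈ value g
      difference = ℂR.trans (ℂR.+-congʳ { - value y} (ℂR.trans (ℂR.reflexive (≡.cong value (≡.sym sum≡))) (ι-+ y g))) (cancel (value y) (value g))
        where
        cancel : ∀ a b → (a + b) - a ≈ b
        cancel = solve 2 (λ a b → (a :+ b) :- a := b) ℂR.refl
          where open Integers ℂ-ring using (_:-_)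

    fromBasis : ∀ {I : Set} {W : ℂ^ I → Set} {k} {v : Fin k → ℂ^ I} → Basis W v → IsBasis W v
    fromBasis B = record { members = Basis.members B ; independent = Basis.independent B ; spanning = Basis.spanning B }

    Matches : ∀ {m} → ℤ√2 × List (Fin m) → ℂ × ℕ → Set
    Matches (x , ks) (μ , k) = μ ≈ value x × length ks ≡ k

    module _ {n m : ℕ} (φ : Fin m → Fin n) (φ⁻¹ : Fin n → Fin m) (φ-φ⁻¹ : ∀ y → φ (φ⁻¹ y) ≡ y) (φ-injective : Injective _≡_ _≡_ φ)
      {Mᵗ V D : Table m} {θ : Vec ℤ√2 m} {N : ℤ} (N≢0 : N ≢ 0ℤ) (table : Diagonalizes Mᵗ V D θ N)
      (M : Matrix n) (M-φ : ∀ y z → M (φ y , φ z) ≈ value (lookup (lookup Mᵗ y) z))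
      {groups : Groups m} (grouping : Grouping θ groups) {θs : List (ℂ × ℕ)} (matches : Pointwise Matches groups θs) where

      private
        N⁻¹ = fromℤ-inverse N≢0
        module G = Grouping grouping
        module B = Eigenbasis φ φ⁻¹ φ-φ⁻¹ φ-injective table (proj₁ N⁻¹) (ℂR.trans (ℂR.*-congˡ {proj₁ N⁻¹} (value-⌊⌋ N)) (proj₂ N⁻¹)) M M-φ

        value-cong : ∀ {x y} → x ≡ y → value x ≈ value y
        value-cong eq = ℂR.reflexive (≡.cong value eq)

        apart : ∀ {x y μ ν} → μ ≈ value x → ν ≈ value y → Separated x y → μ # ν
        apart {x} {y} {μ} {ν} μ≈x ν≈y s = difference#0⇒# (#0-resp (ℂR.+-cong (ℂR.sym μ≈x) (ℂR.-‿cong (ℂR.sym ν≈y))) (separated-gap {x} {y} s))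

        Eligible : ℤ√2 × List (Fin m) → Set
        Eligible (x , ks) = (∀ i → lookup θ (List.lookup ks i) ≡ x) × (∀ i j → List.lookup ks i ≡ List.lookup ks j → i ≡ j)
                          × (∀ k → (∃[ i ] List.lookup ks i ≡ k) ⊎ Separated (lookup θ k) x)

        dimension : ∀ {g μk} → Matches g μk → Eligible g → HasDim (Eigenspace M (proj₁ μk)) (proj₂ μk)
        dimension {x , ks} {μ , _} (μ≈x , ≡.refl) (vals , inj , exh) = B.eigenvector ∘ List.lookup ks
          , fromBasis (B.eigenspace-basis μ (List.lookup ks) (λ {i} {j} → inj i j)
              (λ i → ℂR.trans (value-cong {lookup θ (List.lookup ks i)} {x} (vals i)) (ℂR.sym μ≈x))
              (λ k → Sum.map₂ (λ s → #0-resp (ℂR.+-congˡ {value (lookup θ k)} (ℂR.-‿cong (ℂR.sym μ≈x))) (separated-gap {lookup θ k} {x} s)) (exh k)))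

        inhabitant : ∀ {g : ℤ√2 × List (Fin m)} {μk} → Matches g μk → Σ[ k ∈ Fin m ] lookup θ k ≡ proj₁ g → NonZero (Eigenspace M (proj₁ μk))
        inhabitant {x , _} (μ≈x , _) (k , eq) = B.eigenvector k
          , (λ y → ℂR.trans (B.eigen-equation k y) (ℂR.*-congʳ {B.eigenvector k y} (ℂR.trans (value-cong {lookup θ k} {x} eq) (ℂR.sym μ≈x))))
          , B.eigenvector-nonzero k

      private
        distinct′ : AllPairs (λ (θ , _) (θ′ , _) → θ # θ′) θs
        distinct′ = AllPairs-transport {R = Matches {m}} (λ {g} {μk} {g′} {νk} (μ≈x , _) (ν≈y , _) → apart {proj₁ g} {proj₁ g′} {proj₁ μk} {proj₁ νk} μ≈x ν≈y) matches G.distinct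

        eigenvalues′ : All (λ (μ , _) → NonZero (Eigenspace M μ)) θs
        eigenvalues′ = All-transport {R = Matches {m}} {P = λ (x , _) → Σ[ k ∈ Fin m ] lookup θ k ≡ x} {Q = λ (μ , _) → NonZero (Eigenspace M μ)}
          (λ {g} {μk} → inhabitant {g} {μk}) matches G.inhabited

        multiplicities′ : All (λ (μ , k) → HasDim (Eigenspace M μ) k) θs
        multiplicities′ = All-transport {R = Matches {m}} {P = Eligible} {Q = λ (μ , k) → HasDim (Eigenspace M μ) k}
          (λ {g} {μk} → dimension {g} {μk}) matches (All.zip (G.values , All.zip (G.injective , G.exhaustive)))

        exhaust : ∀ μ → ∃[ k ] μ ≈ value (lookup θ k) → Any (λ (ν , _) → μ ≈ ν) θs
        exhaust μ (k , eq) = Any-transport {R = Matches {m}} (λ {g} (ν≈x , _) θ≡x → ℂR.trans eq (ℂR.trans (value-cong {lookup θ k} {proj₁ g} θ≡x) (ℂR.sym ν≈x))) matches (G.covering k)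

        exhaustive′ : ∀ μ → NonZero (Eigenspace M μ) → Any (λ (ν , _) → μ ≈ ν) θs
        exhaustive′ μ nonzero = exhaust μ (B.eigenvalue-of nonzero)

      hasSpectrum : HasSpectrum M θs
      hasSpectrum = record
        { distinct = distinct′ ; eigenvalues = eigenvalues′ ; multiplicities = multiplicities′ ; exhaustive = exhaustive′ }

module TypeSpectra where

  open import Defs hiding (S)
  open LocalStructure
  open Model
  open VertexOrderings
  open ComplexArithmetic
  open IntegerBases
  open MatrixUnits
  open Eigenvectors
  open ComplexLinearAlgebra
  open import Data.Fin.Base using (suc)
  open import Data.Fin.Properties using (any?)
  open import Data.Fin.Subset using (Subset; ∣_∣)
  open import Data.List.Base using ([]; _∷_)
  open import Data.List.Relation.Binary.Pointwise.Base using (Pointwise; []; _∷_)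
  open import Data.Nat.Base using (suc)
  open import Data.Nat.Properties using (_≤?_)
  open import Data.Vec.Base using ([]; _∷_; map)
  open import Data.Vec.Properties using (lookup-map; []=⇒lookup; lookup⇒[]=)
  open import Relation.Binary.PropositionalEquality using (_≡_; _≢_)
  open import Relation.Nullary hiding (⌊_⌋)
  open import Relation.Nullary.Decidable using (does-⇔)
  open import Agda.Builtin.FromNat using (fromNat)
  open import Agda.Builtin.FromNeg using (fromNeg)

  endpoint multiplicity diameter : ModuleType → ℕ
  endpoint typeI   = 0
  endpoint typeII  = 1
  endpoint typeIII = 2
  endpoint typeIV  = 2
  endpoint typeV   = 3
  endpoint typeVI  = 3
  multiplicity typeI   = 1
  multiplicity typeII  = 2
  multiplicity typeIII = 1
  multiplicity typeIV  = 2
  multiplicity typeV   = 1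
  multiplicity typeVI  = 1
  diameter typeI   = 4
  diameter typeII  = 3
  diameter typeIII = 1
  diameter typeIV  = 2
  diameter typeV   = 0
  diameter typeVI  = 1

  shape : ∀ τ → Vec ℕ (suc (diameter τ))
  shape typeI   = 1 ∷ 1 ∷ 1 ∷ 1 ∷ 1 ∷ []
  shape typeII  = 1 ∷ 1 ∷ 2 ∷ 1 ∷ []
  shape typeIII = 1 ∷ 1 ∷ []
  shape typeIV  = 1 ∷ 2 ∷ 1 ∷ []
  shape typeV   = 1 ∷ []
  shape typeVI  = 1 ∷ 1 ∷ []

  -- Position in the basis of the basis vectors with the j-th support.
  onSupport : ∀ τ j → Fin (lookup (shape τ) j) → Fin (size τ)
  onSupport typeI   0F _  = 0F
  onSupport typeI   1F _  = 1F
  onSupport typeI   2F _  = 2F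
  onSupport typeI   3F _  = 3F
  onSupport typeI   4F _  = 4F
  onSupport typeII  0F _  = 0F
  onSupport typeII  1F _  = 1F
  onSupport typeII  2F 0F = 2F
  onSupport typeII  2F 1F = 3F
  onSupport typeII  3F _  = 4F
  onSupport typeIII 0F _  = 0F
  onSupport typeIII 1F _  = 1F
  onSupport typeIV  0F _  = 0F
  onSupport typeIV  1F 0F = 1F
  onSupport typeIV  1F 1F = 2F
  onSupport typeIV  2F _  = 3F
  onSupport typeV   0F _  = 0F
  onSupport typeVI  0F _  = 0F
  onSupport typeVI  1F _  = 1F

  levelSet : ModuleType → Subset 5
  levelSet τ = tabulate λ i → does (any? λ j → lookup (supports τ) j ≟ toℕ i)

  blocksOfType : ModuleType → Subset 8
  blocksOfType τ = tabulate λ b → does (blockType b ≟ᵀ τ)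

  abstract
    onSupport-injective : ∀ τ j i i′ → onSupport τ j i ≡ onSupport τ j i′ → i ≡ i′
    onSupport-injective = from-yes (allTypes? λ τ → all? λ j → all? λ i → all? λ i′ → (onSupport τ j i ≟ᶠ onSupport τ j i′) →-dec (i ≟ᶠ i′))

    onSupport-support : ∀ τ j i → lookup (supports τ) (onSupport τ j i) ≡ endpoint τ ℕ.+ toℕ j
    onSupport-support = from-yes (allTypes? λ τ → all? λ j → all? λ i → lookup (supports τ) (onSupport τ j i) ≟ endpoint τ ℕ.+ toℕ j)

    onSupport-covers : ∀ τ j k → (∃[ i ] onSupport τ j i ≡ k) ⊎ lookup (supports τ) k ≢ endpoint τ ℕ.+ toℕ j
    onSupport-covers = from-yes (allTypes? λ τ → all? λ j → all? λ k →
      (any? λ i → onSupport τ j i ≟ᶠ k) ⊎-dec ¬? (lookup (supports τ) k ≟ endpoint τ ℕ.+ toℕ j))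

    support-first : ∀ τ → lookup (supports τ) (first τ) ≡ endpoint τ
    support-first = from-yes (allTypes? λ τ → lookup (supports τ) (first τ) ≟ endpoint τ)

    only-first : ∀ τ k → (Fin 1 × first τ ≡ k) ⊎ lookup (supports τ) k ≢ endpoint τ
    only-first = from-yes (allTypes? λ τ → all? λ k → (yes 0F ×-dec (first τ ≟ᶠ k)) ⊎-dec ¬? (lookup (supports τ) k ≟ endpoint τ))

    endpoint-minimal : ∀ τ k → endpoint τ ≤ lookup (supports τ) k
    endpoint-minimal = from-yes (allTypes? λ τ → all? λ k → endpoint τ ≤? lookup (supports τ) k)

    support-bounded : ∀ τ k → lookup (supports τ) k ≤ 4
    support-bounded = from-yes (allTypes? λ τ → all? λ k → lookup (supports τ) k ≤? 4)

    support-increasing : ∀ τ i j → toℕ i ≤ toℕ j → lookup (supports τ) i ≤ lookup (supports τ) j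
    support-increasing = from-yes (allTypes? λ τ → all? λ i → all? λ j → (toℕ i ≤? toℕ j) →-dec (lookup (supports τ) i ≤? lookup (supports τ) j))

  ∣levelSet∣ : ∀ τ → ∣ levelSet τ ∣ ≡ suc (diameter τ)
  ∣levelSet∣ typeI   = ≡.refl
  ∣levelSet∣ typeII  = ≡.refl
  ∣levelSet∣ typeIII = ≡.refl
  ∣levelSet∣ typeIV  = ≡.refl
  ∣levelSet∣ typeV   = ≡.refl
  ∣levelSet∣ typeVI  = ≡.refl

  ∣blocksOfType∣ : ∀ τ → ∣ blocksOfType τ ∣ ≡ multiplicity τ
  ∣blocksOfType∣ typeI   = ≡.refl
  ∣blocksOfType∣ typeII  = ≡.refl
  ∣blocksOfType∣ typeIII = ≡.refl
  ∣blocksOfType∣ typeIV  = ≡.refl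
  ∣blocksOfType∣ typeV   = ≡.refl
  ∣blocksOfType∣ typeVI  = ≡.refl

  ∈tabulate⇔ : ∀ {n} {P : Fin n → Set} (P? : ∀ i → Dec (P i)) i → i ∈ˢ tabulate (does ∘ P?) ⇔ P i
  ∈tabulate⇔ P? i = mk⇔ (λ i∈ → does-true (P? i) (≡.trans (≡.sym (lookup∘tabulate (does ∘ P?) i)) ([]=⇒lookup i∈)))
                        (λ p → lookup⇒[]= i _ (≡.trans (lookup∘tabulate (does ∘ P?) i) (dec-true (P? i) p)))

  typeGroups : ∀ τ → Groups (size τ)
  typeGroups typeI   = (3 +√ 0 , 0F ∷ []) ∷ (2 +√ 0 , 1F ∷ []) ∷ (-1 +√ 1 , 2F ∷ []) ∷ (-1 +√ 0 , 3F ∷ []) ∷ (-1 +√ -1 , 4F ∷ []) ∷ []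
  typeGroups typeII  = (2 +√ 0 , 0F ∷ 1F ∷ []) ∷ (-1 +√ 1 , 2F ∷ []) ∷ (-1 +√ 0 , 3F ∷ []) ∷ (-1 +√ -1 , 4F ∷ []) ∷ []
  typeGroups typeIII = (2 +√ 0 , 0F ∷ []) ∷ (-1 +√ 0 , 1F ∷ []) ∷ []
  typeGroups typeIV  = (2 +√ 0 , 0F ∷ []) ∷ (-1 +√ 1 , 1F ∷ []) ∷ (-1 +√ 0 , 2F ∷ []) ∷ (-1 +√ -1 , 3F ∷ []) ∷ []
  typeGroups typeV   = (-1 +√ 0 , 0F ∷ []) ∷ []
  typeGroups typeVI  = (-1 +√ 1 , 0F ∷ []) ∷ (-1 +√ -1 , 1F ∷ []) ∷ []

  modelGroups : Groups 28
  modelGroups = (3 +√ 0 , # 0 ∷ [])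
              ∷ (2 +√ 0 , # 1 ∷ # 5 ∷ # 6 ∷ # 10 ∷ # 11 ∷ # 15 ∷ # 17 ∷ # 21 ∷ [])
              ∷ (-1 +√ 1 , # 2 ∷ # 7 ∷ # 12 ∷ # 18 ∷ # 22 ∷ # 26 ∷ [])
              ∷ (-1 +√ 0 , # 3 ∷ # 8 ∷ # 13 ∷ # 16 ∷ # 19 ∷ # 23 ∷ # 25 ∷ [])
              ∷ (-1 +√ -1 , # 4 ∷ # 9 ∷ # 14 ∷ # 20 ∷ # 24 ∷ # 27 ∷ []) ∷ []

  abstract
    typeGrouping : ∀ τ → Grouping (eigenvalues τ) (typeGroups τ)
    typeGrouping = from-yes (allTypes? λ τ → grouping? (eigenvalues τ) (typeGroups τ))

    modelGrouping : Grouping modelEigenvalues modelGroups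
    modelGrouping = from-yes (grouping? modelEigenvalues modelGroups)

  module Spectra (R : RealNumbers) where
    open Complex R
    open ComplexNumbers R
    open ComplexAlgebra R
    private module ℂR = CommutativeRing ℂ-ring

    θ₊ θ₋ : ℂ
    θ₊ = fromℤ -1ℤ + fromℝ √2
    θ₋ = fromℤ -1ℤ - fromℝ √2

    integral : ∀ k → fromℤ k ≈ value ⌊ k ⌋
    integral k = ℂR.sym (value-⌊⌋ k)

    θ₊≈ : θ₊ ≈ value (-1ℤ +√ 1ℤ)
    θ₊≈ = ℂR.+-congˡ {fromℤ -1ℤ} (ℂR.sym (ℂR.trans (ℂR.*-congʳ {fromℝ √2} fromℤ-1) (ℂR.*-identityˡ (fromℝ √2))))

    θ₋≈ : θ₋ ≈ value (-1ℤ +√ -1ℤ)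
    θ₋≈ = ℂR.+-congˡ {fromℤ -1ℤ} (ℂR.trans (ℂR.-‿cong (ℂR.sym (ℂR.trans (ℂR.*-congʳ {fromℝ √2} fromℤ-1) (ℂR.*-identityˡ (fromℝ √2)))))
      (-‿distribˡ-* (fromℤ 1ℤ) (fromℝ √2)))
      where open import Algebra.Properties.Ring ℂR.ring using (-‿distribˡ-*)

    spectrum : ModuleType → List (ℂ × ℕ)
    spectrum typeI   = (fromℤ (+ 3) , 1) ∷ (fromℤ (+ 2) , 1) ∷ (θ₊ , 1) ∷ (fromℤ -1ℤ , 1) ∷ (θ₋ , 1) ∷ []
    spectrum typeII  = (fromℤ (+ 2) , 2) ∷ (θ₊ , 1) ∷ (fromℤ -1ℤ , 1) ∷ (θ₋ , 1) ∷ []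
    spectrum typeIII = (fromℤ (+ 2) , 1) ∷ (fromℤ -1ℤ , 1) ∷ []
    spectrum typeIV  = (fromℤ (+ 2) , 1) ∷ (θ₊ , 1) ∷ (fromℤ -1ℤ , 1) ∷ (θ₋ , 1) ∷ []
    spectrum typeV   = (fromℤ -1ℤ , 1) ∷ []
    spectrum typeVI  = (θ₊ , 1) ∷ (θ₋ , 1) ∷ []

    graphSpectrum : List (ℂ × ℕ)
    graphSpectrum = (fromℤ (+ 3) , 1) ∷ (fromℤ (+ 2) , 8) ∷ (θ₊ , 6) ∷ (fromℤ -1ℤ , 7) ∷ (θ₋ , 6) ∷ []

    type-matches : ∀ τ → Pointwise Matches (typeGroups τ) (spectrum τ)
    type-matches typeI   = (integral (+ 3) , ≡.refl) ∷ (integral (+ 2) , ≡.refl) ∷ (θ₊≈ , ≡.refl) ∷ (integral -1ℤ , ≡.refl) ∷ (θ₋≈ , ≡.refl) ∷ []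
    type-matches typeII  = (integral (+ 2) , ≡.refl) ∷ (θ₊≈ , ≡.refl) ∷ (integral -1ℤ , ≡.refl) ∷ (θ₋≈ , ≡.refl) ∷ []
    type-matches typeIII = (integral (+ 2) , ≡.refl) ∷ (integral -1ℤ , ≡.refl) ∷ []
    type-matches typeIV  = (integral (+ 2) , ≡.refl) ∷ (θ₊≈ , ≡.refl) ∷ (integral -1ℤ , ≡.refl) ∷ (θ₋≈ , ≡.refl) ∷ []
    type-matches typeV   = (integral -1ℤ , ≡.refl) ∷ []
    type-matches typeVI  = (θ₊≈ , ≡.refl) ∷ (θ₋≈ , ≡.refl) ∷ []

    graph-matches : Pointwise Matches modelGroups graphSpectrum
    graph-matches = (integral (+ 3) , ≡.refl) ∷ (integral (+ 2) , ≡.refl) ∷ (θ₊≈ , ≡.refl) ∷ (integral -1ℤ , ≡.refl) ∷ (θ₋≈ , ≡.refl) ∷ []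

    type-spectrum : ∀ τ → HasSpectrum (fromRows (rows τ)) (spectrum τ)
    type-spectrum τ = hasSpectrum id id (λ _ → ≡.refl) id {N = dualDenominator} (λ ()) (type-diagonalizes τ) (fromRows (rows τ))
      (λ y z → ℂR.trans (integral (lookup (lookup (rows τ) y) z)) (ℂR.reflexive (≡.cong value (entry-map y z)))) (typeGrouping τ) (type-matches τ)
      where
      entry-map : ∀ y z → ⌊ lookup (lookup (rows τ) y) z ⌋ ≡ lookup (lookup (typeMatrix τ) y) z
      entry-map y z = ≡.sym (≡.trans (≡.cong (λ v → lookup v z) (lookup-map y (map ⌊_⌋) (rows τ))) (lookup-map z ⌊_⌋ (lookup (rows τ) y)))

    module _ {n : ℕ} (Γ : Graph n) {x : Fin n} {y : Fin 6 → Fin n} (C : Coordinates Γ x y) where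
      open Coordinates C

      adjacency-φ : ∀ i j → adjacencyMatrix Γ (φ i , φ j) ≈ (if does (modelAdj? i j) then 1# else 0#)
      adjacency-φ i j = ℂR.reflexive (≡.cong (if_then 1# else 0#) (does-⇔ (φ-adjacent i j) (Graph.adj? Γ (φ i) (φ j)) (modelAdj? i j)))

      graph-spectrum : HasSpectrum (adjacencyMatrix Γ) graphSpectrum
      graph-spectrum = hasSpectrum φ φ⁻¹ φ-φ⁻¹ φ-injective {N = modelDenominator} (λ ()) model-diagonalizes (adjacencyMatrix Γ)
        (λ i j → ℂR.trans (adjacency-φ i j) (ℂR.trans (bit (does (modelAdj? i j))) (ℂR.reflexive (≡.cong value (entry-tabulate i j)))))
        modelGrouping graph-matches
        where
        bit : ∀ b → (if b then 1# else 0#) ≈ value ⌊ if b then 1 else 0 ⌋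
        bit true  = ℂR.trans (ℂR.sym fromℤ-1) (integral (+ 1))
        bit false = integral (+ 0)
        entry-tabulate : ∀ i j → ⌊ if does (modelAdj? i j) then 1 else 0 ⌋ ≡ lookup (lookup modelMatrix i) j
        entry-tabulate i j = ≡.sym (≡.trans (≡.cong (λ v → lookup v j) (lookup∘tabulate (λ y → tabulate λ z → ⌊ if does (modelAdj? y z) then 1 else 0 ⌋) i))
          (lookup∘tabulate (λ z → ⌊ if does (modelAdj? i z) then 1 else 0 ⌋) j))

module Decompositions where

  open import Defs hiding (S)
  open LocalStructure
  open Model
  open VertexOrderings
  open ComplexArithmetic
  open LinearAlgebra
  open IntegerBases
  open Coordinatisation
  open ComplexLinearAlgebra
  open TypeSpectra
  open import Data.Bool.Base using (Bool)
  open import Data.Bool.Properties using (∧-identityʳ; ∧-zeroʳ)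
  open import Data.List.Base using ([]; _∷_)
  open import Data.List.Relation.Binary.Pointwise.Base using ([]; _∷_)
  open import Data.Vec.Base using ([]; _∷_)
  open import Relation.Binary.PropositionalEquality using (_≡_)
  open import Relation.Nullary hiding (⌊_⌋)
  open import Agda.Builtin.FromNat using (fromNat)
  open import Agda.Builtin.FromNeg using (fromNeg)

  module Masked (K : CommutativeRing 0ℓ 0ℓ) (S : Summation K) where
    open Linear K S

    masked-sum : ∀ {n} (c : Bool) (y : Fin n) (v : Fin n → Carrier) →
                 sum (λ z → (if does (y ≟ᶠ z) ∧ c then 1# else 0#) * v z) ≈ (if c then v y else 0#)
    masked-sum true  y v = trans (sum-cong λ z → *-congʳ (reflexive (≡.cong (if_then 1# else 0#) (∧-identityʳ (does (y ≟ᶠ z)))))) (sum-δ y v)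
    masked-sum false y v = sum-0 λ z → trans (*-congʳ (reflexive (≡.cong (if_then 1# else 0#) (∧-zeroʳ (does (y ≟ᶠ z)))))) (zeroˡ _)

  module Decomposition (R : RealNumbers) {n : ℕ} (Γ : Graph n) (levels : Distance.HasNeighbourLevels Γ) (x : Fin n)
    (o : VertexOrdering Γ x) (C : Coordinates Γ x (VertexOrdering.y o)) where
    open Complex R
    open Terwilliger R Γ 4 x
    open ComplexNumbers R
    open ComplexAlgebra R
    open Spectra R
    open Coordinates C
    private
      module o  = VertexOrdering o
      module ℂR = CommutativeRing ℂ-ring
      module O  = Orderings.OfOrdering Γ levels x o

      u-labels = O.u-labels C
      z-labels = O.z-labels C
      π = proj₁ u-labels
      e = proj₁ z-labels

    F : Family
    F = basisFamily π e

    good : Good F (dualFamily F)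
    good = basisFamily-good π e (λ i j → proj₁ (proj₂ u-labels))

    basisII : V → Vec V 5
    basisII ν = ν ∷ A · ν ∷ E* 3 · A · A · ν ∷ E* 3 · A · A · A · ν ∷ E* 4 · A · A · A · ν ∷ []

    basisIII : V → Vec V 2
    basisIII ν = ν ∷ A · ν ∷ []

    basisIV : V → Vec V 4
    basisIV ν = ν ∷ A · ν ∷ E* 3 · A · A · ν ∷ E* 4 · A · A · ν ∷ []

    basisVI : V → Vec V 2
    basisVI ν = ν ∷ E* 4 · A · ν ∷ []

    basisVectors : ∀ b → Vec V (size (blockType b))
    basisVectors 0F = e* 0 ∷ e* 1 ∷ e* 2 ∷ e* 3 ∷ e* 4 ∷ []
    basisVectors 1F = basisII (fromEssential o.u (1 ∷ -1 ∷ 0 ∷ []))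
    basisVectors 2F = basisII (fromEssential o.u (1 ∷ 1 ∷ -2 ∷ []))
    basisVectors 3F = basisIII (fromEssential o.y (1 ∷ -1 ∷ -1 ∷ 1 ∷ -1 ∷ 1 ∷ []))
    basisVectors 4F = basisIV (fromEssential o.y (1 ∷ -1 ∷ 0 ∷ 0 ∷ 1 ∷ -1 ∷ []))
    basisVectors 5F = basisIV (fromEssential o.y (1 ∷ -1 ∷ 2 ∷ -2 ∷ -1 ∷ 1 ∷ []))
    basisVectors 6F = fromEssential o.z (-1 ∷ 1 ∷ -1 ∷ 1 ∷ -1 ∷ 1 ∷ -1 ∷ 1 ∷ 1 ∷ -1 ∷ 1 ∷ -1 ∷ []) ∷ []
    basisVectors 7F = basisVI (fromEssential o.z (-1 ∷ 1 ∷ 1 ∷ -1 ∷ 1 ∷ -1 ∷ -1 ∷ 1 ∷ -1 ∷ 1 ∷ 1 ∷ -1 ∷ []))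

    basis : ∀ b → Fin (size (blockType b)) → V
    basis b = lookup (basisVectors b)

    module Tr = Embedded.Transport ℂ-ring S embedding φ φ⁻¹ φ-φ⁻¹ φ-injective

    private
      level-φ : ∀ i k → does (dist Γ x (φ i) ≟ k) ≡ does (modelLevel i ≟ k)
      level-φ i k = ≡.cong (λ l → does (l ≟ k)) (φ-level i)

      E-φ : ∀ k v i → (E* k · v) (φ i) ≈ (if does (modelLevel i ≟ k) then v (φ i) else 0#)
      E-φ k v i = ℂR.trans (Masked.masked-sum ℂ-ring S (does (dist Γ x (φ i) ≟ k)) (φ i) v)
        (ℂR.reflexive (≡.cong (if_then v (φ i) else 0#) (level-φ i k)))

    module Op = Tr.Operators A E* (adjacency-φ Γ C) E-φ

    private
      represents-II : ∀ {ν p} → Tr.Represents ν p → ∀ j → Tr.Represents (lookup (basisII ν) j) (lookup (integerII p) j)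
      represents-II {ν} {p} rep 0F = rep
      represents-II {ν} {p} rep 1F = Op.represents-A {ν} {p} rep
      represents-II {ν} {p} rep 2F = Op.represents-E 3 {A · A · ν} {adjacentSum (adjacentSum p)}
        (Op.represents-A {A · ν} {adjacentSum p} (Op.represents-A {ν} {p} rep))
      represents-II {ν} {p} rep 3F = Op.represents-E 3 {A · A · A · ν} {adjacentSum (adjacentSum (adjacentSum p))}
        (Op.represents-A {A · A · ν} {adjacentSum (adjacentSum p)} (Op.represents-A {A · ν} {adjacentSum p} (Op.represents-A {ν} {p} rep)))
      represents-II {ν} {p} rep 4F = Op.represents-E 4 {A · A · A · ν} {adjacentSum (adjacentSum (adjacentSum p))}
        (Op.represents-A {A · A · ν} {adjacentSum (adjacentSum p)} (Op.represents-A {A · ν} {adjacentSum p} (Op.represents-A {ν} {p} rep)))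

      represents-III : ∀ {ν p} → Tr.Represents ν p → ∀ j → Tr.Represents (lookup (basisIII ν) j) (lookup (integerIII p) j)
      represents-III {ν} {p} rep 0F = rep
      represents-III {ν} {p} rep 1F = Op.represents-A {ν} {p} rep

      represents-IV : ∀ {ν p} → Tr.Represents ν p → ∀ j → Tr.Represents (lookup (basisIV ν) j) (lookup (integerIV p) j)
      represents-IV {ν} {p} rep 0F = rep
      represents-IV {ν} {p} rep 1F = Op.represents-A {ν} {p} rep
      represents-IV {ν} {p} rep 2F = Op.represents-E 3 {A · A · ν} {adjacentSum (adjacentSum p)}
        (Op.represents-A {A · ν} {adjacentSum p} (Op.represents-A {ν} {p} rep))
      represents-IV {ν} {p} rep 3F = Op.represents-E 4 {A · A · ν} {adjacentSum (adjacentSum p)}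
        (Op.represents-A {A · ν} {adjacentSum p} (Op.represents-A {ν} {p} rep))

      represents-VI : ∀ {ν p} → Tr.Represents ν p → ∀ j → Tr.Represents (lookup (basisVI ν) j) (lookup (integerVI p) j)
      represents-VI {ν} {p} rep 0F = rep
      represents-VI {ν} {p} rep 1F = Op.represents-E 4 {A · ν} {adjacentSum p} (Op.represents-A {ν} {p} rep)

      represents-e* : ∀ k → Tr.Represents (e* k) (indicator k)
      represents-e* k = Tr.represents-indicator k {e* k} (λ i → ℂR.reflexive (≡.cong (if_then 1# else 0#) (level-φ i k)))

      represents-u : ∀ a → Tr.Represents (fromEssential o.u a) (essential (λ i → uᴹ (lookup π i)) a)
      represents-u = Tr.represents-essential {o = o.u} {λ i → uᴹ (lookup π i)} (proj₂ (proj₂ u-labels))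

      represents-y : ∀ a → Tr.Represents (fromEssential o.y a) (essential yᴹ a)
      represents-y = Tr.represents-essential {o = o.y} {yᴹ} (λ j → ≡.sym (φ-y j))

      represents-z : ∀ a → Tr.Represents (fromEssential o.z a) (essential (λ s → zᴹ (twist e s)) a)
      represents-z = Tr.represents-essential {o = o.z} {λ s → zᴹ (twist e s)} (proj₂ z-labels)

    represented : ∀ b j → Tr.Represents (basis b j) (member F b j)
    represented 0F 0F = represents-e* 0
    represented 0F 1F = represents-e* 1
    represented 0F 2F = represents-e* 2
    represented 0F 3F = represents-e* 3
    represented 0F 4F = represents-e* 4
    represented 1F = represents-II (represents-u (1 ∷ -1 ∷ 0 ∷ []))
    represented 2F = represents-II (represents-u (1 ∷ 1 ∷ -2 ∷ []))
    represented 3F = represents-III (represents-y (1 ∷ -1 ∷ -1 ∷ 1 ∷ -1 ∷ 1 ∷ []))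
    represented 4F = represents-IV (represents-y (1 ∷ -1 ∷ 0 ∷ 0 ∷ 1 ∷ -1 ∷ []))
    represented 5F = represents-IV (represents-y (1 ∷ -1 ∷ 2 ∷ -2 ∷ -1 ∷ 1 ∷ []))
    represented 6F 0F = represents-z (-1 ∷ 1 ∷ -1 ∷ 1 ∷ -1 ∷ 1 ∷ -1 ∷ 1 ∷ 1 ∷ -1 ∷ 1 ∷ -1 ∷ [])
    represented 7F = represents-VI (represents-z (-1 ∷ 1 ∷ 1 ∷ -1 ∷ 1 ∷ -1 ∷ -1 ∷ 1 ∷ -1 ∷ 1 ∷ 1 ∷ -1 ∷ []))

module ModuleTheory where

  open import Defs hiding (S)
  open LocalStructure using (module Distance)
  open Model
  open ComplexArithmetic
  open LinearAlgebra
  open IntegerBases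
  open Coordinatisation
  open MatrixUnits
  open BlockModules
  open ComplexLinearAlgebra
  open TypeSpectra
  open Decompositions
  open import Data.Fin.Properties using (any?)
  open import Data.Product.Base using (∃)
  open import Relation.Binary.PropositionalEquality using (_≡_)
  open import Relation.Nullary hiding (⌊_⌋)
  open import Relation.Unary using (_∈_; _⊆_)
  open import Agda.Builtin.FromNat using (fromNat)
  open import Agda.Builtin.FromNeg using (fromNeg)

  module TerwilligerModules (R : RealNumbers) {n : ℕ} (Γ : Graph n) (levels : Distance.HasNeighbourLevels Γ) (x : Fin n)
    (o : VertexOrdering Γ x) (C : Coordinates Γ x (VertexOrdering.y o)) where
    open Complex R
    open Terwilliger R Γ 4 x
    open ComplexNumbers R
    open ComplexAlgebra R
    open Spectra R
    open Decomposition R Γ levels x o C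
    private
      module ℂR = CommutativeRing ℂ-ring
      d⁻¹ = fromℤ-inverse {denominator} (λ ())
      module B = Op.Basis F good (proj₁ d⁻¹) (proj₂ d⁻¹) basis represented

      blockBasis : BlockBasis ℂ-ring S basis
      blockBasis = record
        { dual = B.dual ; dual-same = B.dual-same′ ; dual-other = B.dual-other′ ; complete = B.complete′ ; orthogonal = B.orthogonal′ }

      open BlockBasis blockBasis using (Acts; BlockMatrix; act; acts-resp; acts-I; acts-+; acts-*; acts-∘; component; expand)

      T-acts : ∀ {M} → M ∈ T → Σ[ X ∈ BlockMatrix ] Acts M X
      T-acts A∈T            = _ , B.acts-A
      T-acts (E*∈T {k} _)   = _ , B.acts-E k
      T-acts I∈T            = _ , acts-I
      T-acts (+-closed p q) = _ , acts-+ (proj₂ (T-acts p)) (proj₂ (T-acts q))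
      T-acts (*-closed c p) = _ , acts-* c (proj₂ (T-acts p))
      T-acts (∘-closed p q) = _ , acts-∘ (proj₂ (T-acts p)) (proj₂ (T-acts q))
      T-acts (resp eq p)    = _ , acts-resp eq (proj₂ (T-acts p))

      T-E : ∀ k → k ≤ 4 → E* k ∈ T
      T-E k = E*∈T

      module M = Modules ℂ-ring S embedding apartness basis blockBasis
      module Alg = M.Algebra A E* B.acts-A B.acts-E B.E-basis T A∈T T-E +-closed *-closed ∘-closed T-acts fromℤ-inverse

    T-dimension : HasDim T 75
    T-dimension = Alg.unitMatrix , fromBasis Alg.T-basis

    W : Fin 8 → Pred V 0ℓ
    W = Alg.W

    isTModule : ∀ b → IsTModule (W b)
    isTModule b = record
      { isSubspace = record { resp = Alg.W-resp b ; 0-closed = Alg.W-0 b ; +-closed = Alg.W-+ b ; *-closed = Alg.W-* b }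
      ; T-closed   = λ M∈T → Alg.W-T b M∈T
      }

    isIrreducible : ∀ b → IsIrreducible (W b)
    isIrreducible b = record
      { isTModule = isTModule b
      ; nonZero   = basis b (first (blockType b)) , Alg.basis∈W b (first (blockType b)) , Alg.basis-nonzero b (first (blockType b))
      ; simple    = simple
      }
      where
      simple : ∀ (U : Pred V 0ℓ) → IsTModule U → NonZero U → U ⊆ W b → W b ⊆ U
      simple U U-module nonzero U⊆W = Alg.simple b U U.resp U.0-closed U.+-closed U.*-closed (IsTModule.T-closed U-module) nonzero U⊆W
        where module U = IsSubspace (IsTModule.isSubspace U-module)

    private
      conj-basis : ∀ b j y → conj (basis b j y) ≈ basis b j y
      conj-basis b j = Tr.everywhere {λ y → conj (basis b j y) ≈ basis b j y} λ i → ℂR.trans (conj-cong (represented b j i))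
        (ℂR.trans (conj-fromℤ (lookup (member F b j) i)) (ℂR.sym (represented b j i)))

      conj∈W : ∀ b {v} → v ∈ W b → (conj ∘ v) ∈ W b
      conj∈W b {v} (a , eq) = conj ∘ a , λ y → ℂR.trans (conj-cong (eq y)) (ℂR.trans (conj-sum (λ j → a j * basis b j y))
        (Summation.sum-cong S {f = λ j → conj (a j * basis b j y)} {λ j → conj (a j) * basis b j y} λ j →
          ℂR.trans (conj-* (a j) (basis b j y)) (ℂR.*-congˡ {conj (a j)} (conj-basis b j y))))

    decomposition : IsOrthogonalDecomposition W
    decomposition = record
      { irreducible = isIrreducible
      ; orthogonal  = λ b b′ b≢b′ {v} {w} v∈W w∈W → Alg.W-orthogonal b b′ b≢b′ {v} {conj ∘ w} v∈W (conj∈W b′ w∈W)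
      ; spanning    = λ v → (λ b → component b v) , (λ b → Alg.component∈W b v) , expand v
      ; direct      = Alg.W-direct
      }

    isomorphic : ∀ b b′ → blockType b ≡ blockType b′ → W b ≅ W b′
    isomorphic b b′ eq = record
      { to            = λ (v , v∈W) → Iso.transfer b b′ p p′ v , Iso.transfer∈W b b′ p p′ v
      ; cong          = Iso.transfer-cong b b′ p p′
      ; +-homo        = λ _ _ _ → Iso.transfer-+ b b′ p p′
      ; *-homo        = λ a _ _ → Iso.transfer-* b b′ p p′ a
      ; T-equivariant = λ M∈T (v , v∈W) _ → Iso.transfer-T b b′ p p′ M∈T v∈W
      ; bijective     = (λ {(_ , v∈W)} {(_ , w∈W)} → Iso.transfer-injective b b′ p p′ v∈W w∈W)
                      , λ (w , w∈W) → (Iso.transfer b′ b p′ p w , Iso.transfer∈W b′ b p′ p w)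
                          , λ eq y → ℂR.trans (Iso.transfer-cong b b′ p p′ eq y) (Iso.transfer-transfer b b′ p p′ w∈W y)
      }
      where
      module Iso = Alg.Isomorphism (blockType b′)
      p  = eq
      p′ = ≡.refl

    isomorphic⇒same-type : ∀ b b′ → W b ≅ W b′ → blockType b ≡ blockType b′
    isomorphic⇒same-type b b′ iso = decide (blockType b ≟ᵀ blockType b′)
      where
      open _≅_ iso
      f = first (blockType b)
      v₀ z₀ : ∃ (W b)
      v₀ = basis b f , Alg.basis∈W b f
      z₀ = 0ᵥ , Alg.W-0 b
      decide : Dec (blockType b ≡ blockType b′) → blockType b ≡ blockType b′
      decide (yes eq) = eq
      decide (no τ≢τ′) = ⊥-elim (0≈⇒¬# (vanishes (proj₁ nonzero)) (proj₂ nonzero))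
        where
        nonzero = Alg.basis-nonzero b f
        image≈0 : proj₁ (to v₀) ≈ᵥ 0ᵥ
        image≈0 y = ℂR.trans (T-equivariant (Alg.unitMatrix∈T _) v₀ v₀ (λ y → ℂR.sym (Alg.detector-fixes b y)) y)
          (Alg.detector-annihilates b b′ τ≢τ′ (proj₂ (to v₀)) y)
        zero-image : proj₁ (to z₀) ≈ᵥ 0ᵥ
        zero-image y = ℂR.trans (*-homo 0# v₀ z₀ (λ y → ℂR.sym (ℂR.zeroˡ (basis b f y))) y) (ℂR.zeroˡ (proj₁ (to v₀) y))
        vanishes : basis b f ≈ᵥ 0ᵥ
        vanishes = proj₁ bijective {v₀} {z₀} (λ y → ℂR.trans (image≈0 y) (ℂR.sym (zero-image y)))

    classification : ∀ b b′ → (W b ≅ W b′) ⇔ (blockType b ≡ blockType b′)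
    classification b b′ = mk⇔ (isomorphic⇒same-type b b′) (isomorphic b b′)

    seed : ∀ b → SeedOf (basis b (first (blockType b))) (W b) (endpoint (blockType b))
    seed b = fromBasis (Alg.image-basis b (endpoint (blockType b)) (λ (_ : Fin 1) → first (blockType b)) (λ { {0F} {0F} _ → ≡.refl })
      (λ _ → support-first (blockType b)) (λ j → Sum.map₁ (λ (i , eq) → i , eq) (only-first (blockType b) j)))

    supported-at : ∀ b j → basis b j ≈ᵥ E* (lookup (supports (blockType b)) j) · basis b j
    supported-at b j = Alg.E-fixes b {lookup (supports (blockType b)) j} {j} ≡.refl

    moduleData : ∀ b → let τ = blockType b in
      ModuleData (W b) (endpoint τ) (multiplicity τ) (size τ) (diameter τ) (shape τ) (basisVectors b) (rows τ) (spectrum τ)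
    moduleData b = record
      { hasEndpoint     = Alg.image-nonzero b (first τ) (support-first τ)
                        , λ i i<r → Alg.image-zero b λ j eq → ℕₚ.<⇒≱ i<r (≡.subst (endpoint τ ≤_) eq (endpoint-minimal τ j))
      ; hasMultiplicity = 8 , W , decomposition , blocksOfType τ , same-type , ∣blocksOfType∣ τ
      ; hasDimension    = basis b , isBasis
      ; hasDiameter     = levelSet τ , occupied , ∣levelSet∣ τ
      ; hasShape        = λ j → basis b ∘ onSupport τ j , fromBasis (Alg.image-basis b (endpoint τ ℕ.+ toℕ j) (onSupport τ j)
                            (λ {i} {i′} → onSupport-injective τ j i i′) (onSupport-support τ j) (onSupport-covers τ j))
      ; isPureBasis     = record
        { isBasis    = isBasis
        ; support    = lookup (supports τ)
        ; pure       = λ j → support-bounded τ j , Alg.basis-nonzero b j , basis b j , supported-at b j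
        ; increasing = support-increasing τ
        }
      ; represents      = act B.acts-A b
      ; hasSpectrum     = type-spectrum τ
      }
      where
      τ = blockType b
      isBasis : IsBasis (W b) (basis b)
      isBasis = fromBasis (Alg.W-basis b)
      same-type : ∀ i → i ∈ˢ blocksOfType τ ⇔ (W i ≅ W b)
      same-type i = mk⇔ (isomorphic i b ∘ Equivalence.to blocks) (Equivalence.from blocks ∘ isomorphic⇒same-type i b)
        where blocks = ∈tabulate⇔ (λ i → blockType i ≟ᵀ τ) i
      level? : ∀ (i : Fin 5) → Dec (∃[ j ] lookup (supports τ) j ≡ toℕ i)
      level? i = any? λ j → lookup (supports τ) j ≟ toℕ i
      occupied : ∀ i → i ∈ˢ levelSet τ ⇔ NonZero (image (E* (toℕ i)) (W b))
      occupied i = mk⇔ (λ i∈ → let j , eq = Equivalence.to (∈tabulate⇔ level? i) i∈ in Alg.image-nonzero b j eq)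
        (λ nonzero → Equivalence.from (∈tabulate⇔ level? i) (decide nonzero (level? i)))
        where
        decide : NonZero (image (E* (toℕ i)) (W b)) → Dec (∃[ j ] lookup (supports τ) j ≡ toℕ i) → ∃[ j ] lookup (supports τ) j ≡ toℕ i
        decide nonzero (yes p)   = p
        decide nonzero (no none) = ⊥-elim (Alg.image-zero b (λ j eq → none (j , eq)) nonzero)

open import Defs hiding (S)
open LocalStructure using (module Distance; module Regular; Enumeration)
open Labels using (Tree)
open Matchings using (triangles)
open Model
open Triangles
open VertexOrderings
open IntegerBases
open ComplexLinearAlgebra
open TypeSpectra
open ModuleTheory
open import Data.List.Base using ([]; _∷_)
open import Data.List.Relation.Binary.Pointwise.Base using ([]; _∷_)
open import Data.Unit.Base using (⊤)
open import Data.Vec.Base using ([]; _∷_)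
open import Relation.Binary.PropositionalEquality using (_≡_)
open import Relation.Nullary hiding (⌊_⌋)
open import Relation.Unary using (_∈_)
open import Agda.Builtin.FromNat using ()
open import Agda.Builtin.FromNeg using ()
open import Data.Nat.Base using (_^_)

module Conclusions (R : RealNumbers) {n : ℕ} (Γ : Graph n) (levels : Distance.HasNeighbourLevels Γ) (everything : Enumeration {n} (λ _ → ⊤) 28) where
  open Complex R
  open ComplexAlgebra R

  module _ (x : Fin n) where
    open Terwilliger R Γ 4 x

    tree-with-far : ∃[ tree ] Existence.Far Γ levels x triangles (Tree.y tree)
    tree-with-far = Existence.triangular-tree Γ levels x

    tree : Tree Γ x
    tree = proj₁ tree-with-far

    vertexOrdering : VertexOrdering Γ x
    vertexOrdering = Orderings.WithCoordinates.ordering Γ levels x (Labelling.coordinates Γ levels everything x tree (proj₂ tree-with-far))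
      (Tree.y-level tree) (Tree.y-injective tree) (Tree.y-covers tree) (proj₂ tree-with-far)

    module _ (o : VertexOrdering Γ x) where

      coordinates : Coordinates Γ x (VertexOrdering.y o)
      coordinates = Labelling.coordinates Γ levels everything x (Orderings.OfOrdering.tree Γ levels x o) (Orderings.OfOrdering.far Γ levels x o)

      open TerwilligerModules R Γ levels x o coordinates public

      W′ : Fin 8 → Pred V 0ℓ
      W′ = lookup (W 0F ∷ W 1F ∷ W 2F ∷ W 3F ∷ W 4F ∷ W 5F ∷ W 6F ∷ W 7F ∷ [])

      W≡W′ : ∀ b → W b ≡ W′ b
      W≡W′ 0F = ≡.refl
      W≡W′ 1F = ≡.refl
      W≡W′ 2F = ≡.refl
      W≡W′ 3F = ≡.refl
      W≡W′ 4F = ≡.refl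
      W≡W′ 5F = ≡.refl
      W≡W′ 6F = ≡.refl
      W≡W′ 7F = ≡.refl

      W′⊆W : ∀ b {v} → v ∈ W′ b → v ∈ W b
      W′⊆W b {v} = ≡.subst (v ∈_) (≡.sym (W≡W′ b))

      W⊆W′ : ∀ b {v} → v ∈ W b → v ∈ W′ b
      W⊆W′ b {v} = ≡.subst (v ∈_) (W≡W′ b)

      decomposition′ : IsOrthogonalDecomposition W′
      decomposition′ = record
        { irreducible = λ b → ≡.subst IsIrreducible (W≡W′ b) (D.irreducible b)
        ; orthogonal  = λ b b′ b≢b′ v∈ w∈ → D.orthogonal b b′ b≢b′ (W′⊆W b v∈) (W′⊆W b′ w∈)
        ; spanning    = λ v → let w , w∈ , eq = D.spanning v in w , (λ b → W⊆W′ b (w∈ b)) , eq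
        ; direct      = λ w w∈ → D.direct w (λ b → W′⊆W b (w∈ b))
        }
        where module D = IsOrthogonalDecomposition decomposition

      classification′ : ∀ b b′ → (W′ b ≅ W′ b′) ⇔ (blockType b ≡ blockType b′)
      classification′ b b′ = ≡.subst₂ (λ P Q → (P ≅ Q) ⇔ (blockType b ≡ blockType b′)) (W≡W′ b) (W≡W′ b′) (classification b b′)

    dimension : HasDim T 75
    dimension = T-dimension vertexOrdering

  graphSpectrumAt : (x : Fin n) → HasSpectrum (adjacencyMatrix Γ) (Spectra.graphSpectrum R)
  graphSpectrumAt x = Spectra.graph-spectrum R Γ (coordinates x (vertexOrdering x))

-- Stated for a variable number n of vertices: with 28 for n, type checking would
-- unfold the sums over the vertices.  For the same reason, the type of mainTheorem7
-- is inferred from this one.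
decompositionTheorem :
  (R : RealNumbers) {n : ℕ} (Γ : Graph n) (levels : Distance.HasNeighbourLevels Γ) (everything : Enumeration {n} (λ _ → ⊤) 28) (x₀ : Fin n) →
  let module ℝ = RealNumbers R
      open Complex R
      open Agda.Builtin.FromNeg using (fromNeg)
  in
  Σ[ √2 ∈ ℝ.Carrier ] ℝ.IsSquareRoot (ℝ.fromℕ 2) √2 ×
  (let θ₊ = fromℤ -1 + fromℝ √2
       θ₋ = fromℤ -1 - fromℝ √2
   in
   HasSpectrum (adjacencyMatrix Γ)
     ((fromℤ (ℤ.+ 3) , 1) ∷ (fromℤ (ℤ.+ 2) , 8) ∷ (θ₊ , 6) ∷ (fromℤ -1 , 7) ∷ (θ₋ , 6) ∷ []) ×
   ((x : Fin n) →
    let open Terwilliger R Γ 4 x in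
    HasDim T (5 ^ 2 ℕ.+ 5 ^ 2 ℕ.+ 2 ^ 2 ℕ.+ 4 ^ 2 ℕ.+ 1 ^ 2 ℕ.+ 2 ^ 2) ×
    5 ^ 2 ℕ.+ 5 ^ 2 ℕ.+ 2 ^ 2 ℕ.+ 4 ^ 2 ℕ.+ 1 ^ 2 ℕ.+ 2 ^ 2 ≡ 75 ×
    VertexOrdering Γ x ×
    ((o : VertexOrdering Γ x) →
     let open VertexOrdering o
         open Agda.Builtin.FromNat using (fromNat)
         ν₁ₐ = fromEssential u (1 ∷ -1 ∷ 0 ∷ [])
         ν₁ᵦ = fromEssential u (1 ∷ 1 ∷ -2 ∷ [])
         ν₂ₐ = fromEssential y (1 ∷ -1 ∷ -1 ∷ 1 ∷ -1 ∷ 1 ∷ [])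
         ν₂ᵦ = fromEssential y (1 ∷ -1 ∷ 0 ∷ 0 ∷ 1 ∷ -1 ∷ [])
         ν₂ᵧ = fromEssential y (1 ∷ -1 ∷ 2 ∷ -2 ∷ -1 ∷ 1 ∷ [])
         ν₃ₐ = fromEssential z (-1 ∷ 1 ∷ -1 ∷ 1 ∷ -1 ∷ 1 ∷ -1 ∷ 1 ∷ 1 ∷ -1 ∷ 1 ∷ -1 ∷ [])
         ν₃ᵦ = fromEssential z (-1 ∷ 1 ∷ 1 ∷ -1 ∷ 1 ∷ -1 ∷ -1 ∷ 1 ∷ -1 ∷ 1 ∷ 1 ∷ -1 ∷ [])
         basisII = λ ν → ν ∷ A · ν ∷ E* 3 · A · A · ν ∷ E* 3 · A · A · A · ν ∷ E* 4 · A · A · A · ν ∷ []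
         basisIII = λ ν → ν ∷ A · ν ∷ []
         basisIV = λ ν → ν ∷ A · ν ∷ E* 3 · A · A · ν ∷ E* 4 · A · A · ν ∷ []
         dataI = λ W → ModuleData W 0 1 5 4 (1 ∷ 1 ∷ 1 ∷ 1 ∷ 1 ∷ [])
           (e* 0 ∷ e* 1 ∷ e* 2 ∷ e* 3 ∷ e* 4 ∷ [])
           ( (0 ∷ 3 ∷ 0 ∷ 0 ∷ 0 ∷ [])
           ∷ (1 ∷ 0 ∷ 2 ∷ 0 ∷ 0 ∷ [])
           ∷ (0 ∷ 1 ∷ 0 ∷ 2 ∷ 0 ∷ [])
           ∷ (0 ∷ 0 ∷ 1 ∷ 1 ∷ 1 ∷ [])
           ∷ (0 ∷ 0 ∷ 0 ∷ 2 ∷ 1 ∷ [])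
           ∷ [] )
           ((fromℤ (ℤ.+ 3) , 1) ∷ (fromℤ (ℤ.+ 2) , 1) ∷ (θ₊ , 1) ∷ (fromℤ -1 , 1) ∷ (θ₋ , 1) ∷ [])
         dataII = λ W ν → SeedOf ν W 1 × A · ν ≈ᵥ E* 2 · A · ν ×
           ModuleData W 1 2 5 3 (1 ∷ 1 ∷ 2 ∷ 1 ∷ [])
           (basisII ν)
           ( (0 ∷ 2 ∷ 0 ∷ 0 ∷ 0 ∷ [])
           ∷ (1 ∷ 0 ∷ 2 ∷ -1 ∷ 0 ∷ [])
           ∷ (0 ∷ 1 ∷ 0 ∷ 1 ∷ 0 ∷ [])
           ∷ (0 ∷ 0 ∷ 1 ∷ 0 ∷ -1 ∷ [])
           ∷ (0 ∷ 0 ∷ 1 ∷ -2 ∷ 1 ∷ [])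
           ∷ [] )
           ((fromℤ (ℤ.+ 2) , 2) ∷ (θ₊ , 1) ∷ (fromℤ -1 , 1) ∷ (θ₋ , 1) ∷ [])
         dataIII = λ W ν → SeedOf ν W 2 × A · ν ≈ᵥ E* 3 · A · ν ×
           ModuleData W 2 1 2 1 (1 ∷ 1 ∷ [])
           (basisIII ν)
           ( (0 ∷ 2 ∷ [])
           ∷ (1 ∷ 1 ∷ [])
           ∷ [] )
           ((fromℤ (ℤ.+ 2) , 1) ∷ (fromℤ -1 , 1) ∷ [])
         dataIV = λ W ν → SeedOf ν W 2 × A · ν ≈ᵥ E* 3 · A · ν ×
           ModuleData W 2 2 4 2 (1 ∷ 2 ∷ 1 ∷ [])
           (basisIV ν)
           ( (0 ∷ 2 ∷ -1 ∷ 0 ∷ [])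
           ∷ (1 ∷ 0 ∷ 1 ∷ 2 ∷ [])
           ∷ (0 ∷ 1 ∷ 0 ∷ 1 ∷ [])
           ∷ (0 ∷ 1 ∷ 0 ∷ -1 ∷ [])
           ∷ [] )
           ((fromℤ (ℤ.+ 2) , 1) ∷ (θ₊ , 1) ∷ (fromℤ -1 , 1) ∷ (θ₋ , 1) ∷ [])
         dataV = λ W ν → SeedOf ν W 3 ×
           ModuleData W 3 1 1 0 (1 ∷ [])
           (ν ∷ [])
           ((-1 ∷ []) ∷ [])
           ((fromℤ -1 , 1) ∷ [])
         dataVI = λ W ν → SeedOf ν W 3 ×
           ModuleData W 3 1 2 1 (1 ∷ 1 ∷ [])
           (ν ∷ E* 4 · A · ν ∷ [])
           ( (-1 ∷ 2 ∷ [])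
           ∷ (1 ∷ -1 ∷ [])
           ∷ [] )
           ((θ₊ , 1) ∷ (θ₋ , 1) ∷ [])
     in
     ∃[ W₀ ] ∃[ W₁ₐ ] ∃[ W₁ᵦ ] ∃[ W₂ₐ ] ∃[ W₂ᵦ ] ∃[ W₂ᵧ ] ∃[ W₃ₐ ] ∃[ W₃ᵦ ]
     (let W = lookup (W₀ ∷ W₁ₐ ∷ W₁ᵦ ∷ W₂ₐ ∷ W₂ᵦ ∷ W₂ᵧ ∷ W₃ₐ ∷ W₃ᵦ ∷ [])
          type = lookup (typeI ∷ typeII ∷ typeII ∷ typeIII ∷ typeIV ∷ typeIV ∷ typeV ∷ typeVI ∷ [])
      in
      IsOrthogonalDecomposition W ×
      (∀ i j → (W i ≅ W j) ⇔ (type i ≡ type j)) ×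
      dataI W₀ ×
      dataII W₁ₐ ν₁ₐ × dataII W₁ᵦ ν₁ᵦ ×
      dataIII W₂ₐ ν₂ₐ ×
      dataIV W₂ᵦ ν₂ᵦ × dataIV W₂ᵧ ν₂ᵧ ×
      dataV W₃ₐ ν₃ₐ ×
      dataVI W₃ᵦ ν₃ᵦ))))
decompositionTheorem R Γ levels everything x₀ = ComplexAlgebra.√2 R , ComplexAlgebra.√2-isSquareRoot R , graphSpectrumAt x₀ , λ x →
  dimension x , ≡.refl , vertexOrdering x , λ o →
    W x o 0F , W x o 1F , W x o 2F , W x o 3F , W x o 4F , W x o 5F , W x o 6F , W x o 7F
  , decomposition′ x o
  , classification′ x o
  , moduleData x o 0F
  , (seed x o 1F , supported-at x o 1F 1F , moduleData x o 1F)
  , (seed x o 2F , supported-at x o 2F 1F , moduleData x o 2F)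
  , (seed x o 3F , supported-at x o 3F 1F , moduleData x o 3F)
  , (seed x o 4F , supported-at x o 4F 1F , moduleData x o 4F)
  , (seed x o 5F , supported-at x o 5F 1F , moduleData x o 5F)
  , (seed x o 6F , moduleData x o 6F)
  , (seed x o 7F , moduleData x o 7F)
  where open Conclusions R Γ levels everything

everyVertex : ∀ {n} → Enumeration {n} (λ _ → ⊤) n
everyVertex = record { at = id ; injective = id ; sound = λ _ → tt ; complete = λ {t} _ → t , ≡.refl }

mainTheorem7 = λ (R : RealNumbers) (Γ : Graph 28) (coxeter : IsCoxeterGraph Γ) →
  decompositionTheorem R Γ (Regular.hasNeighbourLevels Γ coxeter) everyVertex 0F
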